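{- The number of BM-special Triple O'Nan configurations on a non-classical orthogonal Buekenhout-Metz unital $\mathcal U_{a,b}$ in $\mathrm{PG}(2,q^2)$, $q$ odd, depends only on the value of $q$ and on whether $a$ is a square in $\mathbb F_{q^2}$ or not. That is, if $q$ is an odd prime power and $\mathcal U_{a,b}$, $\mathcal U_{a',b'}$ are two non-classical orthogonal Buekenhout-Metz unitals in $\mathrm{PG}(2,q^2)$ such that $a,a'$ are either both squares or both non-squares in $\mathbb F_{q^2}$, then $\mathcal U_{a,b}$ and $\mathcal U_{a',b'}$ contain the same number of BM-special Triple O'Nan configurations.
   Context: Points of $\mathrm{PG}(2,q^2)$ are written in homogeneous coordinates $(x,y,z)$. For $q$ odd and $a,b\in\mathbb F_{q^2}$ such that $d=(b-b^q)^2+4a^{q+1}$ is a non-square in $\mathbb F_q$, the orthogonal Buekenhout-Metz (BM) unital is $$\mathcal U_{a,b}=\{(x,ax^2+bx^{q+1}+r,1)\mid r\in\mathbb F_q,\ x\in\mathbb F_{q^2}\}\cup\{T_\infty=(0,1,0)\}.$$ It is classical if and only if $a=0$. The point $T_\infty$ is called the special point. A Triple O'Nan configuration of $\mathcal U$ is a set of six lines arising as follows: there is a quadrangle of four points of $\mathcal U$ (no three collinear) such that, for each of the three partitions of the four points into two pairs, the two lines joining the pairs meet in a point of $\mathcal U$; the six lines joining pairs of the four points form the Triple O'Nan. It is called BM-special if one of its six lines (as a line of $\mathrm{PG}(2,q^2)$) contains $T_\infty$. -}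

module Defs where

open import Algebra.Bundles using (CommutativeRing; Semiring)
import Algebra.Definitions.RawSemiring as RawSemiringDefs
open import Algebra.Structures using (IsCommutativeRing)
open import Data.Fin.Base using (Fin)
open import Data.Fin.Patterns using (0F; 1F; 2F; 3F)
open import Data.Nat.Base as ℕ using (ℕ; NonZero)
open import Data.Nat.Divisibility using () renaming (_∤_ to _∤ℕ_)
open import Data.Nat.Primality using (Prime)
open import Data.Product.Base using (Σ; ∃₂; ∃-syntax; _×_; _,_)
open import Data.Sum.Base using (_⊎_)
open import Data.Vec.Functional using (Vector; []; _∷_)
open import Function.Bundles using (_⇔_; _↔_; Inverse; mk⇔; Equivalence)
open import Level using (Level; suc)
open import Relation.Binary.Bundles using (Setoid)
open import Relation.Binary.PropositionalEquality
  using (_≡_; _≢_; setoid)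
open import Relation.Nullary.Negation using (¬_)
open import Relation.Unary using (Pred; _∈_)

private
  variable
    c ℓ : Level

OddPrimePower : Pred ℕ _
OddPrimePower q = ∃₂ λ p k → Prime p × NonZero k × q ≡ p ℕ.^ k × 2 ∤ℕ q

HasCardinality : Setoid c ℓ → ℕ → Set _
HasCardinality S n = Inverse S (setoid (Fin n))

record FiniteField c (n : ℕ) : Set (suc c) where
  infixl 7 _*_
  infixl 6 _+_
  infix  8 -_
  field
    Carrier           : Set c
    _+_ _*_           : Carrier → Carrier → Carrier
    -_                : Carrier → Carrier
    0# 1#             : Carrier
    isCommutativeRing : IsCommutativeRing _≡_ _+_ _*_ -_ 0# 1#
    1≢0               : 1# ≢ 0#
    inverse           : ∀ x → x ≢ 0# → ∃[ y ] x * y ≡ 1#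
    enumeration       : Carrier ↔ Fin n

  commutativeRing : CommutativeRing c c
  commutativeRing = record { isCommutativeRing = isCommutativeRing }

  open CommutativeRing commutativeRing public using (_-_; semiring)
  open RawSemiringDefs (Semiring.rawSemiring semiring) public using (_^_; sum) renaming (_×_ to _·_)

  IsSquare : Pred Carrier c
  IsSquare x = ∃[ y ] x ≡ y * y

module PG2 {c} (q : ℕ) (F : FiniteField c (q ℕ.^ 2)) where
  open FiniteField F

  -- The subfield of order q consists of the roots of X^q - X.
  𝔽q : Pred Carrier c
  𝔽q x = x ^ q ≡ x

  NonSquareIn𝔽q : Pred Carrier c
  NonSquareIn𝔽q x = x ∈ 𝔽q × ¬ (∃[ y ] y ∈ 𝔽q × x ≡ y * y)

  V : Set c
  V = Vector Carrier 3

  NonZeroVec : Pred V c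
  NonZeroVec v = ∃[ i ] v i ≢ 0#

  -- Homogeneous coordinates of points and, dually, of lines.  Coordinate
  -- triples are not quotiented by scalars: every predicate below is invariant
  -- under rescaling.
  record Point : Set c where
    constructor point
    field
      coords  : V
      nonZero : NonZeroVec coords

  record Line : Set c where
    constructor line
    field
      coords  : V
      nonZero : NonZeroVec coords

  infix 4 _∼_ _on-line_

  _∼_ : V → V → Set c
  v ∼ w = ∃[ s ] s ≢ 0# × (∀ i → v i ≡ s * w i)

  _on-line_ : Point → Line → Set c
  P on-line l = sum (λ i → Line.coords l i * Point.coords P i) ≡ 0#

  Collinear : Point → Point → Point → Set c
  Collinear P Q R = ∃[ l ] P on-line l × Q on-line l × R on-line l

  T∞ : Point
  T∞ = point (0# ∷ 1# ∷ 0# ∷ []) (1F , 1≢0)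

  IsOrthogonalBM : Carrier → Carrier → Set c
  IsOrthogonalBM a b = NonSquareIn𝔽q ((b - b ^ q) ^ 2 + 4 · a ^ (q ℕ.+ 1))

  𝒰 : Carrier → Carrier → Pred Point c
  𝒰 a b P =
    (∃₂ λ x r → r ∈ 𝔽q ×
       Point.coords P ∼ (x ∷ a * x ^ 2 + b * x ^ (q ℕ.+ 1) + r ∷ 1# ∷ []))
    ⊎ Point.coords P ∼ Point.coords T∞

  -- A unital is classical when it is a non-degenerate Hermitian curve, i.e.
  -- the set of isotropic points of a non-degenerate Hermitian form h.
  Classical : Pred Point c → Set c
  Classical U = Σ (Fin 3 → Fin 3 → Carrier) λ h →
      (∀ i j → h j i ≡ h i j ^ q)
    × (∀ v → NonZeroVec v → ∃[ i ] sum (λ j → h i j * v j) ≢ 0#)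
    × (∀ P → let v = Point.coords P in
         P ∈ U ⇔ sum (λ i → sum (λ j → v i ^ q * h i j * v j)) ≡ 0#)

  module _ (U : Pred Point c) where

    MeetInUnital : Point → Point → Point → Point → Set c
    MeetInUnital A B C D = ∃[ X ] X ∈ U × Collinear A B X × Collinear C D X

    -- The condition noThreeCollinear forces the four points to be distinct,
    -- since any two points lie on a common line.
    record ONanQuadrangle : Set c where
      field
        vertex           : Fin 4 → Point
        vertex∈U         : ∀ i → vertex i ∈ U
        noThreeCollinear : ∀ i j k → i ≢ j → j ≢ k → i ≢ k →
                           ¬ Collinear (vertex i) (vertex j) (vertex k)
        diagonal₁        : MeetInUnital (vertex 0F) (vertex 1F) (vertex 2F) (vertex 3F)
        diagonal₂        : MeetInUnital (vertex 0F) (vertex 2F) (vertex 1F) (vertex 3F)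
        diagonal₃        : MeetInUnital (vertex 0F) (vertex 3F) (vertex 1F) (vertex 2F)

      Side : Pred Line c
      Side l = ∃₂ λ i j → i ≢ j × vertex i on-line l × vertex j on-line l

    open ONanQuadrangle

    BMSpecial : Pred ONanQuadrangle c
    BMSpecial Q = ∃[ l ] l ∈ Side Q × T∞ on-line l

    -- A configuration is a set of six lines, so quadrangles are identified
    -- when they have the same sides.
    BMSpecialTripleONan : Setoid c c
    BMSpecialTripleONan = record
      { Carrier       = Σ ONanQuadrangle BMSpecial
      ; _≈_           = λ (Q , _) (Q′ , _) → ∀ l → l ∈ Side Q ⇔ l ∈ Side Q′
      ; isEquivalence = record
        { refl  = λ l → mk⇔ (λ s → s) (λ s → s)
        ; sym   = λ e l → mk⇔ (from (e l)) (to (e l))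
        ; trans = λ e f l → mk⇔ (λ s → to (f l) (to (e l) s))
                                (λ s → from (e l) (from (f l) s))
        }
      }
      where open Equivalence

{-# OPTIONS --safe #-}

-- Write x̄ = x^q.  No O'Nan configuration of U contains T∞, so the special side of a
-- BM-special Triple O'Nan carries two affine vertices and an affine diagonal point, and a
-- collineation group of U fixing T∞ moves it to the line x = 0.  There these points are
-- (0 , k + α), (0 , k + β) and (0 , k) with k, α, β in 𝔽q; let u⁻¹, v⁻¹ be the abscissas of
-- the other two vertices.  In terms of u, v the conditions that the seven points lie on U
-- determine the slopes of the sides and leave two equations, which are affine combinations
-- of values of the function u ↦ a ū/u - ā u/ū + (b - b̄) together with αβ(u v̄ - ū v).  The
-- constant b - b̄ cancels, so the configurations are parametrised independently of b, and
-- (u , v) ↦ (κ u , κ v) turns the parameters for a into those for κ² a.  Finally, a ≠ 0 since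
-- U is not classical, and a′/a is a square when a and a′ lie in the same square class.
module Submission where

open import Defs
open import Algebra.Bundles using (CommutativeRing)
open import Data.Empty using (⊥; ⊥-elim)
open import Data.Fin.Base as Fin using (Fin; zero; suc; fromℕ; inject₁; punchIn)
open import Data.Fin.Patterns using (0F; 1F; 2F; 3F)
open import Data.Fin.Permutation as Perm using (Permutation′; _⟨$⟩ʳ_; _⟨$⟩ˡ_; _∘ₚ_; transpose)
import Data.Fin.Properties as Fin
open import Data.List.Base as List using (List; tabulate; cartesianProduct)
open import Data.List.Membership.Propositional using () renaming (_∈_ to _∈ˡ_)
open import Data.List.Membership.Propositional.Properties using (∈-cartesianProduct⁺; ∈-tabulate⁺)
open import Data.List.Relation.Unary.Any using (here; there)
open import Data.Nat.Base as ℕ using (ℕ; zero; suc; s≤s)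
open import Data.Nat.Combinatorics using (nCn≡1; nCk≡n!/k![n-k]!; k![n∸k]!∣n!) renaming (_C_ to _choose_)
open import Data.Nat.Divisibility using (_∣_; divides; m∣m*n; ∣1⇒≡1; ∣⇒≤; m%n≡0⇒n∣m)
open import Data.Nat.DivMod using (m/n*n≡m; m≡m%n+[m/n]*n; m%n<n)
open import Data.Nat.Primality using (Prime; euclidsLemma; prime⇒nonTrivial)
import Data.Nat.Properties as ℕ
open import Data.Product.Base using (Σ; ∃; ∃-syntax; ∃₂; _×_; _,_; proj₁; proj₂)
open import Data.Sum.Base using (_⊎_; inj₁; inj₂; [_,_]′; fromInj₁; map₁)
open import Data.Vec.Functional using ([]; _∷_; replicate; removeAt)
open import Function.Base using (_∘_; _$_)
open import Function.Bundles using (mk⇔; Equivalence; Inverse)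
import Function.Construct.Composition as Composition
import Function.Construct.Symmetry as Symmetry
open import Function.Properties.Inverse using (↔⇒↣)
open import Relation.Binary.Bundles using (Setoid)
open import Relation.Binary.Definitions using (DecidableEquality; tri<; tri≈; tri>) renaming (Decidable to Decidable₂)
open import Relation.Nullary.Decidable
  using (Dec; yes; no; map′; via-injection; toWitness; _→-dec_; _×-dec_; _⊎-dec_; ¬?)
open import Relation.Nullary.Negation using (¬_; contradiction)
open import Relation.Unary using (Pred; _∈_; Decidable)

-- The bijection is not induced by a map between the two unitals; it lives on coordinates in which b
-- disappears, and reciprocal abscissas are chosen for this. Take a point of abscissa X = w⁻¹ on a
-- line of slope m whose intercept lies in 𝔽q. Multiplied by w w̄, its membership in U becomes ⟦m ,
-- w⟧ = h(w) + γ with γ = b - b̄ and h(w) = a w̄/w - ā w/w̄: linear over 𝔽q in m, with b present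
-- only in an additive constant. All sides but the special one cross it at intercepts k, k + α or k
-- + β, so every condition has this form. The equations for u and v fix the slope m of the central
-- side. A further diagonal point has w = (β v - α u)/(β - α), whose weights add up to 1, so
-- subtracting the same combination of the first two equations removes γ.
--
-- A bijective count also needs the parameter to be recovered from the set of sides. Only one side
-- passes through T∞, which fixes s; what remains ambiguous is the order of α, β and of u, v. The
-- number itself is never computed: validity of a parameter is decidable over a finite field, and
-- this makes the count exist.

-- Polynomial identities with integer coefficients in a commutative ring

module IntegerCoefficients {c ℓ} (R : CommutativeRing c ℓ) where
  open import Algebra.Solver.Ring.AlmostCommutativeRing using (fromCommutativeRing; _-Raw-AlmostCommutative⟶_)
  open import Data.Integer.Base as ℤ using (ℤ; +_; -[1+_])
  import Data.Integer.Properties as ℤ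
  open import Data.Maybe.Base using (Maybe; just; nothing)
  open import Data.Nat.Base as ℕ using (ℕ; zero; suc; _≤_)
  import Data.Nat.Properties as ℕ
  open import Data.Sum.Base using (inj₁; inj₂)
  import Relation.Binary.PropositionalEquality as ≡
  open import Relation.Nullary.Decidable.Core using (yes; no)
  open CommutativeRing R
  open import Algebra.Properties.Ring ring
    using (-‿distribˡ-*; -‿distribʳ-*; -‿involutive; -0#≈0#)
  open import Algebra.Properties.AbelianGroup +-abelianGroup using (⁻¹-∙-comm)
  open import Algebra.Properties.Semiring.Mult.TCOptimised semiring
    using (×-homo-+; ×1-homo-*) renaming (_×_ to _·_)
  open import Relation.Binary.Reasoning.Setoid setoid

  -- The optimised multiple computes `1 · 1#` to `1#`, so `:0` and `:1` denote `0#` and `1#`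
  -- definitionally and later calls of `solve` close with `refl`.
  fromℤ : ℤ → Carrier
  fromℤ (+ n)    = n · 1#
  fromℤ -[1+ n ] = - (suc n · 1#)

  fromℤ-neg : ∀ i → fromℤ (ℤ.- i) ≈ - fromℤ i
  fromℤ-neg (+ zero)   = sym -0#≈0#
  fromℤ-neg (+ suc n)  = refl
  fromℤ-neg -[1+ n ]   = sym (-‿involutive _)

  fromℤ-∸ : ∀ {m n} → n ≤ m → fromℤ (+ (m ℕ.∸ n)) ≈ m · 1# - n · 1#
  fromℤ-∸ {m} {n} n≤m = begin
    (m ℕ.∸ n) · 1#                      ≈⟨ +-identityʳ _ ⟨
    (m ℕ.∸ n) · 1# + 0#                 ≈⟨ +-congˡ (-‿inverseʳ _) ⟨
    (m ℕ.∸ n) · 1# + (n · 1# - n · 1#)  ≈⟨ +-assoc _ _ _ ⟨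
    (m ℕ.∸ n) · 1# + n · 1# - n · 1#    ≈⟨ +-congʳ (×-homo-+ 1# (m ℕ.∸ n) n) ⟨
    (m ℕ.∸ n ℕ.+ n) · 1# - n · 1#       ≡⟨ ≡.cong (λ k → k · 1# - n · 1#) (ℕ.m∸n+n≡m n≤m) ⟩
    m · 1# - n · 1#                     ∎

  fromℤ-⊖ : ∀ m n → fromℤ (m ℤ.⊖ n) ≈ m · 1# - n · 1#
  fromℤ-⊖ m n with ℕ.≤-total n m
  ... | inj₁ n≤m rewrite ℤ.⊖-≥ n≤m = fromℤ-∸ n≤m
  ... | inj₂ m≤n rewrite ℤ.⊖-≤ m≤n = begin
    fromℤ (ℤ.- (+ (n ℕ.∸ m)))     ≈⟨ fromℤ-neg (+ (n ℕ.∸ m)) ⟩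
    - fromℤ (+ (n ℕ.∸ m))         ≈⟨ -‿cong (fromℤ-∸ m≤n) ⟩
    - (n · 1# - m · 1#)           ≈⟨ ⁻¹-∙-comm _ _ ⟨
    - (n · 1#) + - (- (m · 1#))   ≈⟨ +-congˡ (-‿involutive _) ⟩
    - (n · 1#) + m · 1#           ≈⟨ +-comm _ _ ⟩
    m · 1# - n · 1#               ∎

  fromℤ-+ : ∀ i j → fromℤ (i ℤ.+ j) ≈ fromℤ i + fromℤ j
  fromℤ-+ (+ m)    (+ n)    = ×-homo-+ 1# m n
  fromℤ-+ (+ m)    -[1+ n ] = fromℤ-⊖ m (suc n)
  fromℤ-+ -[1+ m ] (+ n)    = trans (fromℤ-⊖ n (suc m)) (+-comm _ _)
  fromℤ-+ -[1+ m ] -[1+ n ] = begin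
    - (suc (suc (m ℕ.+ n)) · 1#)        ≡⟨ ≡.cong (λ k → - (suc k · 1#)) (ℕ.+-suc m n) ⟨
    - ((suc m ℕ.+ suc n) · 1#)          ≈⟨ -‿cong (×-homo-+ 1# (suc m) (suc n)) ⟩
    - (suc m · 1# + suc n · 1#)         ≈⟨ ⁻¹-∙-comm _ _ ⟨
    - (suc m · 1#) + - (suc n · 1#)     ∎

  fromℤ-*⁺ : ∀ i n → fromℤ (i ℤ.* (+ n)) ≈ fromℤ i * (n · 1#)
  fromℤ-*⁺ (+ m)    n = trans (reflexive (≡.cong fromℤ (≡.sym (ℤ.pos-* m n)))) (×1-homo-* m n)
  fromℤ-*⁺ -[1+ m ] n = begin
    fromℤ (-[1+ m ] ℤ.* + n)             ≡⟨ ≡.cong fromℤ (ℤ.neg-distribˡ-* (+ suc m) (+ n)) ⟨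
    fromℤ (ℤ.- (+ suc m ℤ.* + n))        ≈⟨ fromℤ-neg (+ suc m ℤ.* + n) ⟩
    - fromℤ (+ suc m ℤ.* + n)            ≈⟨ -‿cong (fromℤ-*⁺ (+ suc m) n) ⟩
    - (suc m · 1# * n · 1#)              ≈⟨ -‿distribˡ-* _ _ ⟩
    - (suc m · 1#) * n · 1#              ∎

  fromℤ-* : ∀ i j → fromℤ (i ℤ.* j) ≈ fromℤ i * fromℤ j
  fromℤ-* i (+ n)    = fromℤ-*⁺ i n
  fromℤ-* i -[1+ n ] = begin
    fromℤ (i ℤ.* -[1+ n ])           ≡⟨ ≡.cong fromℤ (ℤ.neg-distribʳ-* i (+ suc n)) ⟨
    fromℤ (ℤ.- (i ℤ.* + suc n))      ≈⟨ fromℤ-neg (i ℤ.* + suc n) ⟩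
    - fromℤ (i ℤ.* + suc n)          ≈⟨ -‿cong (fromℤ-*⁺ i (suc n)) ⟩
    - (fromℤ i * (suc n · 1#))       ≈⟨ -‿distribʳ-* _ _ ⟩
    fromℤ i * - (suc n · 1#)         ∎

  ℤ-homomorphism : ℤ.+-*-rawRing -Raw-AlmostCommutative⟶ fromCommutativeRing R
  ℤ-homomorphism = record
    { ⟦_⟧    = fromℤ
    ; +-homo = fromℤ-+
    ; *-homo = fromℤ-*
    ; -‿homo = fromℤ-neg
    ; 0-homo = refl
    ; 1-homo = refl
    }

  -- Sound but incomplete: distinct integers may agree in positive characteristic, so identities
  -- that depend on the characteristic are beyond the solver.
  coefficient≟ : ∀ i j → Maybe (fromℤ i ≈ fromℤ j)
  coefficient≟ i j with i ℤ.≟ j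
  ... | yes i≡j = just (reflexive (≡.cong fromℤ i≡j))
  ... | no  _   = nothing

  open import Algebra.Solver.Ring
    ℤ.+-*-rawRing (fromCommutativeRing R) ℤ-homomorphism coefficient≟ public
    using (Polynomial; con; _:+_; _:*_; :-_; _:-_; _:=_; solve)

  :0 :1 : ∀ {m} → Polynomial m
  :0 = con (+ 0)
  :1 = con (+ 1)

open import Relation.Binary.PropositionalEquality
  using (_≡_; _≢_; refl; sym; trans; cong; cong₂; subst; module ≡-Reasoning)

-- Divisibility of binomial coefficients by a prime

prime∤! : ∀ {p} → Prime p → ∀ {k} → k ℕ.< p → ¬ p ∣ k ℕ.!
prime∤! p-prime {zero}  _   p∣1 =
  ℕ.nonTrivial⇒≢1 ⦃ prime⇒nonTrivial p-prime ⦄ (∣1⇒≡1 p∣1)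
prime∤! p-prime {suc k} k<p p∣  with euclidsLemma (suc k) (k ℕ.!) p-prime p∣
... | inj₁ p∣1+k = ℕ.<⇒≱ k<p (∣⇒≤ p∣1+k)
... | inj₂ p∣k!  = prime∤! p-prime (ℕ.<⇒≤ k<p) p∣k!

-- The prime p divides p! = C(p,k) k! (p - k)! but neither of the two factorials, all of whose
-- factors are smaller than p.
prime∣binomial : ∀ {n} → Prime (suc n) → ∀ {k} → 0 ℕ.< k → k ℕ.< suc n → suc n ∣ suc n choose k
prime∣binomial {n} p-prime {k@(suc j)} _ k<p
  with euclidsLemma (suc n choose k) (k ℕ.! ℕ.* (suc n ℕ.∸ k) ℕ.!) p-prime
         (subst (suc n ∣_) (sym factorials) (m∣m*n (n ℕ.!)))
  where
  instance _ = k ℕ.!* (suc n ℕ.∸ k) !≢0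
  factorials : (suc n choose k) ℕ.* (k ℕ.! ℕ.* (suc n ℕ.∸ k) ℕ.!) ≡ (suc n) ℕ.!
  factorials = trans (cong (ℕ._* (k ℕ.! ℕ.* (suc n ℕ.∸ k) ℕ.!)) (nCk≡n!/k![n-k]! (ℕ.<⇒≤ k<p))) (m/n*n≡m (k![n∸k]!∣n! (ℕ.<⇒≤ k<p)))
... | inj₁ p∣C = p∣C
... | inj₂ p∣k![p∸k]! with euclidsLemma (k ℕ.!) _ p-prime p∣k![p∸k]!
...   | inj₁ p∣k!     = contradiction p∣k! (prime∤! p-prime k<p)
...   | inj₂ p∣[p∸k]! = contradiction p∣[p∸k]! (prime∤! p-prime (s≤s (ℕ.m∸n≤m n j)))

-- Finite fields: inverses, Fermat, Frobenius, square classes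

module FieldProperties {c n} (F : FiniteField c n) where
  open FiniteField F public
  open CommutativeRing commutativeRing public
    using ( +-comm; +-assoc; *-comm; *-assoc; zeroˡ; zeroʳ; +-identityˡ; +-identityʳ
          ; *-identityˡ; *-identityʳ; distribˡ; distribʳ; -‿inverseʳ; -‿inverseˡ
          ; +-commutativeMonoid; *-commutativeMonoid; +-group)
  open CommutativeRing commutativeRing using (commutativeSemiring)
  open IntegerCoefficients commutativeRing public
    using (Polynomial; con; :0; :1; _:+_; _:*_; :-_; _:-_; _:=_; solve)
  open import Algebra.Properties.Group +-group public
    using () renaming (x∙y⁻¹≈ε⇒x≈y to x-y≡0⇒x≡y; x≈y⇒x∙y⁻¹≈ε to x≡y⇒x-y≡0; ⁻¹-involutive to -‿involutive)
  open import Algebra.Properties.Semiring.Mult semiring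
    using (×1-homo-*; ×-assoc-*; ×-assocˡ)
  open import Algebra.Properties.Semiring.Exp semiring using (^-assocʳ; ^-homo-*) public
  open import Algebra.Properties.CommutativeSemiring.Exp commutativeSemiring using (^-distrib-*) public
  import Algebra.Properties.CommutativeMonoid.Sum +-commutativeMonoid as ∑
  import Algebra.Properties.CommutativeMonoid.Sum *-commutativeMonoid as ∏
  import Algebra.Properties.CommutativeSemiring.Binomial commutativeSemiring as Binomial
  open ≡-Reasoning

  private
    index : Carrier → Fin n
    index = Inverse.to enumeration

    element : Fin n → Carrier
    element = Inverse.from enumeration

    element-index : ∀ x → element (index x) ≡ x
    element-index = Inverse.strictlyInverseʳ enumeration

    index-element : ∀ i → index (element i) ≡ i
    index-element = Inverse.strictlyInverseˡ enumeration

    index-injective : ∀ {x y} → index x ≡ index y → x ≡ y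
    index-injective {x} {y} eq =
      trans (sym (element-index x)) (trans (cong element eq) (element-index y))

    element-injective : ∀ {i j} → element i ≡ element j → i ≡ j
    element-injective {i} {j} eq =
      trans (sym (index-element i)) (trans (cong index eq) (index-element j))

  infix 4 _≟_
  _≟_ : DecidableEquality Carrier
  _≟_ = via-injection (↔⇒↣ enumeration) Fin._≟_

  infix 10 _⁻¹
  -- The default value 0 at 0 makes inversion multiplicative without side conditions, so the scaling
  -- laws of `h` need no assumption on its argument.
  _⁻¹ : Carrier → Carrier
  x ⁻¹ with x ≟ 0#
  ... | yes _   = 0#
  ... | no  x≢0 = proj₁ (inverse x x≢0)

  x*x⁻¹≡1 : ∀ {x} → x ≢ 0# → x * x ⁻¹ ≡ 1#
  x*x⁻¹≡1 {x} x≢0 with x ≟ 0#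
  ... | yes x≡0 = contradiction x≡0 x≢0
  ... | no  x≢0 = proj₂ (inverse x x≢0)

  x⁻¹*x≡1 : ∀ {x} → x ≢ 0# → x ⁻¹ * x ≡ 1#
  x⁻¹*x≡1 x≢0 = trans (*-comm _ _) (x*x⁻¹≡1 x≢0)

  *-cancelˡ : ∀ {x y z} → x ≢ 0# → x * y ≡ x * z → y ≡ z
  *-cancelˡ {x} {y} {z} x≢0 xy≡xz = begin
    y               ≡⟨ *-identityˡ y ⟨
    1# * y          ≡⟨ cong (_* y) (x⁻¹*x≡1 x≢0) ⟨
    x ⁻¹ * x * y    ≡⟨ *-assoc _ _ _ ⟩
    x ⁻¹ * (x * y)  ≡⟨ cong (x ⁻¹ *_) xy≡xz ⟩
    x ⁻¹ * (x * z)  ≡⟨ *-assoc _ _ _ ⟨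
    x ⁻¹ * x * z    ≡⟨ cong (_* z) (x⁻¹*x≡1 x≢0) ⟩
    1# * z          ≡⟨ *-identityˡ z ⟩
    z               ∎

  x*y≡0⇒y≡0 : ∀ {x y} → x ≢ 0# → x * y ≡ 0# → y ≡ 0#
  x*y≡0⇒y≡0 x≢0 xy≡0 = *-cancelˡ x≢0 (trans xy≡0 (sym (zeroʳ _)))

  *-≢0 : ∀ {x y} → x ≢ 0# → y ≢ 0# → x * y ≢ 0#
  *-≢0 x≢0 y≢0 xy≡0 = y≢0 (x*y≡0⇒y≡0 x≢0 xy≡0)

  x*y≡1⇒x≢0 : ∀ {x y} → x * y ≡ 1# → x ≢ 0#
  x*y≡1⇒x≢0 xy≡1 refl = 1≢0 (trans (sym xy≡1) (zeroˡ _))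

  ⁻¹-≢0 : ∀ {x} → x ≢ 0# → x ⁻¹ ≢ 0#
  ⁻¹-≢0 x≢0 = x*y≡1⇒x≢0 (x⁻¹*x≡1 x≢0)

  ⁻¹-unique : ∀ {x y} → x * y ≡ 1# → y ≡ x ⁻¹
  ⁻¹-unique xy≡1 = *-cancelˡ x≢0 (trans xy≡1 (sym (x*x⁻¹≡1 x≢0)))
    where x≢0 = x*y≡1⇒x≢0 xy≡1

  ⁻¹-involutive : ∀ {x} → x ≢ 0# → x ⁻¹ ⁻¹ ≡ x
  ⁻¹-involutive x≢0 = sym (⁻¹-unique (x⁻¹*x≡1 x≢0))

  private
    permutes : (f g : Carrier → Carrier) → (∀ x → f (g x) ≡ x) → (∀ x → g (f x) ≡ x) → Perm.Permutation n n
    permutes f g fg gf = Perm.permutation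
      (index ∘ f ∘ element) (index ∘ g ∘ element)
      (λ i → trans (cong (index ∘ f) (element-index _)) (trans (cong index (fg _)) (index-element i)))
      (λ i → trans (cong (index ∘ g) (element-index _)) (trans (cong index (gf _)) (index-element i)))

  -- Translating by 1 permutes the field, so adding n · 1 to the sum of all elements does not change it.
  characteristic : n · 1# ≡ 0#
  characteristic = begin
    n · 1#                                        ≡⟨ ∑.sum-replicate n ⟨
    sum (replicate n 1#)                          ≡⟨ solve 2 (λ s t → t := :- s :+ (s :+ t)) refl (sum element) _ ⟩
    - sum element + (sum element + sum (replicate n 1#)) ≡⟨ cong (- sum element +_) (∑.∑-distrib-+ element (replicate n 1#)) ⟨
    - sum element + sum (λ i → element i + 1#)    ≡⟨ cong (- sum element +_) (∑.sum-cong-≗ (λ i → element-index (element i + 1#))) ⟨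
    - sum element + sum (λ i → element (index (element i + 1#))) ≡⟨ cong (- sum element +_) (∑.sum-permute element translation) ⟨
    - sum element + sum element                   ≡⟨ -‿inverseˡ _ ⟩
    0#                                            ∎
    where
    translation = permutes (_+ 1#) (_- 1#)
      (solve 1 (λ x → x :- :1 :+ :1 := x) refl)
      (solve 1 (λ x → x :+ :1 :- :1 := x) refl)

  private
    -- Replacing 0 by 1 makes products over the whole field equal products over its units.
    unit : Carrier → Carrier → Carrier
    unit y x with y ≟ 0#
    ... | yes _ = 1#
    ... | no  _ = x

    unit-0 : ∀ {y} x → y ≡ 0# → unit y x ≡ 1#
    unit-0 {y} x y≡0 with y ≟ 0#
    ... | yes _   = refl
    ... | no  y≢0 = contradiction y≡0 y≢0

    unit-≢0 : ∀ {y} x → y ≢ 0# → unit y x ≡ x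
    unit-≢0 {y} x y≢0 with y ≟ 0#
    ... | yes y≡0 = contradiction y≡0 y≢0
    ... | no  _   = refl

    unit-≢ : ∀ y → unit y y ≢ 0#
    unit-≢ y with y ≟ 0#
    ... | yes _   = 1≢0
    ... | no  y≢0 = y≢0

    unit-* : ∀ {x} → x ≢ 0# → ∀ y → unit (x * y) (x * y) ≡ unit y x * unit y y
    unit-* {x} x≢0 y with y ≟ 0#
    ... | yes y≡0 = trans (unit-0 _ (trans (cong (x *_) y≡0) (zeroʳ x))) (sym (*-identityˡ 1#))
    ... | no  y≢0 = unit-≢0 _ (*-≢0 x≢0 y≢0)

    ∏-≢0 : ∀ {m} (f : Fin m → Carrier) → (∀ i → f i ≢ 0#) → ∏.sum f ≢ 0#
    ∏-≢0 {zero}  f f≢0 = 1≢0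
    ∏-≢0 {suc m} f f≢0 = *-≢0 (f≢0 zero) (∏-≢0 (f ∘ suc) (f≢0 ∘ suc))

    -- Multiplication by x permutes the field and fixes 0, so the product of all units is reproduced
    -- with one extra factor x for each unit. Cancelling that product leaves 1.
    ∏unit≡1 : ∀ {x} → x ≢ 0# → ∏.sum (λ i → unit (element i) x) ≡ 1#
    ∏unit≡1 {x} x≢0 = *-cancelˡ (∏-≢0 g (λ i → unit-≢ (element i))) $ begin
      ∏.sum g * ∏.sum f                     ≡⟨ *-comm _ _ ⟩
      ∏.sum f * ∏.sum g                     ≡⟨ ∏.∑-distrib-+ f g ⟨
      ∏.sum (λ i → f i * g i)               ≡⟨ ∏.sum-cong-≗ (λ i → unit-* x≢0 (element i)) ⟨
      ∏.sum (λ i → unit (x * element i) (x * element i))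
        ≡⟨ ∏.sum-cong-≗ (λ i → cong (λ y → unit y y) (element-index (x * element i))) ⟨
      ∏.sum (λ i → g (index (x * element i))) ≡⟨ ∏.sum-permute g scaling ⟨
      ∏.sum g                               ≡⟨ *-identityʳ _ ⟨
      ∏.sum g * 1#                          ∎
      where
      f g : Fin n → Carrier
      f i = unit (element i) x
      g i = unit (element i) (element i)
      scaling = permutes (x *_) (x ⁻¹ *_)
        (λ y → trans (sym (*-assoc _ _ _)) (trans (cong (_* y) (x*x⁻¹≡1 x≢0)) (*-identityˡ y)))
        (λ y → trans (sym (*-assoc _ _ _)) (trans (cong (_* y) (x⁻¹*x≡1 x≢0)) (*-identityˡ y)))

    -- The single index where `e` is 0 contributes 1, and the leading x makes up for it. The family
    -- `e` has a length of its own because n is a module parameter and cannot be split as a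
    -- successor.
    x*∏unit≡x^n : ∀ x {m} (e : Fin m → Carrier) → (∀ {i j} → e i ≡ e j → i ≡ j) → ∃ (λ i → e i ≡ 0#) →
                 x * ∏.sum (λ i → unit (e i) x) ≡ x ^ m
    x*∏unit≡x^n x {suc m} e e-injective (z , ez≡0) = cong (x *_) $ begin
      ∏.sum f                        ≡⟨ ∏.sum-remove {i = z} f ⟩
      f z * ∏.sum (removeAt f z)     ≡⟨ cong (_* ∏.sum (removeAt f z)) (unit-0 x ez≡0) ⟩
      1# * ∏.sum (removeAt f z)      ≡⟨ *-identityˡ _ ⟩
      ∏.sum (removeAt f z)           ≡⟨ ∏.sum-cong-≗ (λ i → unit-≢0 x (others i)) ⟩
      ∏.sum (replicate m x)          ≡⟨ ∏.sum-replicate m ⟩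
      x ^ m                          ∎
      where
      f : Fin (suc m) → Carrier
      f i = unit (e i) x
      others : ∀ i → e (punchIn z i) ≢ 0#
      others i eq = Fin.punchInᵢ≢i z i (e-injective (trans eq (sym ez≡0)))

  fermat : ∀ x → x ^ n ≡ x
  fermat x with x ≟ 0#
  ... | no x≢0 = begin
    x ^ n                                   ≡⟨ x*∏unit≡x^n x element element-injective (index 0# , element-index 0#) ⟨
    x * ∏.sum (λ i → unit (element i) x)    ≡⟨ cong (x *_) (∏unit≡1 x≢0) ⟩
    x * 1#                                  ≡⟨ *-identityʳ x ⟩
    x                                       ∎
  -- For x = 0 the product formula already suffices, since its leading factor vanishes; `0# ^ n`
  -- does not compute for a variable n.
  ... | yes refl = trans (sym (x*∏unit≡x^n 0# element element-injective (index 0# , element-index 0#))) (zeroˡ _)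

  module Frobenius {p} (p-prime : Prime p) (p·1≡0 : p · 1# ≡ 0#) where

    ∣⇒·≡0 : ∀ {m} → p ∣ m → ∀ x → m · x ≡ 0#
    ∣⇒·≡0 {m} (divides d refl) x = begin
      (d ℕ.* p) · x         ≡⟨ ×-assocˡ x d p ⟨
      d · (p · x)           ≡⟨ cong (λ y → d · (p · y)) (*-identityˡ x) ⟨
      d · (p · (1# * x))    ≡⟨ cong (d ·_) (×-assoc-* p 1# x) ⟨
      d · ((p · 1#) * x)    ≡⟨ cong (λ y → d · (y * x)) p·1≡0 ⟩
      d · (0# * x)          ≡⟨ cong (d ·_) (zeroˡ x) ⟩
      d · 0#                ≡⟨ ∑.sum-replicate d ⟨
      sum (replicate d 0#)  ≡⟨ ∑.sum-replicate-zero d ⟩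
      0#                    ∎

    ^p-+ : ∀ x y → (x + y) ^ p ≡ x ^ p + y ^ p
    ^p-+ x y = go p p-prime ∣⇒·≡0
      where
      -- The prime becomes a variable again so that it can be split as `suc m`, which separates the
      -- two outer binomial terms from the middle ones.
      go : ∀ p → Prime p → (∀ {m} → p ∣ m → ∀ x → m · x ≡ 0#) → (x + y) ^ p ≡ x ^ p + y ^ p
      go zero p-prime _ = contradiction p-prime (λ ())
      go p@(suc m) p-prime ∣⇒·≡0 = begin
        (x + y) ^ p                           ≡⟨ Binomial.theorem p x y ⟩
        sum t                                 ≡⟨⟩
        t zero + sum t⁺                       ≡⟨ cong (t zero +_) (∑.sum-init-last t⁺) ⟩
        t zero + (sum middle + t (fromℕ p))   ≡⟨ cong (λ z → t zero + (z + t (fromℕ p))) middle≡0 ⟩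
        t zero + (0# + t (fromℕ p))           ≡⟨ cong₂ (λ u v → u + (0# + v)) first last ⟩
        y ^ p + (0# + x ^ p)                  ≡⟨ solve 2 (λ a b → b :+ (:0 :+ a) := a :+ b) refl (x ^ p) (y ^ p) ⟩
        x ^ p + y ^ p                         ∎
        where
        t : Fin (suc p) → Carrier
        t = Binomial.binomialTerm x y p
        t⁺ : Fin (suc m) → Carrier
        t⁺ i = t (suc i)
        middle : Fin m → Carrier
        middle i = t⁺ (inject₁ i)
        middle≡0 : sum middle ≡ 0#
        middle≡0 = trans
          (∑.sum-cong-≗ (λ i → ∣⇒·≡0 (prime∣binomial p-prime (s≤s ℕ.z≤n) (s≤s (subst (ℕ._< m) (sym (Fin.toℕ-inject₁ i)) (Fin.toℕ<n i)))) _))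
          (∑.sum-replicate-zero m)
        first : t zero ≡ y ^ p
        first = trans (+-identityʳ _) (*-identityˡ _)
        last : t (fromℕ p) ≡ x ^ p
        last rewrite Fin.toℕ-fromℕ m | nCn≡1 p | ℕ.n∸n≡0 m =
          trans (+-identityʳ _) (*-identityʳ _)

    ^pᵏ-+ : ∀ k x y → (x + y) ^ (p ℕ.^ k) ≡ x ^ (p ℕ.^ k) + y ^ (p ℕ.^ k)
    ^pᵏ-+ zero    x y = solve 2 (λ a b → (a :+ b) :* :1 := a :* :1 :+ b :* :1) refl x y
    ^pᵏ-+ (suc k) x y = begin
      (x + y) ^ (p ℕ.* p ℕ.^ k)                     ≡⟨ ^-assocʳ (x + y) p (p ℕ.^ k) ⟨
      ((x + y) ^ p) ^ (p ℕ.^ k)                     ≡⟨ cong (_^ (p ℕ.^ k)) (^p-+ x y) ⟩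
      (x ^ p + y ^ p) ^ (p ℕ.^ k)                   ≡⟨ ^pᵏ-+ k (x ^ p) (y ^ p) ⟩
      (x ^ p) ^ (p ℕ.^ k) + (y ^ p) ^ (p ℕ.^ k)     ≡⟨ cong₂ _+_ (^-assocʳ x p (p ℕ.^ k)) (^-assocʳ y p (p ℕ.^ k)) ⟩
      x ^ (p ℕ.* p ℕ.^ k) + y ^ (p ℕ.* p ℕ.^ k)     ∎

  -- The multiple is the k-th power of `p · 1#`, and a field has no nilpotent elements except 0. It
  -- is used twice: to descend from q² to q, and from q to its prime.
  p^k·1≡0⇒p·1≡0 : ∀ p k → (p ℕ.^ k) · 1# ≡ 0# → p · 1# ≡ 0#
  p^k·1≡0⇒p·1≡0 p zero    eq = contradiction (trans (sym (+-identityʳ 1#)) eq) 1≢0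
  p^k·1≡0⇒p·1≡0 p (suc k) eq with p · 1# ≟ 0#
  ... | yes p·1≡0 = p·1≡0
  ... | no  p·1≢0 = p^k·1≡0⇒p·1≡0 p k
    (x*y≡0⇒y≡0 p·1≢0 (trans (sym (×1-homo-* p (p ℕ.^ k))) eq))

  -- Choosing one of each pair {x , -x} by the enumeration, x ↦ x² on the chosen
  -- elements and x ↦ a x² on the others is injective, hence surjective.
  nonsquare-ratio : 1# + 1# ≢ 0# → ∀ {a b} → ¬ IsSquare a → ¬ IsSquare b → ∃[ k ] b ≡ k * k * a
  nonsquare-ratio 2≢0 {a} {b} a∉□ b∉□ with φ-surjective
    where
    a≢0 : a ≢ 0#
    a≢0 refl = a∉□ (0# , sym (zeroˡ 0#))

    chosen? : ∀ x → Dec (index x Fin.< index (- x))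
    chosen? x = index x Fin.<? index (- x)

    φ : Carrier → Carrier
    φ x with chosen? x
    ... | yes _ = x * x
    ... | no  _ = a * (x * x)

    square-eq : ∀ {x y} → x * x ≡ y * y → x ≡ y ⊎ x ≡ - y
    square-eq {x} {y} xx≡yy with x - y ≟ 0#
    ... | yes x-y≡0 = inj₁ (x-y≡0⇒x≡y x y x-y≡0)
    ... | no  x-y≢0 = inj₂ (x-y≡0⇒x≡y x (- y) (x*y≡0⇒y≡0 x-y≢0
          (trans (solve 2 (λ x y → (x :- y) :* (x :- :- y) := x :* x :- y :* y) refl x y) (x≡y⇒x-y≡0 xx≡yy))))

    mixed : ∀ {x y} → y ≢ 0# → x * x ≢ a * (y * y)
    mixed {x} {y} y≢0 eq = a∉□ (x * y ⁻¹ , sym (begin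
      x * y ⁻¹ * (x * y ⁻¹)              ≡⟨ solve 2 (λ x z → x :* z :* (x :* z) := x :* x :* (z :* z)) refl x (y ⁻¹) ⟩
      x * x * (y ⁻¹ * y ⁻¹)              ≡⟨ cong (_* (y ⁻¹ * y ⁻¹)) eq ⟩
      a * (y * y) * (y ⁻¹ * y ⁻¹)        ≡⟨ solve 3 (λ a y z → a :* (y :* y) :* (z :* z) := a :* ((y :* z) :* (y :* z))) refl a y (y ⁻¹) ⟩
      a * ((y * y ⁻¹) * (y * y ⁻¹))      ≡⟨ cong (λ z → a * (z * z)) (x*x⁻¹≡1 y≢0) ⟩
      a * (1# * 1#)                      ≡⟨ trans (cong (a *_) (*-identityˡ 1#)) (*-identityʳ a) ⟩
      a                                  ∎))

    -- The two kinds of values of `φ` meet only at 0; anywhere else a would be the square of x/y.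
    mixed⁰ : ∀ {x y} → ¬ index y Fin.< index (- y) → x * x ≡ a * (y * y) → x ≡ y
    mixed⁰ {x} {y} _ eq with y ≟ 0#
    ... | no  y≢0 = contradiction eq (mixed y≢0)
    ... | yes refl with x ≟ 0#
    ...   | yes x≡0 = x≡0
    ...   | no  x≢0 = contradiction
              (trans eq (trans (cong (a *_) (zeroˡ 0#)) (zeroʳ a))) (*-≢0 x≢0 x≢0)

    φ-injective : ∀ {x y} → φ x ≡ φ y → x ≡ y
    φ-injective {x} {y} eq with chosen? x | chosen? y
    ... | yes x< | no  y≮ = mixed⁰ y≮ eq
    ... | no  x≮ | yes y< = sym (mixed⁰ x≮ (sym eq))
    ... | yes x< | yes y< with square-eq eq
    ...   | inj₁ x≡y  = x≡y
    ...   | inj₂ refl = contradiction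
              (subst (λ z → index (- y) Fin.< index z) (-‿involutive y) x<) (ℕ.<-asym y<)
    φ-injective {x} {y} eq | no x≮ | no y≮ with square-eq (*-cancelˡ a≢0 eq)
    ... | inj₁ x≡y  = x≡y
    ... | inj₂ refl with Fin.<-cmp (index y) (index (- y))
    ...   | tri< y< _ _ = contradiction y< y≮
    ...   | tri≈ _ y≡ _ = sym (index-injective y≡)
    ...   | tri> _ _ y> = contradiction
              (subst (λ z → index (- y) Fin.< index z) (sym (-‿involutive y)) y>) x≮

    φ-surjective : ∃[ x ] (b ≡ x * x ⊎ b ≡ a * (x * x))
    φ-surjective with Fin.any? (λ i → φ (element i) ≟ b)
    ... | yes (i , eq) = element i , cases eq
      where
      cases : ∀ {x} → φ x ≡ b → b ≡ x * x ⊎ b ≡ a * (x * x)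
      cases {x} eq with chosen? x
      ... | yes _ = inj₁ (sym eq)
      ... | no  _ = inj₂ (sym eq)
    ... | no ∄i = ⊥-elim (missed refl)
      where
      -- If b were not a value, punching out its index would inject `Fin n` into a smaller `Fin m`.
      -- The equation `m ≡ n` stands in for a case split on n.
      missed : ∀ {m} → m ≡ n → _
      missed {zero}  eq = Fin.¬Fin0 (subst Fin (sym eq) (index b))
      missed {suc m} refl = ℕ.1+n≰n (Fin.injective⇒≤ {f = λ i → Fin.punchOut (b≢ i)}
        (λ {i} {j} e → element-injective (φ-injective (index-injective (Fin.punchOut-injective (b≢ i) (b≢ j) e)))))
        where
        b≢ : ∀ i → index b ≢ index (φ (element i))
        b≢ i eq = ∄i (i , sym (index-injective eq))
  ... | x , inj₁ b≡xx  = contradiction (x , b≡xx) b∉□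
  ... | x , inj₂ b≡axx = x , trans b≡axx (*-comm a (x * x))

-- Choosing two or three of four vertices

two-of-four : ∀ {p r} {P : Fin 4 → Set p} {R : Set r} →
  (P 0F → P 1F → R) → (P 0F → P 2F → R) → (P 0F → P 3F → R) →
  (P 1F → P 2F → R) → (P 1F → P 3F → R) → (P 2F → P 3F → R) →
  ∀ i j → i ≢ j → P i → P j → R
two-of-four f₀₁ f₀₂ f₀₃ f₁₂ f₁₃ f₂₃ = λ where
  0F 0F i≢j _ _ → contradiction refl i≢j
  1F 1F i≢j _ _ → contradiction refl i≢j
  2F 2F i≢j _ _ → contradiction refl i≢j
  3F 3F i≢j _ _ → contradiction refl i≢j
  0F 1F _ x y → f₀₁ x y
  1F 0F _ y x → f₀₁ x y
  0F 2F _ x y → f₀₂ x y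
  2F 0F _ y x → f₀₂ x y
  0F 3F _ x y → f₀₃ x y
  3F 0F _ y x → f₀₃ x y
  1F 2F _ x y → f₁₂ x y
  2F 1F _ y x → f₁₂ x y
  1F 3F _ x y → f₁₃ x y
  3F 1F _ y x → f₁₃ x y
  2F 3F _ x y → f₂₃ x y
  3F 2F _ y x → f₂₃ x y

abstract
  -- Obtained by running the decision procedure over all triples; `abstract` keeps the resulting
  -- term from being unfolded.
  remaining : ∀ (i j k : Fin 4) → i ≢ j → j ≢ k → i ≢ k →
              ∃ λ n → ∀ m → m ≢ n → m ≡ i ⊎ m ≡ j ⊎ m ≡ k
  remaining = toWitness {a? = Fin.all? λ i → Fin.all? λ j → Fin.all? λ k →
    ¬? (i Fin.≟ j) →-dec (¬? (j Fin.≟ k) →-dec (¬? (i Fin.≟ k) →-dec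
    Fin.any? λ n → Fin.all? λ m → ¬? (m Fin.≟ n) →-dec ((m Fin.≟ i) ⊎-dec ((m Fin.≟ j) ⊎-dec (m Fin.≟ k)))))} _

-- Splitting on the index that is left out needs four cases instead of one for each ordered triple.
three-of-four : ∀ {p r} {P : Fin 4 → Set p} {R : Set r} →
  (P 0F → P 1F → P 2F → R) → (P 0F → P 1F → P 3F → R) →
  (P 0F → P 2F → P 3F → R) → (P 1F → P 2F → P 3F → R) →
  ∀ i j k → i ≢ j → j ≢ k → i ≢ k → P i → P j → P k → R
three-of-four {P = P} {R} f₀₁₂ f₀₁₃ f₀₂₃ f₁₂₃ i j k i≢j j≢k i≢k Pi Pj Pk =
  go (proj₁ missing) (proj₂ missing)
  where
  missing = remaining i j k i≢j j≢k i≢k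
  P-of : ∀ {m} → m ≡ i ⊎ m ≡ j ⊎ m ≡ k → P m
  P-of (inj₁ refl)        = Pi
  P-of (inj₂ (inj₁ refl)) = Pj
  P-of (inj₂ (inj₂ refl)) = Pk
  go : ∀ n → (∀ m → m ≢ n → m ≡ i ⊎ m ≡ j ⊎ m ≡ k) → R
  go 0F c = f₁₂₃ (P-of (c 1F λ ())) (P-of (c 2F λ ())) (P-of (c 3F λ ()))
  go 1F c = f₀₂₃ (P-of (c 0F λ ())) (P-of (c 2F λ ())) (P-of (c 3F λ ()))
  go 2F c = f₀₁₃ (P-of (c 0F λ ())) (P-of (c 1F λ ())) (P-of (c 3F λ ()))
  go 3F c = f₀₁₂ (P-of (c 0F λ ())) (P-of (c 1F λ ())) (P-of (c 2F λ ()))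

-- Cardinality of a setoid with finitely many keys

module Finiteness {c ℓ} (S : Setoid c ℓ) (_≈?_ : Decidable₂ (Setoid._≈_ S)) where
  open Setoid S using (Carrier; _≈_) renaming (refl to ≈-refl; sym to ≈-sym; trans to ≈-trans)

  -- Pairwise inequivalent elements that meet every class of I. They need not belong to I
  -- themselves, so representatives of one predicate can be reused for another in `adjoin`.
  Representatives : Pred Carrier c → Set _
  Representatives I = ∃₂ λ n (g : Fin n → Carrier) →
    (∀ {i j} → g i ≈ g j → i ≡ j) × (∀ {x} → x ∈ I → ∃ λ i → g i ≈ x)

  adjoin : ∀ {I J : Pred Carrier c} x → (∀ {y} → y ∈ J → x ≈ y ⊎ y ∈ I) → Representatives I → Representatives J
  adjoin x cases (n , g , injective , covers) with Fin.any? (λ i → g i ≈? x)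
  ... | yes (i , gi≈x) = n , g , injective ,
    λ y∈J → [ (λ x≈y → i , ≈-trans gi≈x x≈y) , covers ]′ (cases y∈J)
  ... | no ∄i = suc n , g′ , injective′ ,
      λ y∈J → [ (λ x≈y → zero , x≈y) , (λ y∈I → let i , gi≈y = covers y∈I in suc i , gi≈y) ]′ (cases y∈J)
    where
    g′ : Fin (suc n) → Carrier
    g′ zero    = x
    g′ (suc i) = g i
    injective′ : ∀ {i j} → g′ i ≈ g′ j → i ≡ j
    injective′ {zero}  {zero}  _  = refl
    injective′ {zero}  {suc j} eq = contradiction (j , ≈-sym eq) ∄i
    injective′ {suc i} {zero}  eq = contradiction (i , eq) ∄i
    injective′ {suc i} {suc j} eq = cong suc (injective eq)

  module _ {A : Set c} (key : Carrier → A) (key-injective : ∀ {x y} → key x ≡ key y → x ≈ y)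
    (key⁻¹ : ∀ a → Dec (∃ λ x → key x ≡ a)) where

    -- One preimage per key is enough, since elements with the same key are equivalent, and `key⁻¹`
    -- finds it or shows that there is none. For parameters the key forgets the validity proof, so
    -- that only tuples of field elements are enumerated.
    representatives : ∀ as → Representatives (λ x → key x ∈ˡ as)
    representatives List.[] = 0 , (λ ()) , (λ { {()} }) , λ ()
    representatives (a List.∷ as) with key⁻¹ a | representatives as
    ... | yes (x , refl) | reps = adjoin x (λ where
      (here y≡x)   → inj₁ (key-injective (sym y≡x))
      (there y∈as) → inj₂ y∈as) reps
    ... | no ∄x | n , g , injective , covers = n , g , injective , λ where
      (here y≡a)   → contradiction (_ , y≡a) ∄x
      (there y∈as) → covers y∈as

    finite : ∀ as → (∀ a → a ∈ˡ as) → ∃ λ n → HasCardinality S n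
    finite as complete = let n , g , injective , covers = representatives as in n , record
      { to        = λ x → proj₁ (covers (complete (key x)))
      ; from      = g
      ; to-cong   = λ {x} {y} x≈y → injective (≈-trans (proj₂ (covers (complete (key x)))) (≈-trans x≈y (≈-sym (proj₂ (covers (complete (key y)))))))
      ; from-cong = λ { refl → ≈-refl }
      ; inverse   = (λ {i} {x} x≈gi → injective (≈-trans (proj₂ (covers (complete (key x)))) x≈gi))
                  , (λ { {x} refl → proj₂ (covers (complete (key x))) })
      }

-- Conjugation over the subfield of order q, and the functions `⟦_,_⟧` and `h`

module Conjugation {c} {q} (F : FiniteField c (q ℕ.^ 2)) (q-odd : OddPrimePower q) where
  open FieldProperties F public
  open PG2 q F public
  open import Algebra.Properties.Semiring.Mult semiring
    using (×1-homo-*; ×-homo-+)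
  open ≡-Reasoning

  private
    q·1≡0 : q · 1# ≡ 0#
    q·1≡0 = p^k·1≡0⇒p·1≡0 q 2 characteristic

    char = proj₁ q-odd
    degree = proj₁ (proj₂ q-odd)
    q≡pᵏ : q ≡ char ℕ.^ degree
    q≡pᵏ = proj₁ (proj₂ (proj₂ (proj₂ (proj₂ q-odd))))

    open Frobenius (proj₁ (proj₂ (proj₂ q-odd)))
      (p^k·1≡0⇒p·1≡0 char degree (trans (cong (_· 1#) (sym q≡pᵏ)) q·1≡0))

  -- If 2 vanished, the odd number q would have the value 1 in the field, whereas `q · 1#` is 0.
  2≢0 : 1# + 1# ≢ 0#
  2≢0 1+1≡0 with q ℕ.% 2 in eq | m%n<n q 2 | m≡m%n+[m/n]*n q 2
  ... | 0 | _ | _ = proj₂ (proj₂ (proj₂ (proj₂ (proj₂ q-odd)))) (m%n≡0⇒n∣m q 2 eq)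
  ... | suc (suc _) | s≤s (s≤s ()) | _
  ... | 1 | _ | q≡1+2m = 1≢0 $ begin
    1#                              ≡⟨ solve 1 (λ z → :1 := (:1 :+ :0) :+ z :* :0) refl _ ⟩
    1 · 1# + m · 1# * 0#            ≡⟨ cong (λ z → 1 · 1# + m · 1# * z) 1+1≡0 ⟨
    1 · 1# + m · 1# * (1# + 1#)     ≡⟨ cong (λ z → 1 · 1# + m · 1# * (1# + z)) (+-identityʳ 1#) ⟨
    1 · 1# + m · 1# * (2 · 1#)      ≡⟨ cong (1 · 1# +_) (×1-homo-* m 2) ⟨
    1 · 1# + (m ℕ.* 2) · 1#         ≡⟨ ×-homo-+ 1# 1 (m ℕ.* 2) ⟨
    (1 ℕ.+ m ℕ.* 2) · 1#            ≡⟨ cong (_· 1#) q≡1+2m ⟨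
    q · 1#                          ≡⟨ q·1≡0 ⟩
    0#                              ∎
    where m = q ℕ./ 2

  conj : Carrier → Carrier
  conj x = x ^ q

  conj-conj : ∀ x → conj (conj x) ≡ x
  conj-conj x = begin
    (x ^ q) ^ q    ≡⟨ ^-assocʳ x q q ⟩
    x ^ (q ℕ.* q)  ≡⟨ cong (λ m → x ^ (q ℕ.* m)) (ℕ.*-identityʳ q) ⟨
    x ^ (q ℕ.^ 2)  ≡⟨ fermat x ⟩
    x              ∎

  conj-+ : ∀ x y → conj (x + y) ≡ conj x + conj y
  conj-+ x y = subst (λ q → (x + y) ^ q ≡ x ^ q + y ^ q) (sym q≡pᵏ) (^pᵏ-+ degree x y)

  conj-* : ∀ x y → conj (x * y) ≡ conj x * conj y
  conj-* x y = ^-distrib-* x y q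

  -- The exponent q is a variable, so `0# ^ q` does not compute; additivity yields z = z + z for its
  -- value z.
  conj-0 : conj 0# ≡ 0#
  conj-0 = lin (conj-+ 0# 0#)
    where
    lin : conj (0# + 0#) ≡ conj 0# + conj 0# → conj 0# ≡ 0#
    lin eq rewrite +-identityˡ 0# = trans
      (solve 1 (λ z → z := z :+ z :- z) refl (conj 0#)) (trans (cong (_- conj 0#) (sym eq)) (-‿inverseʳ _))

  conj-≢0 : ∀ {x} → x ≢ 0# → conj x ≢ 0#
  conj-≢0 x≢0 x̄≡0 = x≢0 (trans (sym (conj-conj _)) (trans (cong conj x̄≡0) conj-0))

  conj-1 : conj 1# ≡ 1#
  conj-1 = *-cancelˡ (conj-≢0 1≢0) (begin
    conj 1# * conj 1#  ≡⟨ conj-* 1# 1# ⟨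
    conj (1# * 1#)     ≡⟨ cong conj (*-identityˡ 1#) ⟩
    conj 1#            ≡⟨ *-identityʳ _ ⟨
    conj 1# * 1#       ∎)

  conj-neg : ∀ x → conj (- x) ≡ - conj x
  conj-neg x = begin
    conj (- x)                        ≡⟨ solve 2 (λ y z → z := z :+ y :- y) refl (conj x) (conj (- x)) ⟩
    conj (- x) + conj x - conj x      ≡⟨ cong (_- conj x) (conj-+ (- x) x) ⟨
    conj (- x + x) - conj x           ≡⟨ cong (λ z → conj z - conj x) (-‿inverseˡ x) ⟩
    conj 0# - conj x                  ≡⟨ cong (_- conj x) conj-0 ⟩
    0# - conj x                       ≡⟨ +-identityˡ _ ⟩
    - conj x                          ∎

  infixl 7 _⊗_
  infixl 6 _⊕_ _⊝_

  -- These combinators conjugate an expression along its syntax tree. At a leaf, `refl` keeps the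
  -- conjugate, a membership in `𝔽q` drops it, and `conj-conj` cancels a double one.
  _⊕_ : ∀ {x y x′ y′} → conj x ≡ x′ → conj y ≡ y′ → conj (x + y) ≡ x′ + y′
  refl ⊕ refl = conj-+ _ _

  _⊗_ : ∀ {x y x′ y′} → conj x ≡ x′ → conj y ≡ y′ → conj (x * y) ≡ x′ * y′
  refl ⊗ refl = conj-* _ _

  _⊝_ : ∀ {x y x′ y′} → conj x ≡ x′ → conj y ≡ y′ → conj (x - y) ≡ x′ - y′
  _⊝_ {x} {y} refl refl = trans (conj-+ x (- y)) (cong (conj x +_) (conj-neg y))

  ×≡1⇒conj×≡1 : ∀ {x y} → x * y ≡ 1# → conj x * conj y ≡ 1#
  ×≡1⇒conj×≡1 eq = trans (sym (conj-* _ _)) (trans (cong conj eq) conj-1)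

  conj-⁻¹ : ∀ {x} → x ≢ 0# → conj (x ⁻¹) ≡ conj x ⁻¹
  conj-⁻¹ x≢0 = ⁻¹-unique (×≡1⇒conj×≡1 (x*x⁻¹≡1 x≢0))

  -- A certificate of ideal membership: the coefficients that combine known equations into the goal
  -- are passed explicitly, and a polynomial identity is left to the solver. `lin₂` and `lin₃` do
  -- the same with more equations.
  lin₁ : ∀ {l r e f} k → e ≡ f → l - r ≡ k * (e - f) → l ≡ r
  lin₁ {l} {r} {e} k refl eq = x-y≡0⇒x≡y l r (trans eq (trans (cong (k *_) (-‿inverseʳ e)) (zeroʳ k)))

  lin₂ : ∀ {l r e f e′ f′} k k′ → e ≡ f → e′ ≡ f′ → l - r ≡ k * (e - f) + k′ * (e′ - f′) → l ≡ r
  lin₂ {l} {r} {e} {e′ = e′} k k′ refl refl eq = lin₁ k (refl {x = e})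
    (trans eq (trans (cong (λ z → k * (e - e) + k′ * z) (-‿inverseʳ e′)) (solve 2 (λ a k → a :+ k :* :0 := a) refl _ k′)))

  lin₃ : ∀ {l r e f e′ f′ e″ f″} k k′ k″ → e ≡ f → e′ ≡ f′ → e″ ≡ f″ →
         l - r ≡ k * (e - f) + k′ * (e′ - f′) + k″ * (e″ - f″) → l ≡ r
  lin₃ {l} {r} {e} {e′ = e′} {e″ = e″} k k′ k″ refl refl refl eq = lin₂ k k′ (refl {x = e}) (refl {x = e′})
    (trans eq (trans (cong (λ z → k * (e - e) + k′ * (e′ - e′) + k″ * z) (-‿inverseʳ e″)) (solve 2 (λ a k → a :+ k :* :0 := a) refl _ k″)))

  im : Carrier → Carrier
  im z = z - conj z

  -- The alternating bilinear form of the field over `𝔽q`; it vanishes exactly when u and v are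
  -- linearly dependent over `𝔽q`.
  ⟦_,_⟧ : Carrier → Carrier → Carrier
  ⟦ u , v ⟧ = u * conj v - conj u * v

  ⟦,⟧-swap : ∀ u v → ⟦ v , u ⟧ ≡ - ⟦ u , v ⟧
  ⟦,⟧-swap u v = solve 4 (λ u u̅ v v̅ → v :* u̅ :- v̅ :* u := :- (u :* v̅ :- u̅ :* v)) refl u (conj u) v (conj v)

  0⁻¹≡0 : 0# ⁻¹ ≡ 0#
  0⁻¹≡0 with 0# ≟ 0#
  ... | yes _   = refl
  ... | no  0≢0 = contradiction refl 0≢0

  ⁻¹-* : ∀ x y → (x * y) ⁻¹ ≡ x ⁻¹ * y ⁻¹
  ⁻¹-* x y with x ≟ 0#
  ... | yes refl = trans (cong _⁻¹ (zeroˡ y)) (trans 0⁻¹≡0 (sym (zeroˡ _)))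
  ... | no x≢0 with y ≟ 0#
  ...   | yes refl = trans (cong _⁻¹ (zeroʳ x)) (trans 0⁻¹≡0 (sym (zeroʳ _)))
  ...   | no y≢0 = sym (⁻¹-unique (trans
          (solve 4 (λ x y x′ y′ → x :* y :* (x′ :* y′) := x :* x′ :* (y :* y′)) refl x y _ _)
          (trans (cong₂ _*_ (proj₂ (inverse x x≢0)) (proj₂ (inverse y y≢0))) (*-identityˡ 1#))))

  -- At u = X⁻¹ this is u ū times im (a X²), the contribution of a to the equation of the unital.
  h : Carrier → Carrier → Carrier
  h a u = im (a * (conj u * u ⁻¹))

  h-expand : ∀ a {u X} → u * X ≡ 1# → h a u ≡ a * (conj u * X) - conj a * (u * conj X)
  h-expand a {u} {X} uX≡1 with refl ← ⁻¹-unique uX≡1 =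
    cong (λ z → a * (conj u * u ⁻¹) - z) (refl ⊗ (conj-conj u ⊗ refl))

  -- Because κ² κ̄/κ = κ κ̄, the factor is the norm of κ, the same one that `⟦_,_⟧` acquires when
  -- both arguments are multiplied by κ. This is why the diagonal equations survive rescaling with α
  -- and β unchanged.
  h-scale : ∀ a {κ} u → κ ≢ 0# → h (κ * κ * a) (κ * u) ≡ κ * conj κ * h a u
  h-scale a {κ} u κ≢0 = begin
    im (κ * κ * a * (conj (κ * u) * (κ * u) ⁻¹))  ≡⟨ cong im eq ⟩
    im (κ * conj κ * (a * (conj u * u ⁻¹)))       ≡⟨ cong (λ z → κ * conj κ * (a * (conj u * u ⁻¹)) - z) (refl ⊗ conj-conj κ ⊗ refl) ⟩
    κ * conj κ * (a * (conj u * u ⁻¹)) - conj κ * κ * conj (a * (conj u * u ⁻¹))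
      ≡⟨ solve 4 (λ κ κ̅ z z̅ → κ :* κ̅ :* z :- κ̅ :* κ :* z̅ := κ :* κ̅ :* (z :- z̅)) refl κ (conj κ) _ _ ⟩
    κ * conj κ * h a u                            ∎
    where
    eq : κ * κ * a * (conj (κ * u) * (κ * u) ⁻¹) ≡ κ * conj κ * (a * (conj u * u ⁻¹))
    eq = begin
      κ * κ * a * (conj (κ * u) * (κ * u) ⁻¹)           ≡⟨ cong₂ (λ y z → κ * κ * a * (y * z)) (conj-* κ u) (⁻¹-* κ u) ⟩
      κ * κ * a * (conj κ * conj u * (κ ⁻¹ * u ⁻¹))
        ≡⟨ lin₁ (κ * conj κ * (a * (conj u * u ⁻¹))) (x*x⁻¹≡1 κ≢0)
             (solve 6 (λ κ κ̅ κ′ a u̅ u′ → κ :* κ :* a :* (κ̅ :* u̅ :* (κ′ :* u′)) :- κ :* κ̅ :* (a :* (u̅ :* u′))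
               := κ :* κ̅ :* (a :* (u̅ :* u′)) :* (κ :* κ′ :- :1)) refl κ (conj κ) (κ ⁻¹) a (conj u) (u ⁻¹)) ⟩
      κ * conj κ * (a * (conj u * u ⁻¹))                ∎

  -- The quotient ū/u is insensitive to factors from `𝔽q`. This lets the numerator β v - α u replace
  -- the reciprocal abscissa of a diagonal point.
  h-𝔽q : ∀ a {ρ} u → ρ ∈ 𝔽q → ρ ≢ 0# → h a (ρ * u) ≡ h a u
  h-𝔽q a {ρ} u ρ∈𝔽q ρ≢0 = cong (λ z → im (a * z)) $ begin
    conj (ρ * u) * (ρ * u) ⁻¹          ≡⟨ cong₂ _*_ (ρ∈𝔽q ⊗ refl) (⁻¹-* ρ u) ⟩
    ρ * conj u * (ρ ⁻¹ * u ⁻¹)         ≡⟨ lin₁ (conj u * u ⁻¹) (x*x⁻¹≡1 ρ≢0)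
      (solve 4 (λ ρ ρ′ u̅ u′ → ρ :* u̅ :* (ρ′ :* u′) :- u̅ :* u′ := u̅ :* u′ :* (ρ :* ρ′ :- :1)) refl ρ (ρ ⁻¹) (conj u) (u ⁻¹)) ⟩
    conj u * u ⁻¹                      ∎

  -- Parameters of configurations: validity, finiteness, rescaling

  -- The condition for two opposite sides to meet on the unital: the side through (0 , k + α) and
  -- the vertex of abscissa u⁻¹, and the side through (0 , k + β) and the vertex of abscissa v⁻¹.
  -- Exchanging u and v gives the condition for the third pair of opposite sides.
  DiagonalEquation : Carrier → Carrier → Carrier → Carrier → Carrier → Set c
  DiagonalEquation a α β u v =
    β * h a v - α * h a u - α * β * ⟦ u , v ⟧ ≡ (β - α) * h a (β * v - α * u)

  scale-⟦,⟧ : ∀ κ u v → ⟦ κ * u , κ * v ⟧ ≡ κ * conj κ * ⟦ u , v ⟧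
  scale-⟦,⟧ κ u v = begin
    κ * u * conj (κ * v) - conj (κ * u) * (κ * v)
      ≡⟨ cong₂ (λ y z → κ * u * y - z * (κ * v)) (conj-* κ v) (conj-* κ u) ⟩
    κ * u * (conj κ * conj v) - conj κ * conj u * (κ * v)
      ≡⟨ solve 6 (λ κ κ̅ u u̅ v v̅ → κ :* u :* (κ̅ :* v̅) :- κ̅ :* u̅ :* (κ :* v) := κ :* κ̅ :* (u :* v̅ :- u̅ :* v))
           refl κ (conj κ) u (conj u) v (conj v) ⟩
    κ * conj κ * ⟦ u , v ⟧  ∎

  scale-DiagonalEquation : ∀ a {κ} α β u v → κ ≢ 0# →
    DiagonalEquation a α β u v → DiagonalEquation (κ * κ * a) α β (κ * u) (κ * v)
  scale-DiagonalEquation a {κ} α β u v κ≢0 eq = begin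
    β * h a′ (κ * v) - α * h a′ (κ * u) - α * β * ⟦ κ * u , κ * v ⟧
      ≡⟨ cong₂ _-_ (cong₂ (λ y z → β * y - α * z) (h-scale a v κ≢0) (h-scale a u κ≢0)) (cong (α * β *_) (scale-⟦,⟧ κ u v)) ⟩
    β * (N * h a v) - α * (N * h a u) - α * β * (N * ⟦ u , v ⟧)
      ≡⟨ lin₁ N eq (solve 7 (λ α β N x y b z →
           β :* (N :* y) :- α :* (N :* x) :- α :* β :* (N :* b) :- (β :- α) :* (N :* z)
           := N :* (β :* y :- α :* x :- α :* β :* b :- (β :- α) :* z))
           refl α β N (h a u) (h a v) ⟦ u , v ⟧ (h a W)) ⟩
    (β - α) * (N * h a W)
      ≡⟨ cong ((β - α) *_) (h-scale a W κ≢0) ⟨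
    (β - α) * h a′ (κ * W)
      ≡⟨ cong (λ z → (β - α) * h a′ z) (solve 5 (λ κ α β u v → κ :* (β :* v :- α :* u) := β :* (κ :* v) :- α :* (κ :* u)) refl κ α β u v) ⟩
    (β - α) * h a′ (β * (κ * v) - α * (κ * u))  ∎
    where
    a′ = κ * κ * a
    N = κ * conj κ
    W = β * v - α * u

  -- In the frame at s, the special side is the line of abscissa 0: it carries the diagonal
  -- point (0 , k) and the vertices (0 , k + α), (0 , k + β).  The other two vertices have
  -- abscissas u⁻¹, v⁻¹; they lie on a line through (0 , k) whose slope is determined by u, v.
  Parameter : Set c
  Parameter = Carrier × Carrier × Carrier × Carrier × Carrier × Carrier

  -- Membership of k, α and β in `𝔽q` puts the three points of the special side on the unital,
  -- `uv≢0` makes the slope of the line joining the other two vertices well defined, and the last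
  -- two fields are the remaining diagonal points. No field mentions b.
  record Valid (a : Carrier) (d : Parameter) : Set c where
    constructor valid
    field
      k∈𝔽q : proj₁ (proj₂ d) ∈ 𝔽q
    private
      α = proj₁ (proj₂ (proj₂ d))
      β = proj₁ (proj₂ (proj₂ (proj₂ d)))
      u = proj₁ (proj₂ (proj₂ (proj₂ (proj₂ d))))
      v = proj₂ (proj₂ (proj₂ (proj₂ (proj₂ d))))
    field
      α∈𝔽q  : α ∈ 𝔽q
      β∈𝔽q  : β ∈ 𝔽q
      α≢0   : α ≢ 0#
      β≢0   : β ≢ 0#
      α≢β   : α ≢ β
      uv≢0  : ⟦ u , v ⟧ ≢ 0#
      uv-eq : DiagonalEquation a α β u v
      vu-eq : DiagonalEquation a α β v u

  Unordered : Carrier → Carrier → Carrier → Carrier → Set c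
  Unordered x y x′ y′ = (x ≡ x′ × y ≡ y′) ⊎ (x ≡ y′ × y ≡ x′)

  unordered : ∀ {x y x′ y′} → x ≢ y → x ≡ x′ ⊎ x ≡ y′ → y ≡ x′ ⊎ y ≡ y′ → Unordered x y x′ y′
  unordered x≢y (inj₁ refl) (inj₁ refl) = contradiction refl x≢y
  unordered x≢y (inj₁ refl) (inj₂ refl) = inj₁ (refl , refl)
  unordered x≢y (inj₂ refl) (inj₁ refl) = inj₂ (refl , refl)
  unordered x≢y (inj₂ refl) (inj₂ refl) = contradiction refl x≢y

  unordered-sym : ∀ {x y x′ y′} → Unordered x y x′ y′ → Unordered x′ y′ x y
  unordered-sym (inj₁ (refl , refl)) = inj₁ (refl , refl)
  unordered-sym (inj₂ (refl , refl)) = inj₂ (refl , refl)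

  unordered-trans : ∀ {x y x′ y′ x″ y″} → Unordered x y x′ y′ → Unordered x′ y′ x″ y″ → Unordered x y x″ y″
  unordered-trans (inj₁ (refl , refl)) p = p
  unordered-trans (inj₂ (refl , refl)) (inj₁ (refl , refl)) = inj₂ (refl , refl)
  unordered-trans (inj₂ (refl , refl)) (inj₂ (refl , refl)) = inj₁ (refl , refl)

  infix 4 _≋_
  -- As only one side is special, the labellings of a configuration differ by exchanging the two
  -- vertices on that side and, independently, the two vertices off it.
  _≋_ : Parameter → Parameter → Set c
  (s , k , α , β , u , v) ≋ (s′ , k′ , α′ , β′ , u′ , v′) =
    s ≡ s′ × k ≡ k′ × Unordered α β α′ β′ × Unordered u v u′ v′

  ≋-refl : ∀ d → d ≋ d
  ≋-refl _ = refl , refl , inj₁ (refl , refl) , inj₁ (refl , refl)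

  ≋-trans : ∀ d d′ d″ → d ≋ d′ → d′ ≋ d″ → d ≋ d″
  ≋-trans _ _ _ (s , k , αβ , uv) (s′ , k′ , αβ′ , uv′) =
    trans s s′ , trans k k′ , unordered-trans αβ αβ′ , unordered-trans uv uv′

  parameters : Carrier → Setoid c c
  parameters a = record
    { Carrier = Σ Parameter (Valid a)
    ; _≈_ = λ (d , _) (d′ , _) → d ≋ d′
    ; isEquivalence = record
      { refl = λ {(d , _)} → ≋-refl d
      ; sym = λ (s , k , αβ , uv) → sym s , sym k , unordered-sym αβ , unordered-sym uv
      ; trans = λ {(d , _)} {(d′ , _)} {(d″ , _)} → ≋-trans d d′ d″
      }
    }

  elements : List Carrier
  elements = tabulate (Inverse.from enumeration)

  ∈-elements : ∀ x → x ∈ˡ elements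
  ∈-elements x = subst (_∈ˡ elements) (Inverse.strictlyInverseʳ enumeration x) (∈-tabulate⁺ (Inverse.to enumeration x))

  Valid? : ∀ a → Decidable (Valid a)
  Valid? a (s , k , α , β , u , v) = map′
    (λ (k∈ , α∈ , β∈ , α≢0 , β≢0 , α≢β , uv≢0 , uv-eq , vu-eq) → valid k∈ α∈ β∈ α≢0 β≢0 α≢β uv≢0 uv-eq vu-eq)
    (λ (valid k∈ α∈ β∈ α≢0 β≢0 α≢β uv≢0 uv-eq vu-eq) → k∈ , α∈ , β∈ , α≢0 , β≢0 , α≢β , uv≢0 , uv-eq , vu-eq)
    (conj k ≟ k ×-dec conj α ≟ α ×-dec conj β ≟ β ×-dec ¬? (α ≟ 0#) ×-dec ¬? (β ≟ 0#) ×-dec ¬? (α ≟ β) ×-dec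
     ¬? (⟦ u , v ⟧ ≟ 0#) ×-dec DiagonalEquation? u v ×-dec DiagonalEquation? v u)
    where
    DiagonalEquation? : ∀ u v → Dec (DiagonalEquation a α β u v)
    DiagonalEquation? u v = β * h a v - α * h a u - α * β * ⟦ u , v ⟧ ≟ (β - α) * h a (β * v - α * u)

  _≋?_ : Decidable₂ _≋_
  (s , k , α , β , u , v) ≋? (s′ , k′ , α′ , β′ , u′ , v′) =
    s ≟ s′ ×-dec k ≟ k′ ×-dec unordered? α β α′ β′ ×-dec unordered? u v u′ v′
    where
    unordered? : ∀ x y x′ y′ → Dec (Unordered x y x′ y′)
    unordered? x y x′ y′ = (x ≟ x′ ×-dec y ≟ y′) ⊎-dec (x ≟ y′ ×-dec y ≟ x′)

  parameters-finite : ∀ a → ∃ λ n → HasCardinality (parameters a) n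
  parameters-finite a = Finiteness.finite (parameters a) (λ (d , _) (d′ , _) → d ≋? d′) proj₁
    (λ {x} {y} eq → subst (proj₁ x ≋_) eq (≋-refl (proj₁ x))) valid-over
    (cartesianProduct elements (cartesianProduct elements (cartesianProduct elements
      (cartesianProduct elements (cartesianProduct elements elements)))))
    (λ (s , k , α , β , u , v) → ∈-cartesianProduct⁺ (∈-elements s) (∈-cartesianProduct⁺ (∈-elements k) (∈-cartesianProduct⁺ (∈-elements α)
      (∈-cartesianProduct⁺ (∈-elements β) (∈-cartesianProduct⁺ (∈-elements u) (∈-elements v))))))
    where
    valid-over : ∀ d → Dec (∃ λ (e : Σ Parameter (Valid a)) → proj₁ e ≡ d)
    valid-over d = map′ (λ V → (d , V) , refl) (λ { ((_ , V) , refl) → V }) (Valid? a d)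

  rescale : Carrier → Parameter → Parameter
  rescale κ (s , k , α , β , u , v) = s , k , α , β , κ * u , κ * v

  rescale-valid : ∀ {a κ} d → κ ≢ 0# → Valid a d → Valid (κ * κ * a) (rescale κ d)
  rescale-valid {a} {κ} (s , k , α , β , u , v) κ≢0 (valid k∈ α∈ β∈ α≢0 β≢0 α≢β uv≢0 uv-eq vu-eq) =
    valid k∈ α∈ β∈ α≢0 β≢0 α≢β
      (λ eq → *-≢0 (*-≢0 κ≢0 (conj-≢0 κ≢0)) uv≢0 (trans (sym (scale-⟦,⟧ κ u v)) eq))
      (scale-DiagonalEquation a α β u v κ≢0 uv-eq) (scale-DiagonalEquation a α β v u κ≢0 vu-eq)

  rescale-cong : ∀ κ d d′ → d ≋ d′ → rescale κ d ≋ rescale κ d′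
  rescale-cong κ _ _ (s , k , αβ , inj₁ (refl , refl)) = s , k , αβ , inj₁ (refl , refl)
  rescale-cong κ _ _ (s , k , αβ , inj₂ (refl , refl)) = s , k , αβ , inj₂ (refl , refl)

  rescale-rescale : ∀ {κ κ′} → κ * κ′ ≡ 1# → ∀ d → rescale κ (rescale κ′ d) ≋ d
  rescale-rescale {κ} {κ′} κκ′≡1 (s , k , α , β , u , v) = refl , refl , inj₁ (refl , refl) , inj₁ (cancel u , cancel v)
    where
    cancel : ∀ x → κ * (κ′ * x) ≡ x
    cancel x = trans (sym (*-assoc κ κ′ x)) (trans (cong (_* x) κκ′≡1) (*-identityˡ x))

  rescaled-parameters : ∀ {a κ} → κ ≢ 0# → Inverse (parameters a) (parameters (κ * κ * a))
  rescaled-parameters {a} {κ} κ≢0 = record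
    { to = λ (d , V) → rescale κ d , rescale-valid d κ≢0 V
    ; from = λ (d , V) → rescale κ′ d , subst (λ a → Valid a (rescale κ′ d)) cancel (rescale-valid d (⁻¹-≢0 κ≢0) V)
    ; to-cong = λ {(d , _)} {(d′ , _)} → rescale-cong κ d d′
    ; from-cong = λ {(d , _)} {(d′ , _)} → rescale-cong κ′ d d′
    ; inverse =
        (λ {(e , _)} {(d , _)} d≋ → ≋-trans (rescale κ d) (rescale κ (rescale κ′ e)) e
          (rescale-cong κ d (rescale κ′ e) d≋) (rescale-rescale (x*x⁻¹≡1 κ≢0) e))
      , (λ {(d , _)} {(e , _)} e≋ → ≋-trans (rescale κ′ e) (rescale κ′ (rescale κ d)) d
          (rescale-cong κ′ e (rescale κ d) e≋) (rescale-rescale (x⁻¹*x≡1 κ≢0) d))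
    }
    where
    κ′ = κ ⁻¹
    cancel : κ′ * κ′ * (κ * κ * a) ≡ a
    cancel = lin₁ (a * (κ′ * κ + 1#)) (x⁻¹*x≡1 κ≢0)
      (solve 3 (λ κ κ′ a → κ′ :* κ′ :* (κ :* κ :* a) :- a := a :* (κ′ :* κ :+ :1) :* (κ′ :* κ :- :1)) refl κ κ′ a)

  square-class-ratio : ∀ {a a′} → a ≢ 0# → a′ ≢ 0# →
    (IsSquare a × IsSquare a′) ⊎ (¬ IsSquare a × ¬ IsSquare a′) → ∃ λ κ → κ ≢ 0# × a′ ≡ κ * κ * a
  square-class-ratio {a} {a′} a≢0 a′≢0 class = let κ , eq = ratio class in κ , ≢0 κ eq , eq
    where
    ≢0 : ∀ κ → a′ ≡ κ * κ * a → κ ≢ 0#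
    ≢0 κ eq refl = a′≢0 (trans eq (solve 1 (λ a → :0 :* :0 :* a := :0) refl a))
    ratio : (IsSquare a × IsSquare a′) ⊎ (¬ IsSquare a × ¬ IsSquare a′) → ∃ λ κ → a′ ≡ κ * κ * a
    ratio (inj₂ (a∉□ , a′∉□)) = nonsquare-ratio 2≢0 a∉□ a′∉□
    ratio (inj₁ ((y , refl) , (z , refl))) = z * y ⁻¹ , lin₁ (- (z * z * (y * y ⁻¹ + 1#))) (x*x⁻¹≡1 y≢0)
      (solve 3 (λ y y′ z → z :* z :- z :* y′ :* (z :* y′) :* (y :* y) := :- (z :* z :* (y :* y′ :+ :1)) :* (y :* y′ :- :1)) refl y (y ⁻¹) z)
      where
      y≢0 : y ≢ 0#
      y≢0 refl = a≢0 (zeroˡ 0#)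

  -- The affine equation of the unital

  module Affine (a b : Carrier) where
    γ : Carrier
    γ = b - conj b

    Q : Carrier → Carrier
    Q x = im (a * (x * x) + b * (x * conj x))

    Q-expand : ∀ x → Q x ≡ a * (x * x) - conj a * (conj x * conj x) + γ * (x * conj x)
    Q-expand x = trans
      (cong (λ z → a * (x * x) + b * (x * conj x) - z) ((refl ⊗ (refl ⊗ refl)) ⊕ (refl ⊗ (refl ⊗ conj-conj x))))
      (solve 6 (λ a a̅ b b̅ x x̅ → a :* (x :* x) :+ b :* (x :* x̅) :- (a̅ :* (x̅ :* x̅) :+ b̅ :* (x̅ :* x))
         := a :* (x :* x) :- a̅ :* (x̅ :* x̅) :+ (b :- b̅) :* (x :* x̅)) refl a (conj a) b (conj b) x (conj x))

    Q-𝔽q : ∀ {ρ} x → ρ ∈ 𝔽q → Q (ρ * x) ≡ ρ * ρ * Q x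
    Q-𝔽q {ρ} x ρ∈𝔽q = begin
      Q (ρ * x) ≡⟨ Q-expand (ρ * x) ⟩
      a * (ρ * x * (ρ * x)) - conj a * (conj (ρ * x) * conj (ρ * x)) + γ * (ρ * x * conj (ρ * x))
        ≡⟨ cong (λ z → a * (ρ * x * (ρ * x)) - conj a * (z * z) + γ * (ρ * x * z)) (ρ∈𝔽q ⊗ refl) ⟩
      a * (ρ * x * (ρ * x)) - conj a * (ρ * conj x * (ρ * conj x)) + γ * (ρ * x * (ρ * conj x))
        ≡⟨ solve 6 (λ a a̅ γ ρ x x̅ → a :* (ρ :* x :* (ρ :* x)) :- a̅ :* (ρ :* x̅ :* (ρ :* x̅)) :+ γ :* (ρ :* x :* (ρ :* x̅))
             := ρ :* ρ :* (a :* (x :* x) :- a̅ :* (x̅ :* x̅) :+ γ :* (x :* x̅))) refl a (conj a) γ ρ x (conj x) ⟩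
      ρ * ρ * (a * (x * x) - conj a * (conj x * conj x) + γ * (x * conj x)) ≡⟨ cong (ρ * ρ *_) (Q-expand x) ⟨
      ρ * ρ * Q x ∎

    -- Since `im` vanishes exactly on `𝔽q`, applying it to the second coordinate eliminates the free
    -- summand r of the definition of the unital.
    OnU : Carrier → Carrier → Set c
    OnU x y = im y ≡ Q x

    hᵇ : Carrier → Carrier
    hᵇ u = h a u + γ

    -- Multiplying the equation of U by w w̄ turns a point with abscissa w⁻¹ into a
    -- condition on w that is linear in the slope m.
    module _ {m w X κ : Carrier} (wX≡1 : w * X ≡ 1#) (κ∈𝔽q : κ ∈ 𝔽q) where
      private
        w̄X̄≡1 = ×≡1⇒conj×≡1 wX≡1
        m̄ = conj m
        w̄ = conj w
        X̄ = conj X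
        ā = conj a

        im-line : im (m * X + κ) ≡ m * X - m̄ * X̄
        im-line = trans (cong (λ z → m * X + κ - z) ((refl ⊗ refl) ⊕ κ∈𝔽q))
          (solve 3 (λ x y k → x :+ k :- (y :+ k) := x :- y) refl (m * X) (m̄ * X̄) κ)

        cleared : ⟦ m , w ⟧ - hᵇ w ≡ w * w̄ * (im (m * X + κ) - Q X)
        cleared = begin
          ⟦ m , w ⟧ - (h a w + γ)
            ≡⟨ cong (λ z → ⟦ m , w ⟧ - (z + γ)) (h-expand a wX≡1) ⟩
          ⟦ m , w ⟧ - (a * (w̄ * X) - ā * (w * X̄) + γ)
            ≡⟨ lin₂ (a * w̄ * X + γ * X̄ * w̄ - m * w̄) (m̄ * w - ā * w * X̄ + γ) wX≡1 w̄X̄≡1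
              (solve 9 (λ m m̅ w w̅ x x̅ a a̅ γ →
                m :* w̅ :- m̅ :* w :- (a :* (w̅ :* x) :- a̅ :* (w :* x̅) :+ γ)
                :- w :* w̅ :* (m :* x :- m̅ :* x̅ :- (a :* (x :* x) :- a̅ :* (x̅ :* x̅) :+ γ :* (x :* x̅)))
                := (a :* w̅ :* x :+ γ :* x̅ :* w̅ :- m :* w̅) :* (w :* x :- :1)
                :+ (m̅ :* w :- a̅ :* w :* x̅ :+ γ) :* (w̅ :* x̅ :- :1))
                refl m m̄ w w̄ X X̄ a ā γ) ⟩
          w * w̄ * (m * X - m̄ * X̄ - (a * (X * X) - ā * (X̄ * X̄) + γ * (X * X̄)))
            ≡⟨ cong₂ (λ y z → w * w̄ * (y - z)) im-line (Q-expand X) ⟨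
          w * w̄ * (im (m * X + κ) - Q X)  ∎

      OnU⇒slope : OnU X (m * X + κ) → ⟦ m , w ⟧ ≡ hᵇ w
      OnU⇒slope on = lin₁ (w * w̄) on cleared

      slope⇒OnU : ⟦ m , w ⟧ ≡ hᵇ w → OnU X (m * X + κ)
      slope⇒OnU eq = x-y≡0⇒x≡y _ _ (x*y≡0⇒y≡0 (*-≢0 w≢0 (conj-≢0 w≢0))
        (trans (sym cleared) (x≡y⇒x-y≡0 eq)))
        where w≢0 = x*y≡1⇒x≢0 wX≡1

    conj-im : ∀ z → conj (im z) ≡ - im z
    conj-im z = trans (refl ⊝ conj-conj z) (solve 2 (λ z z̅ → z̅ :- z := :- (z :- z̅)) refl z (conj z))

    conj-γ : conj γ ≡ - γ
    conj-γ = conj-im b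

    conj-hᵇ : ∀ u → conj (hᵇ u) ≡ - hᵇ u
    conj-hᵇ u = trans (conj-im _ ⊕ conj-γ) (solve 2 (λ x y → :- x :+ :- y := :- (x :+ y)) refl (h a u) γ)

    conj-⟦,⟧ : ∀ u v → conj ⟦ u , v ⟧ ≡ - ⟦ u , v ⟧
    conj-⟦,⟧ u v = trans ((refl ⊗ conj-conj v) ⊝ (conj-conj u ⊗ refl))
      (solve 4 (λ u u̅ v v̅ → u̅ :* v :- u :* v̅ := :- (u :* v̅ :- u̅ :* v)) refl u (conj u) v (conj v))

    conj-⟦,⟧⁻¹ : ∀ u v → ⟦ u , v ⟧ ≢ 0# → conj (⟦ u , v ⟧ ⁻¹) ≡ - ⟦ u , v ⟧ ⁻¹
    conj-⟦,⟧⁻¹ u v uv≢0 = begin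
      conj (⟦ u , v ⟧ ⁻¹)   ≡⟨ conj-⁻¹ uv≢0 ⟩
      conj ⟦ u , v ⟧ ⁻¹     ≡⟨ cong _⁻¹ (conj-⟦,⟧ u v) ⟩
      (- ⟦ u , v ⟧) ⁻¹      ≡⟨ ⁻¹-unique (trans (solve 2 (λ x y → :- x :* :- y := x :* y) refl ⟦ u , v ⟧ (⟦ u , v ⟧ ⁻¹)) (x*x⁻¹≡1 uv≢0)) ⟨
      - ⟦ u , v ⟧ ⁻¹        ∎

    -- Cramer's rule for the two equations `⟦ m , u ⟧ ≡ hᵇ u` and `⟦ m , v ⟧ ≡ hᵇ v`, based on the
    -- identity ⟦u , v⟧ m = ⟦m , v⟧ u - ⟦m , u⟧ v.
    slope : Carrier → Carrier → Carrier
    slope u v = (hᵇ v * u - hᵇ u * v) * ⟦ u , v ⟧ ⁻¹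

    slope-swap : ∀ u v → ⟦ u , v ⟧ ≢ 0# → slope v u ≡ slope u v
    slope-swap u v uv≢0 = begin
      (hᵇ u * v - hᵇ v * u) * ⟦ v , u ⟧ ⁻¹
        ≡⟨ cong (λ z → (hᵇ u * v - hᵇ v * u) * z) eq ⟩
      (hᵇ u * v - hᵇ v * u) * - ⟦ u , v ⟧ ⁻¹
        ≡⟨ solve 3 (λ x y z → (x :- y) :* :- z := (y :- x) :* z) refl (hᵇ u * v) (hᵇ v * u) (⟦ u , v ⟧ ⁻¹) ⟩
      (hᵇ v * u - hᵇ u * v) * ⟦ u , v ⟧ ⁻¹  ∎
      where
      eq : ⟦ v , u ⟧ ⁻¹ ≡ - ⟦ u , v ⟧ ⁻¹
      eq = trans (cong _⁻¹ (⟦,⟧-swap u v)) (sym (⁻¹-unique (trans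
        (solve 2 (λ x y → :- x :* :- y := x :* y) refl ⟦ u , v ⟧ (⟦ u , v ⟧ ⁻¹)) (x*x⁻¹≡1 uv≢0))))

    -- Both `hᵇ` and `⟦ u , v ⟧` change sign under conjugation, so the conjugate of the slope is
    -- given by the same formula with ū and v̄ in place of u and v.
    ⟦slope,⟧ˡ : ∀ u v → ⟦ u , v ⟧ ≢ 0# → ⟦ slope u v , u ⟧ ≡ hᵇ u
    ⟦slope,⟧ˡ u v uv≢0 = begin
      slope u v * conj u - conj (slope u v) * u
        ≡⟨ cong (λ z → slope u v * conj u - z * u) (((conj-hᵇ v ⊗ refl) ⊝ (conj-hᵇ u ⊗ refl)) ⊗ conj-⟦,⟧⁻¹ u v uv≢0) ⟩
      slope u v * conj u - (- hᵇ v * conj u - - hᵇ u * conj v) * - t * u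
        ≡⟨ lin₁ (hᵇ u) (x*x⁻¹≡1 uv≢0) (solve 7 (λ x y u u̅ v v̅ t →
            (y :* u :- x :* v) :* t :* u̅ :- (:- y :* u̅ :- :- x :* v̅) :* :- t :* u :- x
            := x :* ((u :* v̅ :- u̅ :* v) :* t :- :1)) refl (hᵇ u) (hᵇ v) u (conj u) v (conj v) t) ⟩
      hᵇ u ∎
      where t = ⟦ u , v ⟧ ⁻¹

    ⟦,⟧-swap-≢0 : ∀ {u v} → ⟦ u , v ⟧ ≢ 0# → ⟦ v , u ⟧ ≢ 0#
    ⟦,⟧-swap-≢0 {u} {v} uv≢0 vu≡0 = uv≢0 (trans (⟦,⟧-swap v u)
      (trans (cong -_ vu≡0) (solve 0 (:- :0 := :0) refl)))

    ⟦slope,⟧ʳ : ∀ u v → ⟦ u , v ⟧ ≢ 0# → ⟦ slope u v , v ⟧ ≡ hᵇ v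
    ⟦slope,⟧ʳ u v uv≢0 = trans (cong ⟦_, v ⟧ (sym (slope-swap u v uv≢0))) (⟦slope,⟧ˡ v u (⟦,⟧-swap-≢0 uv≢0))

    slope-unique : ∀ {m} u v → ⟦ u , v ⟧ ≢ 0# → ⟦ m , u ⟧ ≡ hᵇ u → ⟦ m , v ⟧ ≡ hᵇ v → m ≡ slope u v
    slope-unique {m} u v uv≢0 mu mv = *-cancelˡ uv≢0 $ begin
      ⟦ u , v ⟧ * m                             ≡⟨ solve 6 (λ m m̅ u u̅ v v̅ →
                                                    (u :* v̅ :- u̅ :* v) :* m := (m :* v̅ :- m̅ :* v) :* u :- (m :* u̅ :- m̅ :* u) :* v)
                                                    refl m (conj m) u (conj u) v (conj v) ⟩
      ⟦ m , v ⟧ * u - ⟦ m , u ⟧ * v             ≡⟨ cong₂ (λ x y → y * u - x * v) mu mv ⟩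
      hᵇ v * u - hᵇ u * v                       ≡⟨ *-identityˡ _ ⟨
      1# * (hᵇ v * u - hᵇ u * v)                ≡⟨ cong (_* (hᵇ v * u - hᵇ u * v)) (x*x⁻¹≡1 uv≢0) ⟨
      ⟦ u , v ⟧ * ⟦ u , v ⟧ ⁻¹ * (hᵇ v * u - hᵇ u * v) ≡⟨ solve 3 (λ x y z → x :* y :* z := x :* (z :* y)) refl ⟦ u , v ⟧ (⟦ u , v ⟧ ⁻¹) _ ⟩
      ⟦ u , v ⟧ * slope u v                     ∎

    𝔽q-- : ∀ {x y} → x ∈ 𝔽q → y ∈ 𝔽q → x - y ∈ 𝔽q
    𝔽q-- x∈ y∈ = x∈ ⊝ y∈

    x≢y⇒x-y≢0 : ∀ {x y} → x ≢ y → x - y ≢ 0#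
    x≢y⇒x-y≢0 x≢y eq = x≢y (x-y≡0⇒x≡y _ _ eq)

    -- The constant γ drops out of the equation for the diagonal point with abscissa w⁻¹.
    module Diagonal {α β u v m w}
      (α∈𝔽q : α ∈ 𝔽q) (β∈𝔽q : β ∈ 𝔽q) (α≢β : α ≢ β)
      (mu : ⟦ m , u ⟧ ≡ hᵇ u) (mv : ⟦ m , v ⟧ ≡ hᵇ v)
      (w-def : (β - α) * w ≡ β * v - α * u) where
      private
        δ≢0 : β - α ≢ 0#
        δ≢0 = x≢y⇒x-y≢0 (α≢β ∘ sym)

        δ∈𝔽q : β - α ∈ 𝔽q
        δ∈𝔽q = 𝔽q-- β∈𝔽q α∈𝔽q

        w̄-def : (β - α) * conj w ≡ β * conj v - α * conj u
        w̄-def = trans (sym (δ∈𝔽q ⊗ refl)) (trans (cong conj w-def) ((β∈𝔽q ⊗ refl) ⊝ (α∈𝔽q ⊗ refl)))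

        h-W : h a (β * v - α * u) ≡ h a w
        h-W = trans (cong (h a) (sym w-def)) (h-𝔽q a w δ∈𝔽q δ≢0)

        scaled : (β - α) * (⟦ m - α * u , w ⟧ - hᵇ w) ≡
                 β * h a v - α * h a u - α * β * ⟦ u , v ⟧ - (β - α) * h a (β * v - α * u)
        scaled = begin
          (β - α) * (⟦ m - α * u , w ⟧ - hᵇ w)
            ≡⟨ cong (λ z → (β - α) * ((m - α * u) * conj w - z * w - hᵇ w)) (refl ⊝ (α∈𝔽q ⊗ refl)) ⟩
          (β - α) * ((m - α * u) * conj w - (conj m - α * conj u) * w - hᵇ w)
            ≡⟨ solve 9 (λ α β m m̅ u u̅ w w̅ x →
                 (β :- α) :* ((m :- α :* u) :* w̅ :- (m̅ :- α :* u̅) :* w :- x)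
                 := (m :- α :* u) :* ((β :- α) :* w̅) :- (m̅ :- α :* u̅) :* ((β :- α) :* w) :- (β :- α) :* x)
                 refl α β m (conj m) u (conj u) w (conj w) (hᵇ w) ⟩
          (m - α * u) * ((β - α) * conj w) - (conj m - α * conj u) * ((β - α) * w) - (β - α) * hᵇ w
            ≡⟨ cong₂ (λ y z → (m - α * u) * y - (conj m - α * conj u) * z - (β - α) * hᵇ w) w̄-def w-def ⟩
          (m - α * u) * (β * conj v - α * conj u) - (conj m - α * conj u) * (β * v - α * u) - (β - α) * (h a w + γ)
            -- The coefficients β, -α and -(β - α) of the three conditions add up to 0; this is
            -- where γ is distributed over the first two.
            ≡⟨ solve 10 (λ α β m m̅ u u̅ v v̅ x γ →
                 (m :- α :* u) :* (β :* v̅ :- α :* u̅) :- (m̅ :- α :* u̅) :* (β :* v :- α :* u) :- (β :- α) :* (x :+ γ)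
                 := β :* ((m :* v̅ :- m̅ :* v) :- γ) :- α :* ((m :* u̅ :- m̅ :* u) :- γ) :- α :* β :* (u :* v̅ :- u̅ :* v) :- (β :- α) :* x)
                 refl α β m (conj m) u (conj u) v (conj v) (h a w) γ ⟩
          β * (⟦ m , v ⟧ - γ) - α * (⟦ m , u ⟧ - γ) - α * β * ⟦ u , v ⟧ - (β - α) * h a w
            ≡⟨ cong₂ (λ y z → β * (y - γ) - α * (z - γ) - α * β * ⟦ u , v ⟧ - (β - α) * h a w) mv mu ⟩
          β * (hᵇ v - γ) - α * (hᵇ u - γ) - α * β * ⟦ u , v ⟧ - (β - α) * h a w
            ≡⟨ cong₂ (λ y z → β * y - α * z - α * β * ⟦ u , v ⟧ - (β - α) * h a w) (drop (h a v)) (drop (h a u)) ⟩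
          β * h a v - α * h a u - α * β * ⟦ u , v ⟧ - (β - α) * h a w
            ≡⟨ cong (λ z → β * h a v - α * h a u - α * β * ⟦ u , v ⟧ - (β - α) * z) h-W ⟨
          β * h a v - α * h a u - α * β * ⟦ u , v ⟧ - (β - α) * h a (β * v - α * u) ∎
          where
          drop : ∀ x → x + γ - γ ≡ x
          drop x = solve 2 (λ x γ → x :+ γ :- γ := x) refl x γ

      diagonal⇒equation : ⟦ m - α * u , w ⟧ ≡ hᵇ w → DiagonalEquation a α β u v
      diagonal⇒equation eq = x-y≡0⇒x≡y _ _
        (trans (sym scaled) (trans (cong ((β - α) *_) (x≡y⇒x-y≡0 eq)) (zeroʳ _)))

      equation⇒diagonal : DiagonalEquation a α β u v → ⟦ m - α * u , w ⟧ ≡ hᵇ w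
      equation⇒diagonal eq = x-y≡0⇒x≡y _ _ (x*y≡0⇒y≡0 δ≢0 (trans scaled (x≡y⇒x-y≡0 eq)))

    -- If Q x = 0 with x ≠ 0, the discriminant is the square of a x / x̄ + ā x̄ / x.
    anisotropic : IsOrthogonalBM a b → ∀ {x} → x ≢ 0# → Q x ≢ 0#
    anisotropic (_ , d-nonsquare) {x} x≢0 Qx≡0 = d-nonsquare (e , e∈𝔽q , trans expand (sym e²))
      where
      X = x ⁻¹
      x̄ = conj x
      X̄ = conj X
      xX≡1 = x*x⁻¹≡1 x≢0
      x̄X̄≡1 = ×≡1⇒conj×≡1 xX≡1
      g = a * (x * X̄)
      ḡ = conj a * (x̄ * X)
      e = g + ḡ

      e∈𝔽q : e ∈ 𝔽q
      e∈𝔽q = trans ((refl ⊗ (refl ⊗ conj-conj X)) ⊕ (conj-conj a ⊗ (conj-conj x ⊗ refl))) (+-comm _ _)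

      -- The equation Q x = 0, divided by x x̄.
      γ≡ : γ ≡ ḡ - g
      γ≡ = lin₃ (X * X̄) (- (a * x * X̄) - γ * (x̄ * X̄)) (conj a * x̄ * X - γ)
        (trans (sym (Q-expand x)) Qx≡0) xX≡1 x̄X̄≡1
        (solve 7 (λ a a̅ γ x x̅ X X̅ → γ :- (a̅ :* (x̅ :* X) :- a :* (x :* X̅))
          := X :* X̅ :* (a :* (x :* x) :- a̅ :* (x̅ :* x̅) :+ γ :* (x :* x̅) :- :0)
             :+ (:- (a :* x :* X̅) :- γ :* (x̅ :* X̅)) :* (x :* X :- :1)
             :+ (a̅ :* x̅ :* X :- γ) :* (x̅ :* X̅ :- :1)) refl a (conj a) γ x x̄ X X̄)

      d = (b - b ^ q) ^ 2 + 4 · a ^ (q ℕ.+ 1)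

      expand : d ≡ γ * γ + (1# + 1# + (1# + 1#)) * (a * conj a)
      expand = trans (cong (λ z → γ ^ 2 + 4 · z) (^-homo-* a q 1))
        (solve 3 (λ γ a a̅ → γ :* (γ :* :1) :+ (a̅ :* (a :* :1) :+ (a̅ :* (a :* :1) :+ (a̅ :* (a :* :1) :+ (a̅ :* (a :* :1) :+ :0))))
          := γ :* γ :+ (:1 :+ :1 :+ (:1 :+ :1)) :* (a :* a̅)) refl γ a (conj a))

      -- Here (g + ḡ)² - (ḡ - g)² = 4 g ḡ, and g ḡ = a ā because the factors x and x̄ cancel.
      e² : e * e ≡ γ * γ + (1# + 1# + (1# + 1#)) * (a * conj a)
      e² = trans (lin₂ (four * a * conj a * (x̄ * X̄)) (four * a * conj a) xX≡1 x̄X̄≡1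
        (solve 6 (λ a a̅ x x̅ X X̅ →
          (a :* (x :* X̅) :+ a̅ :* (x̅ :* X)) :* (a :* (x :* X̅) :+ a̅ :* (x̅ :* X))
          :- ((a̅ :* (x̅ :* X) :- a :* (x :* X̅)) :* (a̅ :* (x̅ :* X) :- a :* (x :* X̅)) :+ (:1 :+ :1 :+ (:1 :+ :1)) :* (a :* a̅))
          := (:1 :+ :1 :+ (:1 :+ :1)) :* a :* a̅ :* (x̅ :* X̅) :* (x :* X :- :1) :+ (:1 :+ :1 :+ (:1 :+ :1)) :* a :* a̅ :* (x̅ :* X̅ :- :1))
          refl a (conj a) x x̄ X X̄))
        (cong (λ z → z * z + four * (a * conj a)) (sym γ≡))
        where four = 1# + 1# + (1# + 1#)

    Q-0 : Q 0# ≡ 0#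
    Q-0 = trans (Q-expand 0#)
      (trans (cong (λ z → a * (0# * 0#) - conj a * (z * z) + γ * (0# * z)) conj-0)
        (solve 3 (λ a a̅ γ → a :* (:0 :* :0) :- a̅ :* (:0 :* :0) :+ γ :* (:0 :* :0) := :0) refl a (conj a) γ))

    OnU-0⇒𝔽q : ∀ {k} → OnU 0# k → k ∈ 𝔽q
    OnU-0⇒𝔽q on = sym (x-y≡0⇒x≡y _ _ (trans on Q-0))

    𝔽q⇒OnU-0 : ∀ {k} → k ∈ 𝔽q → OnU 0# k
    𝔽q⇒OnU-0 k∈𝔽q = trans (x≡y⇒x-y≡0 (sym k∈𝔽q)) (sym Q-0)

    im-+𝔽q : ∀ {z k} → k ∈ 𝔽q → im (z + k) ≡ im z
    im-+𝔽q {z} {k} k∈ = trans (cong (λ w → z + k - w) (refl ⊕ k∈))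
      (solve 3 (λ z z̅ k → z :+ k :- (z̅ :+ k) := z :- z̅) refl z (conj z) k)

    im-𝔽q* : ∀ {ρ z} → ρ ∈ 𝔽q → im (ρ * z) ≡ ρ * im z
    im-𝔽q* {ρ} {z} ρ∈ = trans (cong (λ w → ρ * z - w) (ρ∈ ⊗ refl))
      (solve 3 (λ z z̅ k → k :* z :- k :* z̅ := k :* (z :- z̅)) refl z (conj z) ρ)

    -- On an 𝔽q-line of abscissas Q is a quadratic polynomial with non-zero leading
    -- coefficient, so it agrees with an affine function in at most two points.
    collinear⇒independent : IsOrthogonalBM a b → ∀ {k X₁ Y₁ X₂ Y₂} → OnU 0# k → OnU X₁ Y₁ → OnU X₂ Y₂ →
      X₁ * (Y₂ - k) ≡ X₂ * (Y₁ - k) → X₁ ≢ 0# → X₂ ≢ 0# → X₁ ≢ X₂ → ⟦ X₁ , X₂ ⟧ ≢ 0#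
    collinear⇒independent bm {k} {X₁} {Y₁} {X₂} {Y₂} on₀ on₁ on₂ col X₁≢0 X₂≢0 X₁≢X₂ dep =
      *-≢0 (*-≢0 ρ≢0 (x≢y⇒x-y≢0 ρ≢1)) (anisotropic bm X₁≢0) (begin
        ρ * (ρ - 1#) * Q X₁      ≡⟨ solve 2 (λ ρ z → ρ :* (ρ :- :1) :* z := ρ :* ρ :* z :- ρ :* z) refl ρ (Q X₁) ⟩
        ρ * ρ * Q X₁ - ρ * Q X₁  ≡⟨ x≡y⇒x-y≡0 parabola ⟩
        0#                       ∎)
      where
      ρ = X₂ * X₁ ⁻¹
      k∈𝔽q = OnU-0⇒𝔽q on₀

      ρ*X₁≡X₂ : ρ * X₁ ≡ X₂
      ρ*X₁≡X₂ = trans (*-assoc _ _ _) (trans (cong (X₂ *_) (x⁻¹*x≡1 X₁≢0)) (*-identityʳ X₂))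

      ρ≢0 : ρ ≢ 0#
      ρ≢0 = *-≢0 X₂≢0 (⁻¹-≢0 X₁≢0)

      ρ≢1 : ρ ≢ 1#
      ρ≢1 ρ≡1 = X₁≢X₂ (trans (sym (*-identityˡ X₁)) (trans (cong (_* X₁) (sym ρ≡1)) ρ*X₁≡X₂))

      -- The assumed dependence says that X₁ X̄₂ = X̄₁ X₂, so the ratio of the two abscissas is
      -- fixed by conjugation.
      ρ∈𝔽q : ρ ∈ 𝔽q
      ρ∈𝔽q = *-cancelˡ X₁≢0 (*-cancelˡ (conj-≢0 X₁≢0) (begin
        conj X₁ * (X₁ * conj ρ)         ≡⟨ solve 3 (λ x x̅ ρ → x̅ :* (x :* ρ) := x :* (ρ :* x̅)) refl X₁ (conj X₁) (conj ρ) ⟩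
        X₁ * (conj ρ * conj X₁)         ≡⟨ cong (X₁ *_) (trans (sym (conj-* ρ X₁)) (cong conj ρ*X₁≡X₂)) ⟩
        X₁ * conj X₂                    ≡⟨ x-y≡0⇒x≡y _ _ dep ⟩
        conj X₁ * X₂                    ≡⟨ cong (conj X₁ *_) (trans (sym ρ*X₁≡X₂) (*-comm ρ X₁)) ⟩
        conj X₁ * (X₁ * ρ)              ∎))

      Y₂≡ : Y₂ ≡ ρ * (Y₁ - k) + k
      Y₂≡ = *-cancelˡ X₁≢0 (lin₂ 1# (k - Y₁) col ρ*X₁≡X₂
        (solve 6 (λ X₁ X₂ Y₁ Y₂ k ρ → X₁ :* Y₂ :- X₁ :* (ρ :* (Y₁ :- k) :+ k)
          := :1 :* (X₁ :* (Y₂ :- k) :- X₂ :* (Y₁ :- k)) :+ (k :- Y₁) :* (ρ :* X₁ :- X₂)) refl X₁ X₂ Y₁ Y₂ k ρ))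

      parabola : ρ * ρ * Q X₁ ≡ ρ * Q X₁
      parabola = begin
        ρ * ρ * Q X₁               ≡⟨ Q-𝔽q X₁ ρ∈𝔽q ⟨
        Q (ρ * X₁)                 ≡⟨ cong Q ρ*X₁≡X₂ ⟩
        Q X₂                       ≡⟨ on₂ ⟨
        im Y₂                      ≡⟨ cong im Y₂≡ ⟩
        im (ρ * (Y₁ - k) + k)      ≡⟨ im-+𝔽q k∈𝔽q ⟩
        im (ρ * (Y₁ - k))          ≡⟨ im-𝔽q* ρ∈𝔽q ⟩
        ρ * im (Y₁ - k)            ≡⟨ cong (ρ *_) (im-+𝔽q (trans (conj-neg k) (cong -_ k∈𝔽q))) ⟩
        ρ * im Y₁                  ≡⟨ cong (ρ *_) on₁ ⟩
        ρ * Q X₁                   ∎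

    -- No O'Nan configuration of U contains T∞.
    wilbrink : IsOrthogonalBM a b → ∀ {k X₁ Y₁ Y₁′ X₂ Y₂ Y₂′} → OnU 0# k →
      OnU X₁ Y₁ → OnU X₁ Y₁′ → OnU X₂ Y₂ → OnU X₂ Y₂′ →
      X₁ * (Y₂ - k) ≡ X₂ * (Y₁ - k) → X₁ * (Y₂′ - k) ≡ X₂ * (Y₁′ - k) →
      X₁ ≢ 0# → X₂ ≢ 0# → X₁ ≢ X₂ → Y₁ ≡ Y₁′
    wilbrink bm {k} {X₁} {Y₁} {Y₁′} {X₂} {Y₂} {Y₂′} on₀ on₁ on₁′ on₂ on₂′ col col′ X₁≢0 X₂≢0 X₁≢X₂ =
      x-y≡0⇒x≡y _ _ (x*y≡0⇒y≡0 (collinear⇒independent bm on₀ on₁ on₂ col X₁≢0 X₂≢0 X₁≢X₂) (begin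
        (X₁ * conj X₂ - conj X₁ * X₂) * δ₁
          ≡⟨ solve 5 (λ x x̅ y y̅ d → (x :* y̅ :- x̅ :* y) :* d := x :* (y̅ :* d) :- x̅ :* (y :* d)) refl X₁ (conj X₁) X₂ (conj X₂) δ₁ ⟩
        X₁ * (conj X₂ * δ₁) - conj X₁ * (X₂ * δ₁)
          ≡⟨ cong₂ (λ y z → X₁ * y - conj X₁ * z) (sym eq̄) (sym eq) ⟩
        X₁ * (conj X₁ * δ₂) - conj X₁ * (X₁ * δ₂)
          ≡⟨ solve 3 (λ x x̅ d → x :* (x̅ :* d) :- x̅ :* (x :* d) := :0) refl X₁ (conj X₁) δ₂ ⟩
        0# ∎))
      where
      δ₁ = Y₁ - Y₁′
      δ₂ = Y₂ - Y₂′

      difference∈𝔽q : ∀ {y y′ z} → im y ≡ z → im y′ ≡ z → y - y′ ∈ 𝔽q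
      difference∈𝔽q {y} {y′} {z} e e′ = trans (refl ⊝ refl) (lin₂ (- 1#) 1# e e′
        (solve 5 (λ y y̅ y′ y̅′ z → y̅ :- y̅′ :- (y :- y′) := :- :1 :* (y :- y̅ :- z) :+ :1 :* (y′ :- y̅′ :- z))
          refl y (conj y) y′ (conj y′) z))

      -- Points of the unital with the same abscissa have ordinates that differ by an element of
      -- `𝔽q`. This relation is therefore a dependence between X₁ and X₂ over `𝔽q`, and their
      -- independence makes the difference δ₁ vanish.
      eq : X₁ * δ₂ ≡ X₂ * δ₁
      eq = lin₂ 1# (- 1#) col col′
        (solve 7 (λ x y k y₁ y₁′ y₂ y₂′ → x :* (y₂ :- y₂′) :- y :* (y₁ :- y₁′)
          := :1 :* (x :* (y₂ :- k) :- y :* (y₁ :- k)) :+ :- :1 :* (x :* (y₂′ :- k) :- y :* (y₁′ :- k)))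
          refl X₁ X₂ k Y₁ Y₁′ Y₂ Y₂′)

      eq̄ : conj X₁ * δ₂ ≡ conj X₂ * δ₁
      eq̄ = trans (sym (refl ⊗ difference∈𝔽q on₂ on₂′)) (trans (cong conj eq) (refl ⊗ difference∈𝔽q on₁ on₁′))

    -- Homogeneous points, and affine coordinates in a frame

    open Point

    ∼-refl : ∀ {v} → v ∼ v
    ∼-refl = 1# , 1≢0 , λ i → sym (*-identityˡ _)

    ∼-sym : ∀ {v w} → v ∼ w → w ∼ v
    ∼-sym {v} {w} (t , t≢0 , eq) = t ⁻¹ , ⁻¹-≢0 t≢0 , λ i → sym (begin
      t ⁻¹ * v i        ≡⟨ cong (t ⁻¹ *_) (eq i) ⟩
      t ⁻¹ * (t * w i)  ≡⟨ *-assoc _ _ _ ⟨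
      t ⁻¹ * t * w i    ≡⟨ cong (_* w i) (x⁻¹*x≡1 t≢0) ⟩
      1# * w i          ≡⟨ *-identityˡ _ ⟩
      w i               ∎)

    ∼-trans : ∀ {u v w} → u ∼ v → v ∼ w → u ∼ w
    ∼-trans (t , t≢0 , eq) (t′ , t′≢0 , eq′) =
      t * t′ , *-≢0 t≢0 t′≢0 , λ i → trans (eq i) (trans (cong (t *_) (eq′ i)) (sym (*-assoc _ _ _)))

    on-∼ : ∀ {P P′ l} → coords P ∼ coords P′ → P on-line l → P′ on-line l
    on-∼ {P} {P′} {l} (t , t≢0 , eq) on = x*y≡0⇒y≡0 t≢0 (begin
      t * sum (λ i → L i * v′ i)
        ≡⟨ solve 7 (λ t a b c x y z → t :* (a :* x :+ (b :* y :+ (c :* z :+ :0))) := a :* (t :* x) :+ (b :* (t :* y) :+ (c :* (t :* z) :+ :0)))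
             refl t (L 0F) (L 1F) (L 2F) (v′ 0F) (v′ 1F) (v′ 2F) ⟩
      L 0F * (t * v′ 0F) + (L 1F * (t * v′ 1F) + (L 2F * (t * v′ 2F) + 0#))
        ≡⟨ cong₂ (λ x y → L 0F * x + y) (eq 0F) (cong₂ (λ x y → L 1F * x + (L 2F * y + 0#)) (eq 1F) (eq 2F)) ⟨
      sum (λ i → L i * coords P i)  ≡⟨ on ⟩
      0#                            ∎)
      where
      L = Line.coords l
      v′ = coords P′

    collinear-∼₃ : ∀ {P Q R R′} → coords R ∼ coords R′ → Collinear P Q R → Collinear P Q R′
    collinear-∼₃ {R = R} {R′} R∼R′ (l , P-on , Q-on , R-on) = l , P-on , Q-on , on-∼ {R} {R′} {l} R∼R′ R-on

    collinear-swap₁₂ : ∀ {P Q R} → Collinear P Q R → Collinear Q P R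
    collinear-swap₁₂ (l , P-on , Q-on , R-on) = l , Q-on , P-on , R-on

    collinear-rotate : ∀ {P Q R} → Collinear P Q R → Collinear Q R P
    collinear-rotate (l , P-on , Q-on , R-on) = l , Q-on , R-on , P-on

    IsT∞ : Point → Set c
    IsT∞ P = coords P ∼ coords T∞

    T∞-on : ∀ {l} → Line.coords l 1F ≡ 0# → T∞ on-line l
    T∞-on {l} l₁≡0 = trans (cong (λ z → L 0F * 0# + (z * 1# + (L 2F * 0# + 0#))) l₁≡0)
      (solve 2 (λ x z → x :* :0 :+ (:0 :* :1 :+ (z :* :0 :+ :0)) := :0) refl (L 0F) (L 2F))
      where L = Line.coords l

    on-T∞ : ∀ {l} → T∞ on-line l → Line.coords l 1F ≡ 0#
    on-T∞ {l} on = trans (solve 3 (λ x y z → y := x :* :0 :+ (y :* :1 :+ (z :* :0 :+ :0))) refl (L 0F) (L 1F) (L 2F)) on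
      where L = Line.coords l

    parabola : Carrier → Carrier
    parabola x = a * x ^ 2 + b * x ^ (q ℕ.+ 1)

    im-parabola : ∀ x → im (parabola x) ≡ Q x
    im-parabola x = cong im (cong₂ (λ y z → a * y + b * z)
      (cong (x *_) (*-identityʳ x)) (trans (^-homo-* x q 1) (trans (cong (conj x *_) (*-identityʳ x)) (*-comm _ _))))

    im-- : ∀ x y → im (x - y) ≡ im x - im y
    im-- x y = trans (cong (λ z → x - y - z) (refl ⊝ refl))
      (solve 4 (λ x x̅ y y̅ → x :- y :- (x̅ :- y̅) := x :- x̅ :- (y :- y̅)) refl x (conj x) y (conj y))

    affine∈𝒰 : ∀ P {x y} → coords P ∼ (x ∷ y ∷ 1# ∷ []) → OnU x y → P ∈ 𝒰 a b
    affine∈𝒰 P {x} {y} (t , t≢0 , eq) on = inj₁ (x , y - parabola x , r∈𝔽q , t , t≢0 , eq′)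
      where
      r∈𝔽q : y - parabola x ∈ 𝔽q
      r∈𝔽q = sym (x-y≡0⇒x≡y _ _ (trans (im-- y (parabola x)) (x≡y⇒x-y≡0 (trans on (sym (im-parabola x))))))
      eq′ : ∀ i → coords P i ≡ t * (x ∷ parabola x + (y - parabola x) ∷ 1# ∷ []) i
      eq′ 0F = eq 0F
      eq′ 1F = trans (eq 1F) (cong (t *_) (solve 2 (λ y p → y := p :+ (y :- p)) refl y (parabola x)))
      eq′ 2F = eq 2F

    ∈𝒰-affine : ∀ P → P ∈ 𝒰 a b → (∃₂ λ x y → coords P ∼ (x ∷ y ∷ 1# ∷ []) × OnU x y) ⊎ IsT∞ P
    ∈𝒰-affine P (inj₂ ∼T∞) = inj₂ ∼T∞
    ∈𝒰-affine P (inj₁ (x , r , r∈𝔽q , P∼)) = inj₁ (x , parabola x + r , P∼ , trans (im-+𝔽q r∈𝔽q) (im-parabola x))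

    -- The collineation (X , Y) ↦ (s + X , origin + tilt X + Y) maps U to itself, so in the
    -- coordinates X, Y the equation of U does not depend on s.
    module Frame (s : Carrier) where
      -- These are forced by expanding Q (s + X): `im origin` is Q s, and `im (tilt * X)` is the
      -- mixed term. The summand `γ * conj s` yields both mixed products of s and X because γ
      -- changes sign under conjugation.
      origin tilt : Carrier
      origin = a * (s * s) + b * (s * conj s)
      tilt = (a + a) * s + γ * conj s

      vec : Carrier → Carrier → V
      vec X Y = s + X ∷ origin + tilt * X + Y ∷ 1# ∷ []

      -- A record instead of an abbreviation, so that X and Y can be inferred from a proof; they
      -- cannot be read off the unfolded coordinate vector.
      record At (P : Point) (X Y : Carrier) : Set c where
        constructor scaled
        field proportional : coords P ∼ vec X Y

      shear : ∀ X Y → im (origin + tilt * X + Y) - Q (s + X) ≡ im Y - Q X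
      shear X Y = begin
        im (origin + tilt * X + Y) - Q (s + X)
          ≡⟨ cong₂ (λ y z → origin + tilt * X + Y - y - z) conj-ordinate (Q-expand (s + X)) ⟩
        _ ≡⟨ cong (λ z → origin + tilt * X + Y - (conj a * (s̄ * s̄) + conj b * (s̄ * s) + ((conj a + conj a) * s̄ + - γ * s) * X̄ + Ȳ)
                         - (a * ((s + X) * (s + X)) - conj a * (z * z) + γ * ((s + X) * z))) (conj-+ s X) ⟩
        _ ≡⟨ solve 10 (λ a a̅ b b̅ s s̅ X X̅ Y Y̅ →
               a :* (s :* s) :+ b :* (s :* s̅) :+ ((a :+ a) :* s :+ (b :- b̅) :* s̅) :* X :+ Y
               :- (a̅ :* (s̅ :* s̅) :+ b̅ :* (s̅ :* s) :+ ((a̅ :+ a̅) :* s̅ :+ :- (b :- b̅) :* s) :* X̅ :+ Y̅)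
               :- (a :* ((s :+ X) :* (s :+ X)) :- a̅ :* ((s̅ :+ X̅) :* (s̅ :+ X̅)) :+ (b :- b̅) :* ((s :+ X) :* (s̅ :+ X̅)))
               := Y :- Y̅ :- (a :* (X :* X) :- a̅ :* (X̅ :* X̅) :+ (b :- b̅) :* (X :* X̅)))
               refl a (conj a) b (conj b) s s̄ X X̄ Y Ȳ ⟩
        _ ≡⟨ cong (λ z → im Y - z) (Q-expand X) ⟨
        im Y - Q X ∎
        where
        s̄ = conj s
        X̄ = conj X
        Ȳ = conj Y
        conj-ordinate : conj (origin + tilt * X + Y) ≡
          conj a * (s̄ * s̄) + conj b * (s̄ * s) + ((conj a + conj a) * s̄ + - γ * s) * X̄ + Ȳ
        conj-ordinate = ((refl ⊗ (refl ⊗ refl)) ⊕ (refl ⊗ (refl ⊗ conj-conj s)))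
          ⊕ (((refl ⊕ refl) ⊗ refl) ⊕ (conj-γ ⊗ conj-conj s)) ⊗ refl ⊕ refl

      At-≡ : ∀ {P X X′ Y Y′} → X ≡ X′ → Y ≡ Y′ → At P X Y → At P X′ Y′
      At-≡ refl refl at = at

      At-unique : ∀ {P P′ X Y} → At P X Y → At P′ X Y → coords P ∼ coords P′
      At-unique (scaled p) (scaled p′) = ∼-trans p (∼-sym p′)

      recentre : ∀ P {x y} → coords P ∼ (x ∷ y ∷ 1# ∷ []) → OnU x y → ∃ λ Y → At P (x - s) Y × OnU (x - s) Y
      recentre P {x} {y} (t , t≢0 , eq) on = Y , scaled (t , t≢0 , eq′) , x-y≡0⇒x≡y _ _ (begin
        im Y - Q (x - s)                                      ≡⟨ shear (x - s) Y ⟨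
        im (origin + tilt * (x - s) + Y) - Q (s + (x - s))    ≡⟨ cong₂ (λ y z → im y - Q z) (rearrange p y) (rearrange s x) ⟩
        im y - Q x                                            ≡⟨ x≡y⇒x-y≡0 on ⟩
        0#                                                    ∎)
        where
        p = origin + tilt * (x - s)
        Y = y - p
        rearrange : ∀ p y → p + (y - p) ≡ y
        rearrange p y = solve 2 (λ p y → p :+ (y :- p) := y) refl p y
        eq′ : ∀ i → coords P i ≡ t * vec (x - s) Y i
        eq′ 0F = trans (eq 0F) (cong (t *_) (sym (rearrange s x)))
        eq′ 1F = trans (eq 1F) (cong (t *_) (sym (rearrange p y)))
        eq′ 2F = eq 2F

      abstract
        classify : ∀ P → P ∈ 𝒰 a b → (∃₂ λ X Y → At P X Y × OnU X Y) ⊎ IsT∞ P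
        classify P P∈U = map₁ (λ (x , y , P∼ , on) → x - s , recentre P P∼ on) (∈𝒰-affine P P∈U)

      At⇒∈𝒰 : ∀ {P X Y} → At P X Y → OnU X Y → P ∈ 𝒰 a b
      At⇒∈𝒰 {P} {X} {Y} (scaled P∼) on =
        affine∈𝒰 P P∼ (x-y≡0⇒x≡y _ _ (trans (shear X Y) (x≡y⇒x-y≡0 on)))

      pt : Carrier → Carrier → Point
      pt X Y = point (vec X Y) (2F , 1≢0)

      evaluate : Line → Carrier → Carrier → Carrier
      evaluate l X Y = (L 0F + L 1F * tilt) * X + L 1F * Y + (L 0F * s + L 1F * origin + L 2F)
        where L = Line.coords l

      on-pt : ∀ l X Y → sum (λ i → Line.coords l i * vec X Y i) ≡ evaluate l X Y
      on-pt l X Y = solve 8 (λ L₀ L₁ L₂ s o t X Y →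
        L₀ :* (s :+ X) :+ (L₁ :* (o :+ t :* X :+ Y) :+ (L₂ :* :1 :+ :0))
        := (L₀ :+ L₁ :* t) :* X :+ L₁ :* Y :+ (L₀ :* s :+ L₁ :* o :+ L₂)) refl (L 0F) (L 1F) (L 2F) s origin tilt X Y
        where L = Line.coords l

      on⇒evaluate : ∀ {P X Y} l → At P X Y → P on-line l → evaluate l X Y ≡ 0#
      on⇒evaluate {P} {X} {Y} l (scaled at) on = trans (sym (on-pt l X Y)) (on-∼ {P} {pt X Y} {l} at on)

      evaluate⇒on : ∀ {P X Y} l → At P X Y → evaluate l X Y ≡ 0# → P on-line l
      evaluate⇒on {P} {X} {Y} l (scaled at) ev = on-∼ {pt X Y} {P} {l} (∼-sym at) (trans (on-pt l X Y) ev)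

      -- The line Y = m X + κ of the frame, written in the original coordinates.
      spoke : Carrier → Carrier → Line
      spoke m κ = line (m + tilt ∷ - 1# ∷ origin + κ - (m + tilt) * s ∷ []) (1F , -1≢0)
        where
        -1≢0 : - 1# ≢ 0#
        -1≢0 eq = 1≢0 (trans (sym (-‿involutive 1#)) (trans (cong -_ eq) (solve 0 (:- :0 := :0) refl)))

      evaluate-spoke : ∀ m κ X Y → evaluate (spoke m κ) X Y ≡ m * X + κ - Y
      evaluate-spoke m κ X Y = solve 7 (λ m k s o t X Y →
        (m :+ t :+ :- :1 :* t) :* X :+ :- :1 :* Y :+ ((m :+ t) :* s :+ :- :1 :* o :+ (o :+ k :- (m :+ t) :* s))
        := m :* X :+ k :- Y) refl m κ s origin tilt X Y

      on-spoke : ∀ {P m κ X Y} → At P X Y → m * X + κ ≡ Y → P on-line spoke m κ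
      on-spoke {m = m} {κ} {X} {Y} at eq =
        evaluate⇒on (spoke m κ) at (trans (evaluate-spoke m κ X Y) (x≡y⇒x-y≡0 eq))

      spoke-on : ∀ {P m κ X Y} → At P X Y → P on-line spoke m κ → m * X + κ ≡ Y
      spoke-on {m = m} {κ} {X} {Y} at on =
        x-y≡0⇒x≡y _ _ (trans (sym (evaluate-spoke m κ X Y)) (on⇒evaluate (spoke m κ) at on))

      vertical : Carrier → Line
      vertical X = line (1# ∷ 0# ∷ - (s + X) ∷ []) (0F , 1≢0)

      evaluate-vertical : ∀ X₀ X Y → evaluate (vertical X₀) X Y ≡ X - X₀
      evaluate-vertical X₀ X Y = solve 6 (λ X₀ s o t X Y →
        (:1 :+ :0 :* t) :* X :+ :0 :* Y :+ (:1 :* s :+ :0 :* o :+ :- (s :+ X₀)) := X :- X₀)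
        refl X₀ s origin tilt X Y

      on-vertical : ∀ {P X₀ X Y} → At P X Y → X ≡ X₀ → P on-line vertical X₀
      on-vertical {X₀ = X₀} {X} {Y} at eq =
        evaluate⇒on (vertical X₀) at (trans (evaluate-vertical X₀ X Y) (x≡y⇒x-y≡0 eq))

      vertical-on : ∀ {P X₀ X Y} → At P X Y → P on-line vertical X₀ → X ≡ X₀
      vertical-on {X₀ = X₀} {X} {Y} at on =
        x-y≡0⇒x≡y _ _ (trans (sym (evaluate-vertical X₀ X Y)) (on⇒evaluate (vertical X₀) at on))

      vertical-collinear : ∀ {P Q R X Y Y′ Y″} → At P X Y → At Q X Y′ → At R X Y″ → Collinear P Q R
      vertical-collinear {X = X} P-at Q-at R-at =
        vertical X , on-vertical P-at refl , on-vertical Q-at refl , on-vertical R-at refl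

      T∞-collinear : ∀ {P Q R X Y Y′} → IsT∞ P → At Q X Y → At R X Y′ → Collinear P Q R
      T∞-collinear {P} {X = X} P-T∞ Q-at R-at =
        vertical X , on-∼ {T∞} {P} {vertical X} (∼-sym P-T∞) (T∞-on {vertical X} refl) ,
        on-vertical Q-at refl , on-vertical R-at refl

      -- Such a line could only be the line at infinity, which has no affine point.
      vanishing-line : ∀ l {X Y} → Line.coords l 1F ≡ 0# → Line.coords l 0F ≡ 0# → evaluate l X Y ≡ 0# → ⊥
      vanishing-line (line L (i , Lᵢ≢0)) {X} {Y} L₁≡0 L₀≡0 ev = Lᵢ≢0 (zeros i)
        where
        zeros : ∀ i → L i ≡ 0#
        zeros 0F = L₀≡0
        zeros 1F = L₁≡0
        zeros 2F = lin₃ 1# (- (X + s)) (- (tilt * X + Y + origin)) ev L₀≡0 L₁≡0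
          (solve 8 (λ L₀ L₁ L₂ s o t X Y → L₂ :- :0
            := :1 :* ((L₀ :+ L₁ :* t) :* X :+ L₁ :* Y :+ (L₀ :* s :+ L₁ :* o :+ L₂) :- :0)
            :+ :- (X :+ s) :* (L₀ :- :0) :+ :- (t :* X :+ Y :+ o) :* (L₁ :- :0))
            refl (L 0F) (L 1F) (L 2F) s origin tilt X Y)

      vertical-abscissa : ∀ {P P′ X Y X′ Y′} l → Line.coords l 1F ≡ 0# → At P X Y → At P′ X′ Y′ →
                          P on-line l → P′ on-line l → X ≡ X′
      vertical-abscissa {X = X} {Y} {X′} {Y′} l L₁≡0 P-at P′-at P-on P′-on with Line.coords l 0F ≟ 0#
      ... | yes L₀≡0 = ⊥-elim (vanishing-line l L₁≡0 L₀≡0 (on⇒evaluate l P-at P-on))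
      ... | no  L₀≢0 = *-cancelˡ L₀≢0 (lin₃ 1# (- 1#) (tilt * (X′ - X) + (Y′ - Y))
        (on⇒evaluate l P-at P-on) (on⇒evaluate l P′-at P′-on) L₁≡0
        (solve 10 (λ L₀ L₁ L₂ s o t X Y X′ Y′ → L₀ :* X :- L₀ :* X′
          := :1 :* ((L₀ :+ L₁ :* t) :* X :+ L₁ :* Y :+ (L₀ :* s :+ L₁ :* o :+ L₂) :- :0)
          :+ :- :1 :* ((L₀ :+ L₁ :* t) :* X′ :+ L₁ :* Y′ :+ (L₀ :* s :+ L₁ :* o :+ L₂) :- :0)
          :+ (t :* (X′ :- X) :+ (Y′ :- Y)) :* (L₁ :- :0))
          refl (L 0F) (L 1F) (L 2F) s origin tilt X Y X′ Y′))
        where L = Line.coords l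

      T∞-abscissa : ∀ {P Q R X Y X′ Y′} → Collinear P Q R → IsT∞ P → At Q X Y → At R X′ Y′ → X ≡ X′
      T∞-abscissa {P} (l , P-on , Q-on , R-on) P-T∞ Q-at R-at =
        vertical-abscissa l (on-T∞ {l} (on-∼ {P} {T∞} {l} P-T∞ P-on)) Q-at R-at Q-on R-on

      -- With a non-zero determinant, Cramer's rule applied to the three incidences would annihilate
      -- every coefficient of the line.
      collinear⇒det : ∀ {P P₁ P₂ k X₁ Y₁ X₂ Y₂} → At P 0# k → At P₁ X₁ Y₁ → At P₂ X₂ Y₂ →
                      Collinear P P₁ P₂ → X₁ * (Y₂ - k) ≡ X₂ * (Y₁ - k)
      collinear⇒det {k = k} {X₁} {Y₁} {X₂} {Y₂} at at₁ at₂ (l , on , on₁ , on₂)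
        with X₁ * (Y₂ - k) ≟ X₂ * (Y₁ - k)
      ... | yes eq = eq
      ... | no ≢ = ⊥-elim (vanishing-line l L₁≡0 L₀≡0 ev)
        where
        L = Line.coords l
        det≢0 = x≢y⇒x-y≢0 ≢
        ev = on⇒evaluate l at on
        ev₁ = on⇒evaluate l at₁ on₁
        ev₂ = on⇒evaluate l at₂ on₂
        λ₀ = L 0F + L 1F * tilt
        μ = L 0F * s + L 1F * origin + L 2F
        L₁≡0 : L 1F ≡ 0#
        L₁≡0 = x*y≡0⇒y≡0 det≢0 (lin₃ X₁ (- X₂) (X₂ - X₁) ev₂ ev₁ ev
          (solve 8 (λ λ₀ L₁ μ k X₁ Y₁ X₂ Y₂ → (X₁ :* (Y₂ :- k) :- X₂ :* (Y₁ :- k)) :* L₁ :- :0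
            := X₁ :* (λ₀ :* X₂ :+ L₁ :* Y₂ :+ μ :- :0) :+ :- X₂ :* (λ₀ :* X₁ :+ L₁ :* Y₁ :+ μ :- :0)
               :+ (X₂ :- X₁) :* (λ₀ :* :0 :+ L₁ :* k :+ μ :- :0)) refl λ₀ (L 1F) μ k X₁ Y₁ X₂ Y₂))
        λ₀≡0 : λ₀ ≡ 0#
        λ₀≡0 = x*y≡0⇒y≡0 det≢0 (lin₃ (k - Y₁) (Y₂ - k) (Y₁ - Y₂) ev₂ ev₁ ev
          (solve 8 (λ λ₀ L₁ μ k X₁ Y₁ X₂ Y₂ → (X₁ :* (Y₂ :- k) :- X₂ :* (Y₁ :- k)) :* λ₀ :- :0
            := (k :- Y₁) :* (λ₀ :* X₂ :+ L₁ :* Y₂ :+ μ :- :0) :+ (Y₂ :- k) :* (λ₀ :* X₁ :+ L₁ :* Y₁ :+ μ :- :0)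
               :+ (Y₁ :- Y₂) :* (λ₀ :* :0 :+ L₁ :* k :+ μ :- :0)) refl λ₀ (L 1F) μ k X₁ Y₁ X₂ Y₂))
        L₀≡0 : L 0F ≡ 0#
        L₀≡0 = lin₂ 1# (- tilt) λ₀≡0 L₁≡0 (solve 3 (λ x y t → x :- :0 := :1 :* (x :+ y :* t :- :0) :+ :- t :* (y :- :0))
          refl (L 0F) (L 1F) tilt)

    open Frame using (At; scaled; At-≡; At-unique; classify; vertical-collinear; T∞-collinear; T∞-abscissa; collinear⇒det)

    centred : ∀ P → P ∈ 𝒰 a b → (∃₂ λ s k → At s P 0# k × OnU 0# k) ⊎ IsT∞ P
    centred P P∈U = map₁ centre (∈𝒰-affine P P∈U)
      where
      centre : (∃₂ λ x y → coords P ∼ (x ∷ y ∷ 1# ∷ []) × OnU x y) → ∃₂ λ s k → At s P 0# k × OnU 0# k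
      centre (x , y , P∼ , on) = let Y , P-at , Y-on = Frame.recentre x P P∼ on in
        x , Y , At-≡ x (-‿inverseʳ x) refl P-at , subst (λ X → OnU X Y) (-‿inverseʳ x) Y-on

    -- Quadrangles with labelled vertices

    record Quadrangle (A B C D : Point) : Set c where
      field
        A∈U : A ∈ 𝒰 a b
        B∈U : B ∈ 𝒰 a b
        C∈U : C ∈ 𝒰 a b
        D∈U : D ∈ 𝒰 a b
        ¬ABC : ¬ Collinear A B C
        ¬ABD : ¬ Collinear A B D
        ¬ACD : ¬ Collinear A C D
        ¬BCD : ¬ Collinear B C D
        AB∧CD : MeetInUnital (𝒰 a b) A B C D
        AC∧BD : MeetInUnital (𝒰 a b) A C B D
        AD∧BC : MeetInUnital (𝒰 a b) A D B C

    meet-swap : ∀ {U A B C D} → MeetInUnital U A B C D → MeetInUnital U C D A B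
    meet-swap (X , X∈U , ABX , CDX) = X , X∈U , CDX , ABX

    meet-flip : ∀ {U A B C D} → MeetInUnital U A B C D → MeetInUnital U B A C D
    meet-flip {A = A} {B} (X , X∈U , ABX , CDX) = X , X∈U , collinear-swap₁₂ {A} {B} {X} ABX , CDX

    quadrangle-swap : ∀ {A B C D} → Quadrangle A B C D → Quadrangle B A C D
    quadrangle-swap {A} {B} {C} {D} Q = record
      { A∈U = B∈U ; B∈U = A∈U ; C∈U = C∈U ; D∈U = D∈U
      ; ¬ABC = ¬ABC ∘ collinear-swap₁₂ {B} {A} {C} ; ¬ABD = ¬ABD ∘ collinear-swap₁₂ {B} {A} {D} ; ¬ACD = ¬BCD ; ¬BCD = ¬ACD
      ; AB∧CD = meet-flip {𝒰 a b} {A} {B} {C} {D} AB∧CD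
      ; AC∧BD = meet-swap {𝒰 a b} {A} {D} {B} {C} AD∧BC ; AD∧BC = meet-swap {𝒰 a b} {A} {C} {B} {D} AC∧BD }
      where open Quadrangle Q

    -- For a = 0 the unital is a Hermitian curve

    module _ (bm : IsOrthogonalBM a b) (a≡0 : a ≡ 0#) where
      private
        Q≡ : ∀ x → Q x ≡ γ * (x * conj x)
        Q≡ x = begin
          Q x                                                           ≡⟨ Q-expand x ⟩
          a * (x * x) - conj a * (conj x * conj x) + γ * (x * conj x)   ≡⟨ cong (λ a → a * (x * x) - conj a * (conj x * conj x) + γ * (x * conj x)) a≡0 ⟩
          0# * (x * x) - conj 0# * (conj x * conj x) + γ * (x * conj x) ≡⟨ cong (λ z → 0# * (x * x) - z * (conj x * conj x) + γ * (x * conj x)) conj-0 ⟩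
          0# * (x * x) - 0# * (conj x * conj x) + γ * (x * conj x)      ≡⟨ solve 3 (λ γ x x̄ → :0 :* (x :* x) :- :0 :* (x̄ :* x̄) :+ γ :* (x :* x̄) := γ :* (x :* x̄)) refl γ x (conj x) ⟩
          γ * (x * conj x)                                              ∎

        γ≢0 : γ ≢ 0#
        γ≢0 γ≡0 = anisotropic bm 1≢0 (trans (Q≡ 1#) (trans (cong (_* (1# * conj 1#)) γ≡0) (zeroˡ _)))

        -- y z̄ - ȳ z = γ x x̄, made Hermitian by the factor γ = - γ̄.
        form : Fin 3 → Fin 3 → Carrier
        form = (- (γ * γ) ∷ 0# ∷ 0# ∷ []) ∷ (0# ∷ 0# ∷ - γ ∷ []) ∷ (0# ∷ γ ∷ 0# ∷ []) ∷ []

        evaluate-form : V → Carrier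
        evaluate-form v = sum (λ i → sum (λ j → v i ^ q * form i j * v j))

        hermitian : ∀ i j → form j i ≡ form i j ^ q
        hermitian 0F 0F = sym (trans (conj-neg (γ * γ)) (cong -_ (trans (conj-γ ⊗ conj-γ) (solve 1 (λ γ → :- γ :* :- γ := γ :* γ) refl γ))))
        hermitian 0F 1F = sym conj-0
        hermitian 0F 2F = sym conj-0
        hermitian 1F 0F = sym conj-0
        hermitian 1F 1F = sym conj-0
        hermitian 1F 2F = sym (trans (conj-neg γ) (trans (cong -_ conj-γ) (-‿involutive γ)))
        hermitian 2F 0F = sym conj-0
        hermitian 2F 1F = sym conj-γ
        hermitian 2F 2F = sym conj-0

        nondegenerate : ∀ v → NonZeroVec v → ∃[ i ] sum (λ j → form i j * v j) ≢ 0#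
        nondegenerate v (0F , v₀≢0) = 0F , λ eq → *-≢0 (*-≢0 γ≢0 γ≢0) v₀≢0 (trans
          (solve 4 (λ γ x y z → γ :* γ :* x := :- (:- (γ :* γ) :* x :+ (:0 :* y :+ (:0 :* z :+ :0)))) refl γ (v 0F) (v 1F) (v 2F))
          (trans (cong -_ eq) (solve 0 (:- :0 := :0) refl)))
        nondegenerate v (1F , v₁≢0) = 2F , λ eq → *-≢0 γ≢0 v₁≢0 (trans
          (solve 4 (λ γ x y z → γ :* y := :0 :* x :+ (γ :* y :+ (:0 :* z :+ :0))) refl γ (v 0F) (v 1F) (v 2F)) eq)
        nondegenerate v (2F , v₂≢0) = 1F , λ eq → *-≢0 γ≢0 v₂≢0 (trans
          (solve 4 (λ γ x y z → γ :* z := :- (:0 :* x :+ (:0 :* y :+ (:- γ :* z :+ :0)))) refl γ (v 0F) (v 1F) (v 2F))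
          (trans (cong -_ eq) (solve 0 (:- :0 := :0) refl)))

        form-expand : ∀ v → evaluate-form v ≡ γ * (v 1F * conj (v 2F) - conj (v 1F) * v 2F - γ * (v 0F * conj (v 0F)))
        form-expand v = solve 7 (λ γ x x̄ y ȳ z z̄ →
          x̄ :* :- (γ :* γ) :* x :+ (x̄ :* :0 :* y :+ (x̄ :* :0 :* z :+ :0)) :+
          (ȳ :* :0 :* x :+ (ȳ :* :0 :* y :+ (ȳ :* :- γ :* z :+ :0)) :+
          (z̄ :* :0 :* x :+ (z̄ :* γ :* y :+ (z̄ :* :0 :* z :+ :0)) :+ :0))
          := γ :* (y :* z̄ :- ȳ :* z :- γ :* (x :* x̄))) refl γ (v 0F) (conj (v 0F)) (v 1F) (conj (v 1F)) (v 2F) (conj (v 2F))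

        equation : V → Set c
        equation v = ⟦ v 1F , v 2F ⟧ ≡ γ * (v 0F * conj (v 0F))

        equation-∼ : ∀ {v w} → v ∼ w → equation w → equation v
        equation-∼ {v} {w} (t , _ , eq) on = begin
          v 1F * conj (v 2F) - conj (v 1F) * v 2F    ≡⟨ cong₂ (λ y z → y * conj z - conj y * z) (eq 1F) (eq 2F) ⟩
          ⟦ t * w 1F , t * w 2F ⟧                    ≡⟨ scale-⟦,⟧ t (w 1F) (w 2F) ⟩
          t * conj t * ⟦ w 1F , w 2F ⟧               ≡⟨ cong (t * conj t *_) on ⟩
          t * conj t * (γ * (w 0F * conj (w 0F)))    ≡⟨ solve 5 (λ t t̄ γ x x̄ → t :* t̄ :* (γ :* (x :* x̄)) := γ :* (t :* x :* (t̄ :* x̄))) refl t (conj t) γ (w 0F) (conj (w 0F)) ⟩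
          γ * (t * w 0F * (conj t * conj (w 0F)))    ≡⟨ cong (λ z → γ * (t * w 0F * z)) (conj-* t (w 0F)) ⟨
          γ * (t * w 0F * conj (t * w 0F))           ≡⟨ cong (λ x → γ * (x * conj x)) (eq 0F) ⟨
          γ * (v 0F * conj (v 0F))                   ∎

        affine-equation : ∀ y → ⟦ y , 1# ⟧ ≡ im y
        affine-equation y = trans (cong (λ z → y * z - conj y * 1#) conj-1)
          (solve 2 (λ y ȳ → y :* :1 :- ȳ :* :1 := y :- ȳ) refl y (conj y))

        ∈𝒰⇒equation : ∀ P → P ∈ 𝒰 a b → equation (coords P)
        ∈𝒰⇒equation P P∈U with ∈𝒰-affine P P∈U
        ... | inj₁ (x , y , P∼ , on) = equation-∼ P∼ (trans (affine-equation y) (trans on (Q≡ x)))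
        ... | inj₂ P∼ = equation-∼ P∼ (begin
          1# * conj 0# - conj 1# * 0#   ≡⟨ cong (λ z → 1# * z - conj 1# * 0#) conj-0 ⟩
          1# * 0# - conj 1# * 0#        ≡⟨ solve 3 (λ z γ w → :1 :* :0 :- z :* :0 := γ :* (:0 :* w)) refl (conj 1#) γ (conj 0#) ⟩
          γ * (0# * conj 0#)            ∎)

        equation⇒∈𝒰 : ∀ P → equation (coords P) → P ∈ 𝒰 a b
        equation⇒∈𝒰 P@(point v (i , vᵢ≢0)) on with v 2F ≟ 0#
        ... | no z≢0 = affine∈𝒰 P P∼ (trans (sym (affine-equation y)) (trans (equation-∼ (∼-sym P∼) on) (sym (Q≡ x))))
          where
          x = v 0F * v 2F ⁻¹
          y = v 1F * v 2F ⁻¹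
          divide : ∀ w → w ≡ v 2F * (w * v 2F ⁻¹)
          divide w = lin₁ (- w) (x*x⁻¹≡1 z≢0) (solve 3 (λ w z z′ → w :- z :* (w :* z′) := :- w :* (z :* z′ :- :1)) refl w (v 2F) (v 2F ⁻¹))
          P∼ : v ∼ (x ∷ y ∷ 1# ∷ [])
          P∼ = v 2F , z≢0 , λ where
            0F → divide (v 0F)
            1F → divide (v 1F)
            2F → sym (*-identityʳ (v 2F))
        -- At infinity the equation reduces to γ x x̄ = 0, so `T∞` is the only solution there.
        ... | yes z≡0 = inj₂ (v 1F , y≢0 , λ where
            0F → trans x≡0 (sym (zeroʳ (v 1F)))
            1F → sym (*-identityʳ (v 1F))
            2F → trans z≡0 (sym (zeroʳ (v 1F))))
          where
          xx̄≡0 : γ * (v 0F * conj (v 0F)) ≡ 0#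
          xx̄≡0 = trans (sym on) (trans (cong (λ z → v 1F * conj z - conj (v 1F) * z) z≡0)
            (trans (cong (λ z → v 1F * z - conj (v 1F) * 0#) conj-0) (solve 2 (λ y ȳ → y :* :0 :- ȳ :* :0 := :0) refl (v 1F) (conj (v 1F)))))
          x≡0 : v 0F ≡ 0#
          x≡0 with v 0F ≟ 0#
          ... | yes eq = eq
          ... | no x≢0 = contradiction xx̄≡0 (*-≢0 γ≢0 (*-≢0 x≢0 (conj-≢0 x≢0)))
          y≢0 : v 1F ≢ 0#
          y≢0 y≡0 = vᵢ≢0 (zeros i)
            where
            zeros : ∀ i → v i ≡ 0#
            zeros 0F = x≡0
            zeros 1F = y≡0
            zeros 2F = z≡0

      classical : Classical (𝒰 a b)
      classical = form , hermitian , nondegenerate , λ P → mk⇔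
        (λ P∈U → trans (form-expand (coords P)) (trans (cong (γ *_) (x≡y⇒x-y≡0 (∈𝒰⇒equation P P∈U))) (zeroʳ γ)))
        (λ eq → equation⇒∈𝒰 P (x-y≡0⇒x≡y _ _ (x*y≡0⇒y≡0 γ≢0 (trans (sym (form-expand (coords P))) eq))))

    -- The special point is neither a vertex nor a diagonal point of a special side

    module Orthogonal (bm : IsOrthogonalBM a b) where
      open Frame using (At; scaled; At-≡; At-unique; classify; vertical-collinear; T∞-collinear; T∞-abscissa; collinear⇒det
                       ; vertical; on-vertical; vertical-abscissa)

      T∞-on-vertical : ∀ {P} X → IsT∞ P → P on-line vertical 0# X
      T∞-on-vertical {P} X P-T∞ = on-∼ {T∞} {P} {vertical 0# X} (∼-sym P-T∞) (T∞-on {vertical 0# X} refl)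

      T∞-pair-collinear : ∀ {P P′ R} → IsT∞ P → IsT∞ P′ → R ∈ 𝒰 a b → Collinear P P′ R
      T∞-pair-collinear {P} {P′} {R} P-T∞ P′-T∞ R∈U with classify 0# R R∈U
      ... | inj₁ (X , Y , R-at , _) =
        vertical 0# X , T∞-on-vertical {P} X P-T∞ , T∞-on-vertical {P′} X P′-T∞ , on-vertical 0# R-at refl
      ... | inj₂ R-T∞ =
        vertical 0# 0# , T∞-on-vertical {P} 0# P-T∞ , T∞-on-vertical {P′} 0# P′-T∞ , T∞-on-vertical {R} 0# R-T∞

      T∞-unique : ∀ {P P′} → IsT∞ P → IsT∞ P′ → coords P ∼ coords P′
      T∞-unique P-T∞ P′-T∞ = ∼-trans P-T∞ (∼-sym P′-T∞)

      x≡0⊎y≡z : ∀ {x y z} → x * (y - z) ≡ 0# → x ≡ 0# ⊎ y ≡ z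
      x≡0⊎y≡z {x} {y} {z} eq with x ≟ 0#
      ... | yes x≡0 = inj₁ x≡0
      ... | no  x≢0 = inj₂ (x-y≡0⇒x≡y y z (x*y≡0⇒y≡0 x≢0 eq))

      affine : ∀ s P → P ∈ 𝒰 a b → ¬ IsT∞ P → ∃₂ λ X Y → At s P X Y × OnU X Y
      affine s P P∈U ¬T∞ = fromInj₁ (⊥-elim ∘ ¬T∞) (classify s P P∈U)

      centred-affine : ∀ P → P ∈ 𝒰 a b → ¬ IsT∞ P → ∃₂ λ s k → At s P 0# k × OnU 0# k
      centred-affine P P∈U ¬T∞ = fromInj₁ (⊥-elim ∘ ¬T∞) (centred P P∈U)

      -- If A were `T∞`, the lines ABE, ACF, BDF and CDE would form an O'Nan configuration through
      -- it. Seen from D, `wilbrink` forces B = E, and then B, C and D are collinear.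
      T∞-not-vertex : ∀ {A B C D} → Quadrangle A B C D → ¬ IsT∞ A
      T∞-not-vertex {A} {B} {C} {D} quad A-T∞ =
        let E , E∈U , ABE , l , C-l , D-l , E-l = AB∧CD
            F′ , F∈U , ACF , l′ , B-l′ , D-l′ , F-l′ = AC∧BD
            s , k , D-at , D-on = centred-affine D D∈U λ D-T∞ →
              let m , A-m , D-m , C-m = T∞-pair-collinear {A} {D} {C} A-T∞ D-T∞ C∈U in ¬ACD (m , A-m , C-m , D-m)
            X₁ , Y₁ , B-at , B-on = affine s B B∈U λ B-T∞ → ¬ABC (T∞-pair-collinear {A} {B} {C} A-T∞ B-T∞ C∈U)
            X₂ , Y₂ , C-at , C-on = affine s C C∈U λ C-T∞ → ¬ACD (T∞-pair-collinear {A} {C} {D} A-T∞ C-T∞ D∈U)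
            X₁′ , Y₁′ , E-at′ , E-on′ = affine s E E∈U λ E-T∞ →
              ¬ACD (l , on-∼ {E} {A} {l} (T∞-unique {E} {A} E-T∞ A-T∞) E-l , C-l , D-l)
            X₂′ , Y₂′ , F-at′ , F-on′ = affine s F′ F∈U λ F-T∞ →
              ¬ABD (l′ , on-∼ {F′} {A} {l′} (T∞-unique {F′} {A} F-T∞ A-T∞) F-l′ , B-l′ , D-l′)
            X₁′≡X₁ = sym (T∞-abscissa s {A} ABE A-T∞ B-at E-at′)
            X₂′≡X₂ = sym (T∞-abscissa s {A} ACF A-T∞ C-at F-at′)
            E-at = At-≡ s X₁′≡X₁ refl E-at′
            F-at = At-≡ s X₂′≡X₂ refl F-at′
            Y₁≡Y₁′ = wilbrink bm D-on
              B-on (subst (λ X → OnU X Y₁′) X₁′≡X₁ E-on′) (subst (λ X → OnU X Y₂′) X₂′≡X₂ F-on′) C-on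
              (collinear⇒det s D-at B-at F-at (l′ , D-l′ , B-l′ , F-l′))
              (collinear⇒det s D-at E-at C-at (l , D-l , E-l , C-l))
              (λ X₁≡0 → ¬ABD (T∞-collinear s {A} A-T∞ (At-≡ s X₁≡0 refl B-at) D-at))
              (λ X₂≡0 → ¬ACD (T∞-collinear s {A} A-T∞ (At-≡ s X₂≡0 refl C-at) D-at))
              (λ X₁≡X₂ → ¬ABC (T∞-collinear s {A} A-T∞ (At-≡ s X₁≡X₂ refl B-at) C-at))
        in ¬BCD (l , on-∼ {E} {B} {l} (At-unique s E-at (At-≡ s refl Y₁≡Y₁′ B-at)) E-l , C-l , D-l)
        where open Quadrangle quad

      -- If E were `T∞`, the lines AB and CD through it and the lines AC and BD through F would form
      -- an O'Nan configuration. Seen from F, `wilbrink` forces A = B.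
      T∞-not-diagonal : ∀ {A B C D E} → Quadrangle A B C D → Collinear A B E → Collinear C D E → ¬ IsT∞ E
      T∞-not-diagonal {A} {B} {C} {D} {E} quad (l , A-l , B-l , E-l) (l′ , C-l′ , D-l′ , E-l′) E-T∞ =
        let F′ , F∈U , (m , A-m , C-m , F-m) , (m′ , B-m′ , D-m′ , F-m′) = AC∧BD
            ¬A-T∞ = T∞-not-vertex quad
            ¬B-T∞ = T∞-not-vertex (quadrangle-swap quad)
            ¬C-T∞ = λ C-T∞ → ¬ABC (l , A-l , B-l , on-∼ {E} {C} {l} (T∞-unique {E} {C} E-T∞ C-T∞) E-l)
            ¬D-T∞ = λ D-T∞ → ¬ABD (l , A-l , B-l , on-∼ {E} {D} {l} (T∞-unique {E} {D} E-T∞ D-T∞) E-l)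
            s , k , F-at , F-on = centred-affine F′ F∈U λ F-T∞ →
              let X , _ , A-at , _ = affine 0# A A∈U ¬A-T∞
                  _ , _ , B-at , _ = affine 0# B B∈U ¬B-T∞
                  _ , _ , C-at , _ = affine 0# C C∈U ¬C-T∞
                  X≡Xᴮ = T∞-abscissa 0# {E} (l , E-l , A-l , B-l) E-T∞ A-at B-at
                  X≡Xᶜ = T∞-abscissa 0# {F′} (m , F-m , A-m , C-m) F-T∞ A-at C-at
              in ¬ABC (vertical-collinear 0# A-at (At-≡ 0# (sym X≡Xᴮ) refl B-at) (At-≡ 0# (sym X≡Xᶜ) refl C-at))
            X₁ , Y₁ , A-at , A-on = affine s A A∈U ¬A-T∞
            X₁′ , Y₁′ , B-at′ , B-on′ = affine s B B∈U ¬B-T∞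
            X₂ , Y₂ , C-at , C-on = affine s C C∈U ¬C-T∞
            X₂′ , Y₂′ , D-at′ , D-on′ = affine s D D∈U ¬D-T∞
            X₁′≡X₁ = sym (T∞-abscissa s {E} (l , E-l , A-l , B-l) E-T∞ A-at B-at′)
            X₂′≡X₂ = sym (T∞-abscissa s {E} (l′ , E-l′ , C-l′ , D-l′) E-T∞ C-at D-at′)
            B-at = At-≡ s X₁′≡X₁ refl B-at′
            D-at = At-≡ s X₂′≡X₂ refl D-at′
            col = collinear⇒det s F-at A-at C-at (m , F-m , A-m , C-m)
            X₁≢X₂ = λ X₁≡X₂ → ¬ABC (vertical-collinear s (At-≡ s X₁≡X₂ refl A-at) (At-≡ s X₁≡X₂ refl B-at) C-at)
            X₁≢0 = λ X₁≡0 →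
              [ (λ X₂≡0 → X₁≢X₂ (trans X₁≡0 (sym X₂≡0)))
              , (λ Y₁≡k → ¬ABD (m′ , on-∼ {F′} {A} {m′} (At-unique s F-at (At-≡ s X₁≡0 Y₁≡k A-at)) F-m′ , B-m′ , D-m′))
              ]′ (x≡0⊎y≡z (trans (sym col) (trans (cong (_* (Y₂ - k)) X₁≡0) (zeroˡ _))))
            X₂≢0 = λ X₂≡0 →
              [ X₁≢0
              , (λ Y₂≡k → ¬BCD (m′ , B-m′ , on-∼ {F′} {C} {m′} (At-unique s F-at (At-≡ s X₂≡0 Y₂≡k C-at)) F-m′ , D-m′))
              ]′ (x≡0⊎y≡z (trans col (trans (cong (_* (Y₁ - k)) X₂≡0) (zeroˡ _))))
            Y₁≡Y₁′ = wilbrink bm F-on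
              A-on (subst (λ X → OnU X Y₁′) X₁′≡X₁ B-on′) C-on (subst (λ X → OnU X Y₂′) X₂′≡X₂ D-on′) col
              (collinear⇒det s F-at B-at D-at (m′ , F-m′ , B-m′ , D-m′)) X₁≢0 X₂≢0 X₁≢X₂
        in ¬ABC (m , A-m , on-∼ {A} {B} {m} (At-unique s (At-≡ s refl Y₁≡Y₁′ A-at) B-at) A-m , C-m)
        where open Quadrangle quad

      -- From a quadrangle with a special side to its parameter

      -- The side from (0 , k + α) to the point of abscissa u⁻¹ on Y = m X + k has slope m - α u,
      -- and the opposite side likewise has slope m - β v. Equating their ordinates at the common
      -- point of abscissa w⁻¹ gives (β - α) w = β v - α u, as `Diagonal` requires.
      diagonal-equation : ∀ {k α β u v m X Y} → k ∈ 𝔽q → α ∈ 𝔽q → β ∈ 𝔽q → α ≢ β → u ≢ 0# → v ≢ 0# → X ≢ 0# →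
        ⟦ m , u ⟧ ≡ hᵇ u → ⟦ m , v ⟧ ≡ hᵇ v → OnU X Y →
        u ⁻¹ * (Y - (k + α)) ≡ X * (m * u ⁻¹ + k - (k + α)) →
        v ⁻¹ * (Y - (k + β)) ≡ X * (m * v ⁻¹ + k - (k + β)) →
        DiagonalEquation a α β u v
      diagonal-equation {k} {α} {β} {u} {v} {m} {X} {Y} k∈ α∈ β∈ α≢β u≢0 v≢0 X≢0 mu mv on colᵘ colᵛ =
        Diagonal.diagonal⇒equation α∈ β∈ α≢β mu mv w-def
          (OnU⇒slope (x⁻¹*x≡1 X≢0) (k∈ ⊕ α∈) (subst (OnU X) (Y≡ u≢0 colᵘ) on))
        where
        w = X ⁻¹
        Y≡ : ∀ {u α} → u ≢ 0# → u ⁻¹ * (Y - (k + α)) ≡ X * (m * u ⁻¹ + k - (k + α)) → Y ≡ (m - α * u) * X + (k + α)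
        Y≡ {u} {α} u≢0 col = lin₂ u (m * X - Y + (k + α)) col (x*x⁻¹≡1 u≢0)
          (solve 7 (λ k α u u′ m X Y → Y :- ((m :- α :* u) :* X :+ (k :+ α))
            := u :* (u′ :* (Y :- (k :+ α)) :- X :* (m :* u′ :+ k :- (k :+ α))) :+ (m :* X :- Y :+ (k :+ α)) :* (u :* u′ :- :1))
            refl k α u (u ⁻¹) m X Y)
        w-def : (β - α) * w ≡ β * v - α * u
        w-def = lin₃ w (- w) (β * v - α * u) (Y≡ u≢0 colᵘ) (Y≡ v≢0 colᵛ) (x⁻¹*x≡1 X≢0)
          (solve 9 (λ k α β u v m X Y w → (β :- α) :* w :- (β :* v :- α :* u)
            := w :* (Y :- ((m :- α :* u) :* X :+ (k :+ α))) :+ :- w :* (Y :- ((m :- β :* v) :* X :+ (k :+ β)))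
               :+ (β :* v :- α :* u) :* (w :* X :- :1)) refl k α β u v m X Y w)

      record HasParameter (d : Parameter) (A B C D : Point) : Set c where
        constructor hasParameter
        private
          s = proj₁ d
          k = proj₁ (proj₂ d)
          α = proj₁ (proj₂ (proj₂ d))
          β = proj₁ (proj₂ (proj₂ (proj₂ d)))
          u = proj₁ (proj₂ (proj₂ (proj₂ (proj₂ d))))
          v = proj₂ (proj₂ (proj₂ (proj₂ (proj₂ d))))
        field
          A-at : At s A 0# (k + α)
          B-at : At s B 0# (k + β)
          C-at : At s C (u ⁻¹) (slope u v * u ⁻¹ + k)
          D-at : At s D (v ⁻¹) (slope u v * v ⁻¹ + k)

      -- Inverting both arguments changes the sign of the bracket and divides it by the norms of X
      -- and X′.
      ⁻¹-independent : ∀ {X X′} → X ≢ 0# → X′ ≢ 0# → ⟦ X , X′ ⟧ ≢ 0# → ⟦ X ⁻¹ , X′ ⁻¹ ⟧ ≢ 0#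
      ⁻¹-independent {X} {X′} X≢0 X′≢0 ind dep = ind (begin
        X * X̄′ - X̄ * X′
          ≡⟨ solve 4 (λ x x̅ y y̅ → x :* y̅ :- x̅ :* y := (:1 :* x) :* (:1 :* y̅) :- (:1 :* x̅) :* (:1 :* y)) refl X X̄ X′ X̄′ ⟩
        1# * X * (1# * X̄′) - 1# * X̄ * (1# * X′)
          ≡⟨ cong₂ _-_ (cong₂ (λ y z → y * X * (z * X̄′)) (×≡1⇒conj×≡1 XU≡1) XU′≡1) (cong₂ (λ y z → y * X̄ * (z * X′)) XU≡1 (×≡1⇒conj×≡1 XU′≡1)) ⟨
        X̄ * Ū * X * (X′ * U′ * X̄′) - X * U * X̄ * (X̄′ * Ū′ * X′)
          ≡⟨ lin₁ (- (X * X̄ * X′ * X̄′)) dep (solve 8 (λ X X̄ X′ X̄′ U Ū U′ Ū′ →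
               X̄ :* Ū :* X :* (X′ :* U′ :* X̄′) :- X :* U :* X̄ :* (X̄′ :* Ū′ :* X′) :- :0
               := :- (X :* X̄ :* X′ :* X̄′) :* (U :* Ū′ :- Ū :* U′ :- :0)) refl X X̄ X′ X̄′ U Ū U′ Ū′) ⟩
        0# ∎)
        where
        X̄ = conj X
        X̄′ = conj X′
        U = X ⁻¹
        Ū = conj U
        U′ = X′ ⁻¹
        Ū′ = conj U′
        XU≡1 = x*x⁻¹≡1 X≢0
        XU′≡1 = x*x⁻¹≡1 X′≢0

      minus-cancel : ∀ {x y k} → x - k ≡ y - k → x ≡ y
      minus-cancel {x} {y} {k} eq = lin₁ 1# eq (solve 3 (λ x y k → x :- y := :1 :* (x :- k :- (y :- k))) refl x y k)

      through-centre : ∀ k Y {X} → X ≢ 0# → Y ≡ (Y - k) * X ⁻¹ * X + k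
      through-centre k Y {X} X≢0 = lin₁ (k - Y) (x⁻¹*x≡1 X≢0)
        (solve 4 (λ k Y X U → Y :- ((Y :- k) :* U :* X :+ k) := (k :- Y) :* (U :* X :- :1)) refl k Y X (X ⁻¹))

      on-CD : ∀ k Y Y′ {X X′} → X ≢ 0# → X * (Y′ - k) ≡ X′ * (Y - k) → Y′ ≡ (Y - k) * X ⁻¹ * X′ + k
      on-CD k Y Y′ {X} {X′} X≢0 col = lin₂ (X ⁻¹) (k - Y′) col (x⁻¹*x≡1 X≢0)
        (solve 6 (λ k Y Y′ X X′ U → Y′ :- ((Y :- k) :* U :* X′ :+ k)
          := U :* (X :* (Y′ :- k) :- X′ :* (Y :- k)) :+ (k :- Y′) :* (U :* X :- :1)) refl k Y Y′ X X′ (X ⁻¹))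

      meets-axis : ∀ {X Y X′ κ Z} → X ≢ 0# → X′ ≡ 0# → X * (Y - κ) ≡ X′ * Z → Y ≡ κ
      meets-axis X≢0 refl eq = x-y≡0⇒x≡y _ _ (x*y≡0⇒y≡0 X≢0 (trans eq (zeroˡ _)))

      record Placed (s : Carrier) (P : Point) : Set c where
        constructor placed
        field
          {abscissa ordinate} : Carrier
          at : At s P abscissa ordinate
          on : OnU abscissa ordinate

      open Placed

      place : ∀ s P → P ∈ 𝒰 a b → ¬ IsT∞ P → Placed s P
      place s P P∈U ¬T∞ = let _ , _ , P-at , P-on = affine s P P∈U ¬T∞ in placed P-at P-on

      replace : ∀ {s P X} (p : Placed s P) → abscissa p ≡ X → Σ (At s P X (ordinate p)) λ _ → OnU X (ordinate p)
      replace (placed P-at P-on) refl = P-at , P-on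

      collinear-swap₂₃ : ∀ {P Q R} → Collinear P Q R → Collinear P R Q
      collinear-swap₂₃ (l , P-on , Q-on , R-on) = l , P-on , R-on , Q-on

      -- The axis of the frame is the special side. As `T∞` is neither a vertex nor the diagonal
      -- point E, the points A, B and E are affine points of the axis, while C and D lie off it and
      -- have reciprocal abscissas.
      normal-form : ∀ {A B C D} → Quadrangle A B C D → ∀ l → A on-line l → B on-line l → T∞ on-line l →
                    ∃ λ d → Valid a d × HasParameter d A B C D
      normal-form {A} {B} {C} {D} quad l A-l B-l T∞-l =
        (s , k , α , β , u , v)
        , valid k∈𝔽q α∈𝔽q β∈𝔽q α≢0 β≢0 α≢β uv≢0
            (diagonal-equation k∈𝔽q α∈𝔽q β∈𝔽q α≢β u≢0 v≢0 Xᶠ≢0 mu mv (on F-placed) AC-col BD-col)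
            (diagonal-equation k∈𝔽q α∈𝔽q β∈𝔽q α≢β v≢0 u≢0 Xᴳ≢0 mv mu (on G-placed) AD-col BC-col)
        , hasParameter A-at B-at C-at D-at
        where
        open Quadrangle quad
        E = proj₁ AB∧CD
        ABE = proj₁ (proj₂ (proj₂ AB∧CD))
        CDE = proj₂ (proj₂ (proj₂ AB∧CD))
        Fᵈ = proj₁ AC∧BD
        ACF = proj₁ (proj₂ (proj₂ AC∧BD))
        BDF = proj₂ (proj₂ (proj₂ AC∧BD))
        G = proj₁ AD∧BC
        ADG = proj₁ (proj₂ (proj₂ AD∧BC))
        BCG = proj₂ (proj₂ (proj₂ AD∧BC))

        A-centred = centred-affine A A∈U (T∞-not-vertex quad)
        s = proj₁ A-centred
        kᴬ = proj₁ (proj₂ A-centred)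
        A-at₀ = proj₁ (proj₂ (proj₂ A-centred))

        B-placed = place s B B∈U (T∞-not-vertex (quadrangle-swap quad))
        kᴮ = ordinate B-placed
        B-replaced = replace B-placed (vertical-abscissa s l (on-T∞ {l} T∞-l) (at B-placed) A-at₀ B-l A-l)
        B-at₀ = proj₁ B-replaced

        C-placed = place s C C∈U λ C-T∞ → ¬ABC (l , A-l , B-l , on-∼ {T∞} {C} {l} (∼-sym C-T∞) T∞-l)
        D-placed = place s D D∈U λ D-T∞ → ¬ABD (l , A-l , B-l , on-∼ {T∞} {D} {l} (∼-sym D-T∞) T∞-l)
        E-placed = place s E (proj₁ (proj₂ AB∧CD)) (T∞-not-diagonal {E = E} quad ABE CDE)
        Xᶜ = abscissa C-placed
        Yᶜ = ordinate C-placed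
        Xᴰ = abscissa D-placed
        k = ordinate E-placed

        kᴬ≢kᴮ : kᴬ ≢ kᴮ
        kᴬ≢kᴮ eq = ¬ABC (collinear-swap₂₃ {A} {C} {B} (collinear-rotate {B} {A} {C} (replace-B ACF)))
          where
          replace-B : Collinear A C Fᵈ → Collinear B A C
          replace-B (f , A-f , C-f , _) = f , on-∼ {A} {B} {f} (At-unique s (At-≡ s refl eq A-at₀) B-at₀) A-f , A-f , C-f

        -- E is collinear with A and B, which have abscissa 0 and distinct ordinates.
        E-replaced = replace {X = 0#} E-placed $
          [ (λ Xᴱ≡0 → Xᴱ≡0) , (λ kᴮ≡kᴬ → contradiction (sym kᴮ≡kᴬ) kᴬ≢kᴮ) ]′
            (x≡0⊎y≡z (trans (collinear⇒det s A-at₀ (at E-placed) B-at₀ (collinear-swap₂₃ {A} {B} {E} ABE)) (zeroˡ _)))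
        E-at = proj₁ E-replaced
        E-on = proj₂ E-replaced
        k∈𝔽q = OnU-0⇒𝔽q E-on

        α = kᴬ - k
        β = kᴮ - k
        k+[x-k]≡x : ∀ x → k + (x - k) ≡ x
        k+[x-k]≡x x = solve 2 (λ k x → k :+ (x :- k) := x) refl k x
        A-at = At-≡ s refl (sym (k+[x-k]≡x kᴬ)) A-at₀
        B-at = At-≡ s refl (sym (k+[x-k]≡x kᴮ)) B-at₀
        α∈𝔽q = 𝔽q-- (OnU-0⇒𝔽q (proj₂ (proj₂ (proj₂ A-centred)))) k∈𝔽q
        β∈𝔽q = 𝔽q-- (OnU-0⇒𝔽q (proj₂ B-replaced)) k∈𝔽q
        α≢0 : α ≢ 0#
        α≢0 = x≢y⇒x-y≢0 λ eq → ¬ACD (collinear-rotate {D} {A} {C} (collinear-rotate {C} {D} {A}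
          (collinear-∼₃ {C} {D} {E} {A} (At-unique s E-at (At-≡ s refl eq A-at₀)) CDE)))
        β≢0 : β ≢ 0#
        β≢0 = x≢y⇒x-y≢0 λ eq → ¬BCD (collinear-rotate {D} {B} {C} (collinear-rotate {C} {D} {B}
          (collinear-∼₃ {C} {D} {E} {B} (At-unique s E-at (At-≡ s refl eq B-at₀)) CDE)))
        α≢β : α ≢ β
        α≢β eq = kᴬ≢kᴮ (trans (sym (k+[x-k]≡x kᴬ)) (trans (cong (k +_) eq) (k+[x-k]≡x kᴮ)))

        Xᶜ≢0 : Xᶜ ≢ 0#
        Xᶜ≢0 eq = ¬ABC (vertical-collinear s A-at₀ B-at₀ (At-≡ s eq refl (at C-placed)))
        Xᴰ≢0 : Xᴰ ≢ 0#
        Xᴰ≢0 eq = ¬ABD (vertical-collinear s A-at₀ B-at₀ (At-≡ s eq refl (at D-placed)))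
        CD-col = collinear⇒det s E-at (at C-placed) (at D-placed) (collinear-rotate {D} {E} {C} (collinear-rotate {C} {D} {E} CDE))

        Xᶜ≢Xᴰ : Xᶜ ≢ Xᴰ
        Xᶜ≢Xᴰ eq = ¬ACD (replace-D ACF)
          where
          Yᴰ≡Yᶜ = minus-cancel (*-cancelˡ Xᶜ≢0 (trans CD-col (cong (_* (Yᶜ - k)) (sym eq))))
          replace-D : Collinear A C Fᵈ → Collinear A C D
          replace-D (f , A-f , C-f , _) = f , A-f , C-f ,
            on-∼ {C} {D} {f} (At-unique s (At-≡ s eq (sym Yᴰ≡Yᶜ) (at C-placed)) (at D-placed)) C-f

        u = Xᶜ ⁻¹
        v = Xᴰ ⁻¹
        u≢0 = ⁻¹-≢0 Xᶜ≢0
        v≢0 = ⁻¹-≢0 Xᴰ≢0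
        uv≢0 = ⁻¹-independent Xᶜ≢0 Xᴰ≢0
          (collinear⇒independent bm E-on (on C-placed) (on D-placed) CD-col Xᶜ≢0 Xᴰ≢0 Xᶜ≢Xᴰ)
        mu = ⟦slope,⟧ˡ u v uv≢0
        mv = ⟦slope,⟧ʳ u v uv≢0

        m = (Yᶜ - k) * u
        Yᶜ≡ = through-centre k Yᶜ Xᶜ≢0
        Yᴰ≡ = on-CD k Yᶜ (ordinate D-placed) Xᶜ≢0 CD-col
        -- C and D lie on the line of slope m through E; their membership in the unital provides the
        -- two equations that determine the slope.
        m≡ : m ≡ slope u v
        m≡ = slope-unique u v uv≢0
          (OnU⇒slope (x⁻¹*x≡1 Xᶜ≢0) k∈𝔽q (subst (OnU Xᶜ) Yᶜ≡ (on C-placed)))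
          (OnU⇒slope (x⁻¹*x≡1 Xᴰ≢0) k∈𝔽q (subst (OnU Xᴰ) Yᴰ≡ (on D-placed)))
        u⁻¹≡ = sym (⁻¹-involutive Xᶜ≢0)
        v⁻¹≡ = sym (⁻¹-involutive Xᴰ≢0)
        C-at = At-≡ s u⁻¹≡ (trans Yᶜ≡ (cong₂ (λ m x → m * x + k) m≡ u⁻¹≡)) (at C-placed)
        D-at = At-≡ s v⁻¹≡ (trans Yᴰ≡ (cong₂ (λ m x → m * x + k) m≡ v⁻¹≡)) (at D-placed)

        F-placed = place s Fᵈ (proj₁ (proj₂ AC∧BD)) λ F-T∞ →
          Xᶜ≢0 (sym (T∞-abscissa s {Fᵈ} (collinear-rotate {C} {Fᵈ} {A} (collinear-rotate {A} {C} {Fᵈ} ACF)) F-T∞ A-at₀ (at C-placed)))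
        G-placed = place s G (proj₁ (proj₂ AD∧BC)) λ G-T∞ →
          Xᴰ≢0 (sym (T∞-abscissa s {G} (collinear-rotate {D} {G} {A} (collinear-rotate {A} {D} {G} ADG)) G-T∞ A-at₀ (at D-placed)))
        AC-col = collinear⇒det s A-at C-at (at F-placed) ACF
        BD-col = collinear⇒det s B-at D-at (at F-placed) BDF
        AD-col = collinear⇒det s A-at D-at (at G-placed) ADG
        BC-col = collinear⇒det s B-at C-at (at G-placed) BCG

        -- On the axis the diagonal point of AC and BD would coincide with A, making A, B and D
        -- collinear.
        Xᶠ≢0 : abscissa F-placed ≢ 0#
        Xᶠ≢0 eq = ¬ABD (collinear-rotate {D} {A} {B} (collinear-rotate {B} {D} {A} (collinear-∼₃ {B} {D} {Fᵈ} {A}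
          (At-unique s (At-≡ s eq (meets-axis (⁻¹-≢0 u≢0) eq AC-col) (at F-placed)) A-at) BDF)))
        Xᴳ≢0 : abscissa G-placed ≢ 0#
        Xᴳ≢0 eq = ¬ABC (collinear-rotate {C} {A} {B} (collinear-rotate {B} {C} {A} (collinear-∼₃ {B} {C} {G} {A}
          (At-unique s (At-≡ s eq (meets-axis (⁻¹-≢0 v≢0) eq AD-col) (at G-placed)) A-at) BCG)))

      -- From a valid parameter to a configuration

      open Frame
      open ONanQuadrangle

      U = 𝒰 a b

      vertices : Parameter → Fin 4 → Point
      vertices (s , k , α , β , u , v) =
        pt s 0# (k + α) ∷ pt s 0# (k + β) ∷ pt s (u ⁻¹) (slope u v * u ⁻¹ + k) ∷ pt s (v ⁻¹) (slope u v * v ⁻¹ + k) ∷ []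

      pt-at : ∀ s X Y → At s (pt s X Y) X Y
      pt-at s X Y = scaled ∼-refl

      module _ {u v} (uv≢0 : ⟦ u , v ⟧ ≢ 0#) where
        independent⇒≢0ˡ : u ≢ 0#
        independent⇒≢0ˡ refl = uv≢0 (trans (cong (λ z → 0# * conj v - z * v) conj-0)
          (solve 2 (λ v v̅ → :0 :* v̅ :- :0 :* v := :0) refl v (conj v)))

        independent⇒≢ : u ≢ v
        independent⇒≢ refl = uv≢0 (solve 2 (λ u u̅ → u :* u̅ :- u̅ :* u := :0) refl u (conj u))

      ⁻¹-injective : ∀ {x y} → x ≢ 0# → y ≢ 0# → x ⁻¹ ≡ y ⁻¹ → x ≡ y
      ⁻¹-injective x≢0 y≢0 eq = trans (sym (⁻¹-involutive x≢0)) (trans (cong _⁻¹ eq) (⁻¹-involutive y≢0))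

      on-axis : ∀ s m κ → pt s 0# κ on-line spoke s m κ
      on-axis s m κ = on-spoke s (pt-at s 0# κ) (solve 2 (λ m κ → m :* :0 :+ κ := κ) refl m κ)

      on-vertex : ∀ s M k τ {ω} → ω ≢ 0# → pt s (ω ⁻¹) (M * ω ⁻¹ + k) on-line spoke s (M - τ * ω) (k + τ)
      on-vertex s M k τ {ω} ω≢0 = on-spoke s (pt-at s _ _) (lin₁ (- τ) (x*x⁻¹≡1 ω≢0)
        (solve 5 (λ M k τ ω ω′ → (M :- τ :* ω) :* ω′ :+ (k :+ τ) :- (M :* ω′ :+ k) := :- τ :* (ω :* ω′ :- :1)) refl M k τ ω (ω ⁻¹)))

      on-centre : ∀ s M k X → pt s X (M * X + k) on-line spoke s M k
      on-centre s M k X = on-spoke s (pt-at s _ _) refl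

      diagonal-point : ∀ s k {α β u v M} → k ∈ 𝔽q → α ∈ 𝔽q → β ∈ 𝔽q → α ≢ β → ⟦ u , v ⟧ ≢ 0# → β ≢ 0# →
        ⟦ M , u ⟧ ≡ hᵇ u → ⟦ M , v ⟧ ≡ hᵇ v → DiagonalEquation a α β u v →
        MeetInUnital U (pt s 0# (k + α)) (pt s (u ⁻¹) (M * u ⁻¹ + k)) (pt s 0# (k + β)) (pt s (v ⁻¹) (M * v ⁻¹ + k))
      diagonal-point s k {α} {β} {u} {v} {M} k∈ α∈ β∈ α≢β uv≢0 β≢0 Mu Mv eq =
        pt s (w ⁻¹) ((M - α * u) * w ⁻¹ + (k + α))
        , At⇒∈𝒰 s (pt-at s _ _) (slope⇒OnU (x*x⁻¹≡1 w≢0) (k∈ ⊕ α∈) (Diagonal.equation⇒diagonal α∈ β∈ α≢β Mu Mv w-def eq))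
        , (spoke s (M - α * u) (k + α) , on-axis s _ _ , on-vertex s M k α u≢0 , on-centre s _ _ _)
        , (spoke s (M - β * v) (k + β) , on-axis s _ _ , on-vertex s M k β v≢0 , on-spoke s (pt-at s _ _) second)
        where
        u≢0 = independent⇒≢0ˡ uv≢0
        v≢0 = independent⇒≢0ˡ (⟦,⟧-swap-≢0 uv≢0)
        δ = β - α
        δ≢0 : δ ≢ 0#
        δ≢0 = x≢y⇒x-y≢0 (α≢β ∘ sym)
        -- The reciprocal abscissa at which the two sides meet. Their slopes differ by the
        -- numerator, which is non-zero because u and v are independent over `𝔽q`.
        w = (β * v - α * u) * δ ⁻¹
        w-def : δ * w ≡ β * v - α * u
        w-def = lin₁ (β * v - α * u) (x*x⁻¹≡1 δ≢0) (solve 3 (λ d d′ W → d :* (W :* d′) :- W := W :* (d :* d′ :- :1)) refl δ (δ ⁻¹) (β * v - α * u))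
        W≢0 : β * v - α * u ≢ 0#
        W≢0 W≡0 = *-≢0 β≢0 uv≢0 (lin₂ u (- conj u) conj-W≡0 W≡0
          (solve 6 (λ α β u u̅ v v̅ → β :* (u :* v̅ :- u̅ :* v) :- :0
            := u :* (β :* v̅ :- α :* u̅ :- :0) :+ :- u̅ :* (β :* v :- α :* u :- :0)) refl α β u (conj u) v (conj v)))
          where
          conj-W≡0 : β * conj v - α * conj u ≡ 0#
          conj-W≡0 = trans (sym ((β∈ ⊗ refl) ⊝ (α∈ ⊗ refl))) (trans (cong conj W≡0) conj-0)
        w≢0 : w ≢ 0#
        w≢0 = *-≢0 W≢0 (⁻¹-≢0 δ≢0)
        second : (M - β * v) * w ⁻¹ + (k + β) ≡ (M - α * u) * w ⁻¹ + (k + α)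
        second = lin₂ (- δ) (w ⁻¹) (x*x⁻¹≡1 w≢0) w-def
          (solve 9 (λ M k α β u v w w′ d → (M :- β :* v) :* w′ :+ (k :+ β) :- ((M :- α :* u) :* w′ :+ (k :+ α))
            := :- (β :- α) :* (w :* w′ :- :1) :+ w′ :* ((β :- α) :* w :- (β :* v :- α :* u))) refl M k α β u v w (w ⁻¹) 0#)

      configuration : ∀ d → Valid a d → ONanQuadrangle U
      configuration d@(s , k , α , β , u , v) (valid k∈ α∈ β∈ α≢0 β≢0 α≢β uv≢0 uv-eq vu-eq) = record
        { vertex = vertices d
        ; vertex∈U = λ where
            0F → At⇒∈𝒰 s (pt-at s 0# (k + α)) (𝔽q⇒OnU-0 (k∈ ⊕ α∈))
            1F → At⇒∈𝒰 s (pt-at s 0# (k + β)) (𝔽q⇒OnU-0 (k∈ ⊕ β∈))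
            2F → At⇒∈𝒰 s (pt-at s (u ⁻¹) (M * u ⁻¹ + k)) (slope⇒OnU (x*x⁻¹≡1 u≢0) k∈ Mu)
            3F → At⇒∈𝒰 s (pt-at s (v ⁻¹) (M * v ⁻¹ + k)) (slope⇒OnU (x*x⁻¹≡1 v≢0) k∈ Mv)
        ; noThreeCollinear = λ i j n i≢j j≢n i≢n (l , i-on , j-on , n-on) →
            three-of-four {P = λ i → vertices d i on-line l}
              (λ A-on B-on C-on → ¬ABX (M * u ⁻¹ + k) u≢0 (l , A-on , B-on , C-on))
              (λ A-on B-on D-on → ¬ABX (M * v ⁻¹ + k) v≢0 (l , A-on , B-on , D-on))
              (λ A-on C-on D-on → ¬XCD α≢0 (l , A-on , C-on , D-on))
              (λ B-on C-on D-on → ¬XCD β≢0 (l , B-on , C-on , D-on))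
              i j n i≢j j≢n i≢n i-on j-on n-on
        ; diagonal₁ = pt s 0# k , At⇒∈𝒰 s (pt-at s 0# k) (𝔽q⇒OnU-0 k∈)
                    , vertical-collinear s (pt-at s 0# (k + α)) (pt-at s 0# (k + β)) (pt-at s 0# k)
                    , (spoke s M k , on-centre s M k (u ⁻¹) , on-centre s M k (v ⁻¹) , on-axis s M k)
        ; diagonal₂ = diagonal-point s k {M = M} k∈ α∈ β∈ α≢β uv≢0 β≢0 Mu Mv uv-eq
        ; diagonal₃ = diagonal-point s k {M = M} k∈ α∈ β∈ α≢β (⟦,⟧-swap-≢0 uv≢0) β≢0 Mv Mu vu-eq
        }
        where
        M = slope u v
        Mu = ⟦slope,⟧ˡ u v uv≢0
        Mv = ⟦slope,⟧ʳ u v uv≢0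
        u≢0 = independent⇒≢0ˡ uv≢0
        v≢0 = independent⇒≢0ˡ (⟦,⟧-swap-≢0 uv≢0)
        ¬ABX : ∀ {ω} Y → ω ≢ 0# → ¬ Collinear (pt s 0# (k + α)) (pt s 0# (k + β)) (pt s (ω ⁻¹) Y)
        ¬ABX {ω} Y ω≢0 col = *-≢0 (⁻¹-≢0 ω≢0) (x≢y⇒x-y≢0 (α≢β ∘ sym)) (trans
          (solve 4 (λ α β k ω → ω :* (β :- α) := ω :* (k :+ β :- (k :+ α))) refl α β k (ω ⁻¹))
          (trans (sym (collinear⇒det s (pt-at s 0# (k + α)) (pt-at s 0# (k + β)) (pt-at s (ω ⁻¹) Y) col)) (zeroˡ (Y - (k + α)))))
        ¬XCD : ∀ {τ} → τ ≢ 0# → ¬ Collinear (pt s 0# (k + τ)) (pt s (u ⁻¹) (M * u ⁻¹ + k)) (pt s (v ⁻¹) (M * v ⁻¹ + k))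
        ¬XCD {τ} τ≢0 col = *-≢0 τ≢0 (x≢y⇒x-y≢0 (independent⇒≢ uv≢0 ∘ sym ∘ ⁻¹-injective v≢0 u≢0)) (trans
          (solve 5 (λ τ k M u v → τ :* (v :- u) := u :* (M :* v :+ k :- (k :+ τ)) :- v :* (M :* u :+ k :- (k :+ τ))) refl τ k M (u ⁻¹) (v ⁻¹))
          (x≡y⇒x-y≡0 (collinear⇒det s (pt-at s 0# (k + τ)) (pt-at s (u ⁻¹) (M * u ⁻¹ + k)) (pt-at s (v ⁻¹) (M * v ⁻¹ + k)) col)))

      special : ∀ d (V : Valid a d) → BMSpecial U (configuration d V)
      special (s , k , α , β , _) _ = vertical s 0# ,
        (0F , 1F , (λ ()) , on-vertical s (pt-at s 0# (k + α)) refl , on-vertical s (pt-at s 0# (k + β)) refl) , T∞-on {vertical s 0#} refl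

      -- Recovering the parameter from the set of sides

      -- The five sides other than the special one, recorded by slope and intercept: four join a
      -- vertex on the axis to a vertex off it, and the last is the central side through (0 , k).
      IsSpoke : Parameter → Carrier → Carrier → Set c
      IsSpoke (s , k , α , β , u , v) m κ =
          (∃₂ λ τ ω → (τ ≡ α ⊎ τ ≡ β) × (ω ≡ u ⊎ ω ≡ v) × κ ≡ k + τ × m ≡ slope u v - τ * ω)
        ⊎ (κ ≡ k × m ≡ slope u v)

      spoke⇒side : ∀ d (V : Valid a d) {m κ} → IsSpoke d m κ → Side (configuration d V) (spoke (proj₁ d) m κ)
      spoke⇒side (s , k , α , β , u , v) V (inj₁ (_ , _ , inj₁ refl , inj₁ refl , refl , refl)) =
        0F , 2F , (λ ()) , on-axis s (slope u v - α * u) (k + α) , on-vertex s (slope u v) k α (independent⇒≢0ˡ (Valid.uv≢0 V))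
      spoke⇒side (s , k , α , β , u , v) V (inj₁ (_ , _ , inj₁ refl , inj₂ refl , refl , refl)) =
        0F , 3F , (λ ()) , on-axis s (slope u v - α * v) (k + α) , on-vertex s (slope u v) k α (independent⇒≢0ˡ (⟦,⟧-swap-≢0 (Valid.uv≢0 V)))
      spoke⇒side (s , k , α , β , u , v) V (inj₁ (_ , _ , inj₂ refl , inj₁ refl , refl , refl)) =
        1F , 2F , (λ ()) , on-axis s (slope u v - β * u) (k + β) , on-vertex s (slope u v) k β (independent⇒≢0ˡ (Valid.uv≢0 V))
      spoke⇒side (s , k , α , β , u , v) V (inj₁ (_ , _ , inj₂ refl , inj₂ refl , refl , refl)) =
        1F , 3F , (λ ()) , on-axis s (slope u v - β * v) (k + β) , on-vertex s (slope u v) k β (independent⇒≢0ˡ (⟦,⟧-swap-≢0 (Valid.uv≢0 V)))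
      spoke⇒side (s , k , α , β , u , v) V (inj₂ (refl , refl)) =
        2F , 3F , (λ ()) , on-centre s (slope u v) k (u ⁻¹) , on-centre s (slope u v) k (v ⁻¹)

      vertex-spoke : ∀ {m κ M k τ ω} → ω ≢ 0# → m * 0# + κ ≡ k + τ → m * ω ⁻¹ + κ ≡ M * ω ⁻¹ + k → κ ≡ k + τ × m ≡ M - τ * ω
      vertex-spoke {m} {κ} {M} {k} {τ} {ω} ω≢0 e₁ e₂ =
        trans (solve 2 (λ m κ → κ := m :* :0 :+ κ) refl m κ) e₁ ,
        lin₃ ω (- ω) (M - m) e₂ e₁ (x*x⁻¹≡1 ω≢0) (solve 7 (λ m κ M k τ ω ω′ → m :- (M :- τ :* ω)
          := ω :* (m :* ω′ :+ κ :- (M :* ω′ :+ k)) :+ :- ω :* (m :* :0 :+ κ :- (k :+ τ)) :+ (M :- m) :* (ω :* ω′ :- :1))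
          refl m κ M k τ ω (ω ⁻¹))

      central-spoke : ∀ {m κ M k X X′} → X ≢ X′ → m * X + κ ≡ M * X + k → m * X′ + κ ≡ M * X′ + k → κ ≡ k × m ≡ M
      central-spoke {m} {κ} {M} {k} {X} {X′} X≢X′ e₁ e₂ = lin₂ 1# (- X) e₁ m≡M
          (solve 5 (λ m κ M k u → κ :- k := :1 :* (m :* u :+ κ :- (M :* u :+ k)) :+ :- u :* (m :- M)) refl m κ M k X)
        , m≡M
        where
        m≡M : m ≡ M
        m≡M = *-cancelˡ (x≢y⇒x-y≢0 X≢X′) (lin₂ 1# (- 1#) e₁ e₂
          (solve 6 (λ m κ M k u v → (u :- v) :* m :- (u :- v) :* M
            := :1 :* (m :* u :+ κ :- (M :* u :+ k)) :+ :- :1 :* (m :* v :+ κ :- (M :* v :+ k))) refl m κ M k X X′))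

      plus-cancel : ∀ {k x y} → k + x ≡ k + y → x ≡ y
      plus-cancel {k} {x} {y} eq = lin₁ 1# eq (solve 3 (λ k x y → x :- y := :1 :* (k :+ x :- (k :+ y))) refl k x y)

      side⇒spoke : ∀ d (V : Valid a d) {m κ} → Side (configuration d V) (spoke (proj₁ d) m κ) → IsSpoke d m κ
      side⇒spoke d@(s , k , α , β , u , v) V {m} {κ} (i , j , i≢j , i-on , j-on) =
        two-of-four {P = λ i → vertices d i on-line spoke s m κ} {R = IsSpoke d m κ}
          (λ A-on B-on → contradiction (plus-cancel (trans (sym (A⇒ A-on)) (B⇒ B-on))) (Valid.α≢β V))
          (λ A-on C-on → inj₁ (α , u , inj₁ refl , inj₁ refl , vertex-spoke u≢0 (A⇒ A-on) (C⇒ C-on)))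
          (λ A-on D-on → inj₁ (α , v , inj₁ refl , inj₂ refl , vertex-spoke v≢0 (A⇒ A-on) (D⇒ D-on)))
          (λ B-on C-on → inj₁ (β , u , inj₂ refl , inj₁ refl , vertex-spoke u≢0 (B⇒ B-on) (C⇒ C-on)))
          (λ B-on D-on → inj₁ (β , v , inj₂ refl , inj₂ refl , vertex-spoke v≢0 (B⇒ B-on) (D⇒ D-on)))
          (λ C-on D-on → inj₂ (central-spoke u⁻¹≢v⁻¹ (C⇒ C-on) (D⇒ D-on)))
          i j i≢j i-on j-on
        where
        u≢0 = independent⇒≢0ˡ (Valid.uv≢0 V)
        v≢0 = independent⇒≢0ˡ (⟦,⟧-swap-≢0 (Valid.uv≢0 V))
        u⁻¹≢v⁻¹ : u ⁻¹ ≢ v ⁻¹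
        u⁻¹≢v⁻¹ = independent⇒≢ (Valid.uv≢0 V) ∘ ⁻¹-injective u≢0 v≢0
        A⇒ : vertices d 0F on-line spoke s m κ → m * 0# + κ ≡ k + α
        A⇒ = spoke-on s (pt-at s 0# (k + α))
        B⇒ : vertices d 1F on-line spoke s m κ → m * 0# + κ ≡ k + β
        B⇒ = spoke-on s (pt-at s 0# (k + β))
        C⇒ : vertices d 2F on-line spoke s m κ → m * u ⁻¹ + κ ≡ slope u v * u ⁻¹ + k
        C⇒ = spoke-on s (pt-at s (u ⁻¹) (slope u v * u ⁻¹ + k))
        D⇒ : vertices d 3F on-line spoke s m κ → m * v ⁻¹ + κ ≡ slope u v * v ⁻¹ + k
        D⇒ = spoke-on s (pt-at s (v ⁻¹) (slope u v * v ⁻¹ + k))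

      -- The two vertices off the axis have different abscissas, so a vertical side contains one of
      -- the two vertices on the axis, whose abscissa fixes the frame.
      special-abscissa : ∀ d (V : Valid a d) s → Side (configuration d V) (vertical s 0#) → s ≡ proj₁ d
      special-abscissa d@(s′ , k , α , β , u , v) V s (i , j , i≢j , i-on , j-on) =
        two-of-four {P = λ i → vertices d i on-line vertical s 0#} {R = s ≡ s′}
          (λ A-on _ → 0⇒ (abscissa⇒ (k + α) A-on)) (λ A-on _ → 0⇒ (abscissa⇒ (k + α) A-on)) (λ A-on _ → 0⇒ (abscissa⇒ (k + α) A-on))
          (λ B-on _ → 0⇒ (abscissa⇒ (k + β) B-on)) (λ B-on _ → 0⇒ (abscissa⇒ (k + β) B-on))
          (λ C-on D-on → contradiction
            (trans (abscissa⇒ (slope u v * u ⁻¹ + k) C-on) (sym (abscissa⇒ (slope u v * v ⁻¹ + k) D-on)))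
            (independent⇒≢ (Valid.uv≢0 V) ∘ ⁻¹-injective u≢0 v≢0))
          i j i≢j i-on j-on
        where
        u≢0 = independent⇒≢0ˡ (Valid.uv≢0 V)
        v≢0 = independent⇒≢0ˡ (⟦,⟧-swap-≢0 (Valid.uv≢0 V))
        0⇒ : 0# ≡ s - s′ → s ≡ s′
        0⇒ eq = x-y≡0⇒x≡y s s′ (sym eq)
        vertical≡ : vertical s 0# ≡ vertical s′ (s - s′)
        vertical≡ = cong (λ x → line (1# ∷ 0# ∷ - x ∷ []) (0F , 1≢0)) (solve 2 (λ s s′ → s :+ :0 := s′ :+ (s :- s′)) refl s s′)
        abscissa⇒ : ∀ {X} Y → pt s′ X Y on-line vertical s 0# → X ≡ s - s′
        abscissa⇒ {X} Y on = vertical-on s′ (pt-at s′ X Y) (subst (pt s′ X Y on-line_) vertical≡ on)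

      module _ {s k α β u v k′ α′ β′ u′ v′} (V : Valid a (s , k , α , β , u , v)) (V′ : Valid a (s , k′ , α′ , β′ , u′ , v′))
        (to : ∀ {m κ} → IsSpoke (s , k , α , β , u , v) m κ → IsSpoke (s , k′ , α′ , β′ , u′ , v′) m κ)
        (from : ∀ {m κ} → IsSpoke (s , k′ , α′ , β′ , u′ , v′) m κ → IsSpoke (s , k , α , β , u , v) m κ) where
        private
          M = slope u v
          M′ = slope u′ v′

          ∈≢0 : ∀ {d τ} (V : Valid a d) → let (_ , _ , α , β , _) = d in τ ≡ α ⊎ τ ≡ β → τ ≢ 0#
          ∈≢0 V (inj₁ refl) = Valid.α≢0 V
          ∈≢0 V (inj₂ refl) = Valid.β≢0 V

          +≡⇒≡0 : ∀ {k τ} → k + τ ≡ k → τ ≡ 0#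
          +≡⇒≡0 {k} eq = plus-cancel (trans eq (sym (+-identityʳ k)))

          spoke-cancel : ∀ {M τ ω ω′} → τ ≢ 0# → M - τ * ω ≡ M - τ * ω′ → ω ≡ ω′
          spoke-cancel {M} {τ} {ω} {ω′} τ≢0 eq = *-cancelˡ τ≢0 (lin₁ (- 1#) eq
            (solve 4 (λ M τ ω ω′ → τ :* ω :- τ :* ω′ := :- :1 :* (M :- τ :* ω :- (M :- τ :* ω′))) refl M τ ω ω′))

          other : ∀ {ω} → ω ≡ u′ ⊎ ω ≡ v′ → ∃ λ ω′ → (ω′ ≡ u′ ⊎ ω′ ≡ v′) × ω′ ≢ ω
          other (inj₁ refl) = v′ , inj₂ refl , independent⇒≢ (Valid.uv≢0 V′) ∘ sym
          other (inj₂ refl) = u′ , inj₁ refl , independent⇒≢ (Valid.uv≢0 V′)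

          -- Two sides of different slopes pass through (0 , k′ + τ), whereas the central side is
          -- the only spoke of the first configuration through (0 , k). Hence central sides
          -- correspond to each other.
          not-off-centre : ∀ {τ ω} → τ ≡ α′ ⊎ τ ≡ β′ → ω ≡ u′ ⊎ ω ≡ v′ → k ≡ k′ + τ → M ≡ M′ - τ * ω → ⊥
          not-off-centre {τ} τ∈ ω∈ k≡ M≡ with other ω∈
          ... | ω₂ , ω₂∈ , ω₂≢ω with from (inj₁ (τ , ω₂ , τ∈ , ω₂∈ , k≡ , refl))
          ...   | inj₁ (τ₁ , _ , τ₁∈ , _ , k≡k+τ₁ , _) = ∈≢0 V τ₁∈ (+≡⇒≡0 (sym k≡k+τ₁))
          ...   | inj₂ (_ , eq) = ω₂≢ω (spoke-cancel (∈≢0 V′ τ∈) (trans eq M≡))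

          centre : k ≡ k′ × M ≡ M′
          centre with to (inj₂ (refl , refl))
          ... | inj₁ (_ , _ , τ∈ , ω∈ , k≡ , M≡) = ⊥-elim (not-off-centre τ∈ ω∈ k≡ M≡)
          ... | inj₂ eqs = eqs

          off-centre : ∀ {τ ω} → τ ≡ α ⊎ τ ≡ β → ω ≡ u ⊎ ω ≡ v → (τ ≡ α′ ⊎ τ ≡ β′) × (ω ≡ u′ ⊎ ω ≡ v′)
          off-centre {τ} {ω} τ∈ ω∈ with to (inj₁ (τ , ω , τ∈ , ω∈ , refl , refl))
          ... | inj₂ (k+τ≡k′ , _) = contradiction (+≡⇒≡0 (trans k+τ≡k′ (sym (proj₁ centre)))) (∈≢0 V τ∈)
          ... | inj₁ (τ′ , ω′ , τ′∈ , ω′∈ , k+τ≡ , M-τω≡) = subst (λ τ → τ ≡ α′ ⊎ τ ≡ β′) (sym τ≡τ′) τ′∈ ,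
              subst (λ ω → ω ≡ u′ ⊎ ω ≡ v′) (sym ω≡ω′) ω′∈
            where
            τ≡τ′ : τ ≡ τ′
            τ≡τ′ = plus-cancel (trans k+τ≡ (cong (_+ τ′) (sym (proj₁ centre))))
            ω≡ω′ : ω ≡ ω′
            ω≡ω′ = spoke-cancel (∈≢0 V τ∈) (trans M-τω≡ (cong₂ (λ M τ → M - τ * ω′) (sym (proj₂ centre)) (sym τ≡τ′)))

        spokes-determine : (s , k , α , β , u , v) ≋ (s , k′ , α′ , β′ , u′ , v′)
        spokes-determine = refl , proj₁ centre
          , unordered (Valid.α≢β V) (proj₁ (off-centre (inj₁ refl) (inj₁ refl))) (proj₁ (off-centre (inj₂ refl) (inj₁ refl)))
          , unordered (independent⇒≢ (Valid.uv≢0 V)) (proj₂ (off-centre (inj₁ refl) (inj₁ refl))) (proj₂ (off-centre (inj₁ refl) (inj₂ refl)))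

      open Setoid (BMSpecialTripleONan U) using () renaming (_≈_ to _≈ᴮ_; sym to ≈ᴮ-sym; trans to ≈ᴮ-trans)

      bm-special : Σ Parameter (Valid a) → Setoid.Carrier (BMSpecialTripleONan U)
      bm-special (d , V) = configuration d V , special d V

      bm-special-injective : ∀ d d′ → bm-special d ≈ᴮ bm-special d′ → proj₁ d ≋ proj₁ d′
      bm-special-injective (d , V) (d′ , V′) eq = same-frame V V′ s≡s′ eq
        where
        s≡s′ = special-abscissa d′ V′ (proj₁ d) (Equivalence.to (eq (vertical (proj₁ d) 0#)) (proj₁ (proj₂ (special d V))))
        same-frame : ∀ {s k α β u v s′ k′ α′ β′ u′ v′} (V : Valid a (s , k , α , β , u , v)) (V′ : Valid a (s′ , k′ , α′ , β′ , u′ , v′)) →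
          s ≡ s′ → bm-special (_ , V) ≈ᴮ bm-special (_ , V′) → (s , k , α , β , u , v) ≋ (s′ , k′ , α′ , β′ , u′ , v′)
        same-frame {s} {k} {α} {β} {u} {v} {_} {k′} {α′} {β′} {u′} {v′} V V′ refl eq = spokes-determine V V′
          (λ {m} {κ} sp → side⇒spoke (s , k′ , α′ , β′ , u′ , v′) V′ (Equivalence.to (eq (spoke s m κ)) (spoke⇒side (s , k , α , β , u , v) V sp)))
          (λ {m} {κ} sp → side⇒spoke (s , k , α , β , u , v) V (Equivalence.from (eq (spoke s m κ)) (spoke⇒side (s , k′ , α′ , β′ , u′ , v′) V′ sp)))

      -- Relabelling the vertices, and the bijection with parameters

      HasParameterᵠ : Parameter → ONanQuadrangle U → Permutation′ 4 → Set c
      HasParameterᵠ d Q σ = HasParameter d (vertex Q (σ ⟨$⟩ʳ 0F)) (vertex Q (σ ⟨$⟩ʳ 1F)) (vertex Q (σ ⟨$⟩ʳ 2F)) (vertex Q (σ ⟨$⟩ʳ 3F))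

      parameter⇒≈ : ∀ B (σ : Permutation′ 4) d → HasParameterᵠ (proj₁ d) (proj₁ B) σ → B ≈ᴮ bm-special d
      parameter⇒≈ (Q , _) σ (d@(s , k , α , β , u , v) , V) (hasParameter A-at B-at C-at D-at) l = mk⇔
        (λ (i , j , i≢j , i-on , j-on) → σ ⟨$⟩ˡ i , σ ⟨$⟩ˡ j , (λ eq → i≢j (injectiveˡ eq)) , to i i-on , to j j-on)
        (λ (i , j , i≢j , i-on , j-on) → σ ⟨$⟩ʳ i , σ ⟨$⟩ʳ j , (λ eq → i≢j (injectiveʳ eq)) , from i i-on , from j j-on)
        where
        vertices∼ : ∀ i → coords (vertices d i) ∼ coords (vertex Q (σ ⟨$⟩ʳ i))
        vertices∼ 0F = At-unique s (pt-at s 0# (k + α)) A-at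
        vertices∼ 1F = At-unique s (pt-at s 0# (k + β)) B-at
        vertices∼ 2F = At-unique s (pt-at s (u ⁻¹) (slope u v * u ⁻¹ + k)) C-at
        vertices∼ 3F = At-unique s (pt-at s (v ⁻¹) (slope u v * v ⁻¹ + k)) D-at
        from : ∀ i → vertices d i on-line l → vertex Q (σ ⟨$⟩ʳ i) on-line l
        from i = on-∼ {vertices d i} {vertex Q (σ ⟨$⟩ʳ i)} {l} (vertices∼ i)
        to : ∀ i → vertex Q i on-line l → vertices d (σ ⟨$⟩ˡ i) on-line l
        to i i-on = on-∼ {vertex Q (σ ⟨$⟩ʳ (σ ⟨$⟩ˡ i))} {vertices d (σ ⟨$⟩ˡ i)} {l} (∼-sym (vertices∼ (σ ⟨$⟩ˡ i)))
          (subst (λ j → vertex Q j on-line l) (sym (Perm.inverseʳ σ)) i-on)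
        injectiveˡ : ∀ {i j} → σ ⟨$⟩ˡ i ≡ σ ⟨$⟩ˡ j → i ≡ j
        injectiveˡ eq = trans (sym (Perm.inverseʳ σ)) (trans (cong (σ ⟨$⟩ʳ_) eq) (Perm.inverseʳ σ))
        injectiveʳ : ∀ {i j} → σ ⟨$⟩ʳ i ≡ σ ⟨$⟩ʳ j → i ≡ j
        injectiveʳ eq = trans (sym (Perm.inverseˡ σ)) (trans (cong (σ ⟨$⟩ˡ_) eq) (Perm.inverseˡ σ))

      parameter-swap-αβ : ∀ {s k α β u v A B C D} → HasParameter (s , k , α , β , u , v) A B C D → HasParameter (s , k , β , α , u , v) B A C D
      parameter-swap-αβ (hasParameter A-at B-at C-at D-at) = hasParameter B-at A-at C-at D-at

      parameter-swap-uv : ∀ {s k α β u v A B C D} → ⟦ u , v ⟧ ≢ 0# →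
        HasParameter (s , k , α , β , u , v) A B C D → HasParameter (s , k , α , β , v , u) A B D C
      parameter-swap-uv {s} {k} {u = u} {v} uv≢0 (hasParameter A-at B-at C-at D-at) = hasParameter A-at B-at
        (At-≡ s refl (cong (λ m → m * v ⁻¹ + k) (sym (slope-swap u v uv≢0))) D-at)
        (At-≡ s refl (cong (λ m → m * u ⁻¹ + k) (sym (slope-swap u v uv≢0))) C-at)

      configuration-parameter : ∀ d V → HasParameterᵠ d (configuration d V) Perm.id
      configuration-parameter (s , k , α , β , u , v) _ = hasParameter (pt-at s 0# (k + α)) (pt-at s 0# (k + β))
        (pt-at s (u ⁻¹) (slope u v * u ⁻¹ + k)) (pt-at s (v ⁻¹) (slope u v * v ⁻¹ + k))

      bm-special-cong : ∀ d d′ → proj₁ d ≋ proj₁ d′ → bm-special d ≈ᴮ bm-special d′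
      bm-special-cong ((s , k , α , β , u , v) , V) (d′ , V′) (refl , refl , αβ , uv) = cong≈ αβ uv
        where
        d = s , k , α , β , u , v
        has = configuration-parameter d V
        cong≈ : _ → _ → bm-special (d , V) ≈ᴮ bm-special (d′ , V′)
        cong≈ (inj₁ (refl , refl)) (inj₁ (refl , refl)) = parameter⇒≈ (bm-special (d , V)) Perm.id (d′ , V′) has
        cong≈ (inj₂ (refl , refl)) (inj₁ (refl , refl)) = parameter⇒≈ (bm-special (d , V)) (transpose 0F 1F) (d′ , V′) (parameter-swap-αβ has)
        cong≈ (inj₁ (refl , refl)) (inj₂ (refl , refl)) = parameter⇒≈ (bm-special (d , V)) (transpose 2F 3F) (d′ , V′) (parameter-swap-uv (Valid.uv≢0 V) has)
        cong≈ (inj₂ (refl , refl)) (inj₂ (refl , refl)) = parameter⇒≈ (bm-special (d , V)) (transpose 0F 1F ∘ₚ transpose 2F 3F) (d′ , V′)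
          (parameter-swap-αβ (parameter-swap-uv (Valid.uv≢0 V) has))

      module Relabelling (Q : ONanQuadrangle U) where
        Meet : Fin 4 → Fin 4 → Fin 4 → Fin 4 → Set c
        Meet i j k l = MeetInUnital U (vertex Q i) (vertex Q j) (vertex Q k) (vertex Q l)

        record Labelling : Set c where
          constructor labelling
          field
            label : Permutation′ 4
            meet₁ : Meet (label ⟨$⟩ʳ 0F) (label ⟨$⟩ʳ 1F) (label ⟨$⟩ʳ 2F) (label ⟨$⟩ʳ 3F)
            meet₂ : Meet (label ⟨$⟩ʳ 0F) (label ⟨$⟩ʳ 2F) (label ⟨$⟩ʳ 1F) (label ⟨$⟩ʳ 3F)
            meet₃ : Meet (label ⟨$⟩ʳ 0F) (label ⟨$⟩ʳ 3F) (label ⟨$⟩ʳ 1F) (label ⟨$⟩ʳ 2F)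

        open Labelling

        swap : ∀ {i j k l} → Meet i j k l → Meet k l i j
        swap {i} {j} {k} {l} = meet-swap {U} {vertex Q i} {vertex Q j} {vertex Q k} {vertex Q l}

        flip : ∀ {i j k l} → Meet i j k l → Meet j i k l
        flip {i} {j} {k} {l} = meet-flip {U} {vertex Q i} {vertex Q j} {vertex Q k} {vertex Q l}

        flip₂ : ∀ {i j k l} → Meet i j k l → Meet i j l k
        flip₂ m = swap (flip (swap m))

        identity : Labelling
        identity = labelling Perm.id (diagonal₁ Q) (diagonal₂ Q) (diagonal₃ Q)

        -- An exchange of two adjacent labels preserves one of the three pairings and interchanges
        -- the other two. Compositions of these exchanges bring any two vertices to the first two
        -- places.
        [01] [12] [23] : Labelling → Labelling
        [01] (labelling σ m₁ m₂ m₃) = labelling (transpose 0F 1F ∘ₚ σ) (flip m₁) (swap m₃) (swap m₂)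
        [12] (labelling σ m₁ m₂ m₃) = labelling (transpose 1F 2F ∘ₚ σ) m₂ m₁ (flip₂ m₃)
        [23] (labelling σ m₁ m₂ m₃) = labelling (transpose 2F 3F ∘ₚ σ) (flip₂ m₁) m₃ m₂

        relabel : ∀ i j → i ≢ j → ∃ λ L → label L ⟨$⟩ʳ 0F ≡ i × label L ⟨$⟩ʳ 1F ≡ j
        relabel = λ where
          0F 0F i≢j → contradiction refl i≢j
          1F 1F i≢j → contradiction refl i≢j
          2F 2F i≢j → contradiction refl i≢j
          3F 3F i≢j → contradiction refl i≢j
          0F 1F _ → identity , refl , refl
          0F 2F _ → [12] identity , refl , refl
          0F 3F _ → [12] ([23] identity) , refl , refl
          1F 0F _ → [01] identity , refl , refl
          1F 2F _ → [12] ([01] identity) , refl , refl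
          1F 3F _ → [12] ([23] ([01] identity)) , refl , refl
          2F 0F _ → [01] ([12] identity) , refl , refl
          2F 1F _ → [01] ([12] ([01] identity)) , refl , refl
          2F 3F _ → [12] ([23] ([01] ([12] identity))) , refl , refl
          3F 0F _ → [01] ([12] ([23] identity)) , refl , refl
          3F 1F _ → [01] ([12] ([23] ([01] identity))) , refl , refl
          3F 2F _ → [01] ([12] ([23] ([01] ([12] identity)))) , refl , refl

        quadrangle : ∀ L → let σ = label L in
          Quadrangle (vertex Q (σ ⟨$⟩ʳ 0F)) (vertex Q (σ ⟨$⟩ʳ 1F)) (vertex Q (σ ⟨$⟩ʳ 2F)) (vertex Q (σ ⟨$⟩ʳ 3F))
        quadrangle (labelling σ m₁ m₂ m₃) = record
          { A∈U = vertex∈U Q (σ ⟨$⟩ʳ 0F)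
          ; B∈U = vertex∈U Q (σ ⟨$⟩ʳ 1F)
          ; C∈U = vertex∈U Q (σ ⟨$⟩ʳ 2F)
          ; D∈U = vertex∈U Q (σ ⟨$⟩ʳ 3F)
          ; ¬ABC = noThree 0F 1F 2F (λ ()) (λ ()) (λ ())
          ; ¬ABD = noThree 0F 1F 3F (λ ()) (λ ()) (λ ())
          ; ¬ACD = noThree 0F 2F 3F (λ ()) (λ ()) (λ ())
          ; ¬BCD = noThree 1F 2F 3F (λ ()) (λ ()) (λ ())
          ; AB∧CD = m₁
          ; AC∧BD = m₂
          ; AD∧BC = m₃
          }
          where
          injective : ∀ {i j} → i ≢ j → σ ⟨$⟩ʳ i ≢ σ ⟨$⟩ʳ j
          injective i≢j eq = i≢j (trans (sym (Perm.inverseˡ σ)) (trans (cong (σ ⟨$⟩ˡ_) eq) (Perm.inverseˡ σ)))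
          noThree : ∀ i j k → i ≢ j → j ≢ k → i ≢ k → ¬ Collinear (vertex Q (σ ⟨$⟩ʳ i)) (vertex Q (σ ⟨$⟩ʳ j)) (vertex Q (σ ⟨$⟩ʳ k))
          noThree i j k i≢j j≢k i≢k = noThreeCollinear Q (σ ⟨$⟩ʳ i) (σ ⟨$⟩ʳ j) (σ ⟨$⟩ʳ k) (injective i≢j) (injective j≢k) (injective i≢k)

        parametrise : BMSpecial U Q → ∃₂ λ (σ : Permutation′ 4) (d : Σ Parameter (Valid a)) → HasParameterᵠ (proj₁ d) Q σ
        parametrise (l , (i , j , i≢j , i-on , j-on) , T∞-on-l) = label L , (proj₁ nf , proj₁ (proj₂ nf)) , proj₂ (proj₂ nf)
          where
          L = proj₁ (relabel i j i≢j)
          nf = normal-form (quadrangle L) l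
            (subst (λ i → vertex Q i on-line l) (sym (proj₁ (proj₂ (relabel i j i≢j)))) i-on)
            (subst (λ i → vertex Q i on-line l) (sym (proj₂ (proj₂ (relabel i j i≢j)))) j-on)
            T∞-on-l

      -- The map `from` depends on the special side and the labelling supplied with a quadrangle.
      -- Injectivity of `bm-special` shows that it nevertheless respects equality of configurations.
      parametrisation : Inverse (parameters a) (BMSpecialTripleONan U)
      parametrisation = record
        { to = bm-special
        ; from = from
        ; to-cong = λ {d} {d′} → bm-special-cong d d′
        ; from-cong = λ {Q} {Q′} Q≈Q′ → bm-special-injective (from Q) (from Q′)
            (≈ᴮ-trans {bm-special (from Q)} {Q} {bm-special (from Q′)} (≈ᴮ-sym {Q} {bm-special (from Q)} (Q≈ Q))
              (≈ᴮ-trans {Q} {Q′} {bm-special (from Q′)} Q≈Q′ (Q≈ Q′)))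
        ; inverse =
            (λ {Q} {d} d≋ → ≈ᴮ-trans {bm-special d} {bm-special (from Q)} {Q} (bm-special-cong d (from Q) d≋) (≈ᴮ-sym {Q} {bm-special (from Q)} (Q≈ Q)))
          , (λ {d} {Q} Q≈d → bm-special-injective (from Q) d
              (≈ᴮ-trans {bm-special (from Q)} {Q} {bm-special d} (≈ᴮ-sym {Q} {bm-special (from Q)} (Q≈ Q)) Q≈d))
        }
        where
        from : Setoid.Carrier (BMSpecialTripleONan U) → Σ Parameter (Valid a)
        from (Q , Q-special) = proj₁ (proj₂ (Relabelling.parametrise Q Q-special))
        Q≈ : ∀ Q → Q ≈ᴮ bm-special (from Q)
        Q≈ (Q , Q-special) = parameter⇒≈ (Q , Q-special) (proj₁ (Relabelling.parametrise Q Q-special)) (from (Q , Q-special))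
          (proj₂ (proj₂ (Relabelling.parametrise Q Q-special)))

-- Equality of the two counts

open import Data.Nat.Base using (_^_)

theorem5 : ∀ {c} (q : ℕ) → OddPrimePower q →
    (F : FiniteField c (q ^ 2)) →
    let open FiniteField F
        open PG2 q F
    in
    (a b a′ b′ : Carrier) →
    IsOrthogonalBM a b → IsOrthogonalBM a′ b′ →
    ¬ Classical (𝒰 a b) → ¬ Classical (𝒰 a′ b′) →
    (IsSquare a × IsSquare a′) ⊎ (¬ IsSquare a × ¬ IsSquare a′) →
    ∃[ n ] HasCardinality (BMSpecialTripleONan (𝒰 a b)) n
         × HasCardinality (BMSpecialTripleONan (𝒰 a′ b′)) n
theorem5 q q-odd F a b a′ b′ bm bm′ nonclassical nonclassical′ class =
  n , Composition.inverse (Symmetry.inverse (Affine.Orthogonal.parametrisation F q-odd a b bm)) parameters↔n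
    , Composition.inverse (Symmetry.inverse (Affine.Orthogonal.parametrisation F q-odd a′ b′ bm′)) parameters′↔n
  where
  open Conjugation using (module Affine; parameters; parameters-finite; rescaled-parameters; square-class-ratio)
  n = proj₁ (parameters-finite F q-odd a)
  parameters↔n = proj₂ (parameters-finite F q-odd a)
  ratio = square-class-ratio F q-odd
    (λ a≡0 → nonclassical (Affine.classical F q-odd a b bm a≡0))
    (λ a′≡0 → nonclassical′ (Affine.classical F q-odd a′ b′ bm′ a′≡0))
    class
  parameters′↔n : HasCardinality (parameters F q-odd a′) n
  parameters′↔n = subst (λ z → HasCardinality (parameters F q-odd z) n) (sym (proj₂ (proj₂ ratio)))
    (Composition.inverse (Symmetry.inverse (rescaled-parameters F q-odd (proj₁ (proj₂ ratio)))) parameters↔n)
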